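{- Let $G$ be a tree on $n\geq 2$ vertices with Randi\'c index $R$ and radius $r$. If $G$ is a path with an even number of vertices, greater than $2$, then \[R-r=\sqrt 2-\frac{3}{2};\] otherwise \[R-r\geq 0,\] with equality for the path on $2$ vertices.
   Context: The Randi\'c index is $R(G)=\sum_{uv\in E(G)}\frac{1}{\sqrt{d_ud_v}}$, where $d_v$ is the degree of $v$. The radius is the minimum over vertices $v$ of the maximum distance from $v$ to another vertex. -}

module Defs where

open import Data.Nat as ℕ using (ℕ; zero; suc; z≤n; s≤s)
import Data.Nat.Properties as ℕₚ
open import Data.Nat.Solver using () renaming (module +-*-Solver to ℕ-Solver)
open import Data.Integer as ℤ using (+_)
import Data.Integer.Properties as ℤₚ
open import Data.Integer.Solver using () renaming (module +-*-Solver to ℤ-Solver)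
open import Data.Rational.Unnormalised as ℚᵘ
  using (ℚᵘ; mkℚᵘ; 0ℚᵘ; _+_; _*_; _-_; -_; 1/_; _≤_; _≃_; *≤*; *≡*;
         Positive; positive)
import Data.Rational.Unnormalised.Properties as ℚₚ
open import Data.Rational.Unnormalised.Solver using () renaming (module +-*-Solver to ℚ-Solver)
open import Data.Fin as Fin using (Fin; toℕ)
import Data.Fin.Properties as Finₚ
open import Data.Fin.Permutation using (Permutation; _⟨$⟩ʳ_)
open import Data.List using (List; []; _∷_; length; map; foldr; filter; allFin; cartesianProduct)
open import Data.List.Extrema.Nat using (min; max)
open import Data.List.Relation.Unary.Unique.Propositional using (Unique)
open import Data.Product using (∃; _×_; _,_; proj₁; proj₂)
open import Data.Sum using (_⊎_; inj₁; inj₂; swap)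
open import Function.Bundles using (_⇔_)
open import Relation.Nullary using (¬_; Dec; yes; no; contradiction)
open import Relation.Nullary.Decidable using (map′; ¬?; _×-dec_; _⊎-dec_)
open import Relation.Binary.PropositionalEquality using (_≡_; refl; sym; cong; subst₂)

------------------------------------------------------------------------
-- Real numbers: Bishop's regular sequences of rationals

ε : ℕ → ℚᵘ
ε n = mkℚᵘ (+ 1) n  -- 1 / (n + 1)

-- The bounds below are one-sided, but m and n range over all of ℕ, so
-- `regular` says  ∣ seq m - seq n ∣ ≤ 1/(m+1) + 1/(n+1).
record ℝ : Set where
  constructor mkℝ
  field
    seq     : ℕ → ℚᵘ
    regular : ∀ m n → seq m - seq n ≤ ε m + ε n

open ℝ public

infix 4 _≤ℝ_ _≃ℝ_

_≤ℝ_ : ℝ → ℝ → Set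
x ≤ℝ y = ∀ n → seq x n - seq y n ≤ ε n + ε n

-- That is,  ∣ seq x n - seq y n ∣ ≤ 2/(n+1)  for all n.
_≃ℝ_ : ℝ → ℝ → Set
x ≃ℝ y = x ≤ℝ y × y ≤ℝ x

private
  0≤ε+ε : ∀ m n → 0ℚᵘ ≤ ε m + ε n
  0≤ε+ε m n = ℚₚ.nonNegative⁻¹ (ε m + ε n)

  ε-half : ∀ n → ε (suc (n ℕ.+ n)) + ε (suc (n ℕ.+ n)) ≃ ε n
  ε-half n = *≡* (cong +_ (solve 1 (λ n →
      let d = con 2 :+ (n :+ n) in
      (con 1 :* d :+ con 1 :* d) :* (con 1 :+ n) := con 1 :* (d :* d)) refl n))
    where open ℕ-Solver

fromℚ : ℚᵘ → ℝ
fromℚ q = mkℝ (λ _ → q) λ m n →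
  ℚₚ.≤-trans (ℚₚ.≤-reflexive (ℚₚ.+-inverseʳ q)) (0≤ε+ε m n)

fromℕ : ℕ → ℝ
fromℕ n = fromℚ (mkℚᵘ (+ n) 0)

0ℝ : ℝ
0ℝ = fromℕ 0

infixl 6 _+ℝ_ _-ℝ_
infix  8 -ℝ_

-- Summands are taken at index 2n+1, where they have precision 1/(2(n+1)).
_+ℝ_ : ℝ → ℝ → ℝ
x +ℝ y = mkℝ (λ n → seq x (h n) + seq y (h n)) reg
  where
  h : ℕ → ℕ
  h n = suc (n ℕ.+ n)
  open ℚₚ.≤-Reasoning
  reg : ∀ m n → (seq x (h m) + seq y (h m)) - (seq x (h n) + seq y (h n)) ≤ ε m + ε n
  reg m n = begin
    (seq x (h m) + seq y (h m)) - (seq x (h n) + seq y (h n))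
      ≃⟨ solve 4 (λ a b c d → (a :+ b) :- (c :+ d) := (a :- c) :+ (b :- d)) ℚₚ.≃-refl
           (seq x (h m)) (seq y (h m)) (seq x (h n)) (seq y (h n)) ⟩
    (seq x (h m) - seq x (h n)) + (seq y (h m) - seq y (h n))
      ≤⟨ ℚₚ.+-mono-≤ (regular x (h m) (h n)) (regular y (h m) (h n)) ⟩
    (ε (h m) + ε (h n)) + (ε (h m) + ε (h n))
      ≃⟨ solve 2 (λ a b → (a :+ b) :+ (a :+ b) := (a :+ a) :+ (b :+ b)) ℚₚ.≃-refl
           (ε (h m)) (ε (h n)) ⟩
    (ε (h m) + ε (h m)) + (ε (h n) + ε (h n))
      ≃⟨ ℚₚ.+-cong (ε-half m) (ε-half n) ⟩
    ε m + ε n ∎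
    where open ℚ-Solver

-ℝ_ : ℝ → ℝ
-ℝ x = mkℝ (λ n → - seq x n) reg
  where
  open ℚₚ.≤-Reasoning
  reg : ∀ m n → (- seq x m) - (- seq x n) ≤ ε m + ε n
  reg m n = begin
    (- seq x m) - (- seq x n)
      ≃⟨ solve 2 (λ a b → (:- a) :- (:- b) := b :- a) ℚₚ.≃-refl (seq x m) (seq x n) ⟩
    seq x n - seq x m  ≤⟨ regular x n m ⟩
    ε n + ε m          ≃⟨ ℚₚ.+-comm (ε n) (ε m) ⟩
    ε m + ε n          ∎
    where open ℚ-Solver

_-ℝ_ : ℝ → ℝ → ℝ
x -ℝ y = x +ℝ (-ℝ y)

sumℝ : List ℝ → ℝ
sumℝ = foldr _+ℝ_ 0ℝ

record Positiveℝ (x : ℝ) : Set where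
  field
    bound : ℕ
    lower : ∀ n → bound ℕ.≤ n → ε bound ≤ seq x n

-- The reciprocal of x ≥ 1/(K+1) > 0.  On [1/(K+1), ∞) inversion is
-- Lipschitz with constant (K+1)², so x is read at precision
-- 1/((n+1)(K+1)²).
_⁻¹[_] : (x : ℝ) → Positiveℝ x → ℝ
x ⁻¹[ x>0 ] = mkℝ inv reg
  where
  open Positiveℝ x>0 renaming (bound to K)

  i : ℕ → ℕ
  i n = ℕ.pred (suc n ℕ.* (suc K ℕ.* suc K))

  K≤i : ∀ n → K ℕ.≤ i n
  K≤i n = ℕ.s≤s⁻¹ (ℕₚ.≤-trans (ℕₚ.m≤m*n (suc K) (suc K))
                                (ℕₚ.m≤n*m (suc K ℕ.* suc K) (suc n)))

  ε≤x : ∀ n → ε K ≤ seq x (i n)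
  ε≤x n = lower (i n) (K≤i n)

  x-pos : ∀ n → Positive (seq x (i n))
  x-pos n = positive (ℚₚ.<-≤-trans (ℚₚ.positive⁻¹ (ε K)) (ε≤x n))

  inv : ℕ → ℚᵘ
  inv n = (1/ seq x (i n)) {{ℚₚ.pos⇒nonZero (seq x (i n)) {{x-pos n}}}}

  k : ℚᵘ
  k = mkℚᵘ (+ suc K) 0

  inv≤k : ∀ n → inv n ≤ k
  inv≤k n = ℚₚ.1/-antimono-≤-pos {ε K} {seq x (i n)} {{_}} {{x-pos n}} (ε≤x n)

  0≤inv : ∀ n → 0ℚᵘ ≤ inv n
  0≤inv n = ℚₚ.<⇒≤ (ℚₚ.positive⁻¹ (inv n) {{ℚₚ.1/pos⇒pos (seq x (i n)) {{x-pos n}}}})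

  ε-scale : ∀ n → ε (i n) * (k * k) ≃ ε n
  ε-scale n = *≡* (cong +_ (solve 2 (λ n K → let k = con 1 :+ K in
      (con 1 :* (k :* k)) :* (con 1 :+ n) :=
      con 1 :* (((con 1 :+ n) :* (k :* k)) :* con 1)) refl n K))
    where open ℕ-Solver

  open ℚₚ.≤-Reasoning
  reg : ∀ m n → inv m - inv n ≤ ε m + ε n
  reg m n = begin
    inv m - inv n
      ≃⟨ ℚₚ.+-cong (ℚₚ.≃-sym (ℚₚ.*-identityʳ (inv m)))
                   (ℚₚ.-‿cong (ℚₚ.≃-sym (ℚₚ.*-identityʳ (inv n)))) ⟩
    inv m * ℚᵘ.1ℚᵘ - inv n * ℚᵘ.1ℚᵘ
      ≃⟨ ℚₚ.+-cong (ℚₚ.*-congˡ {inv m} (ℚₚ.≃-sym (ℚₚ.*-inverseʳ b {{b≢0}})))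
                   (ℚₚ.-‿cong (ℚₚ.*-congˡ {inv n} (ℚₚ.≃-sym (ℚₚ.*-inverseʳ a {{a≢0}})))) ⟩
    inv m * (b * inv n) - inv n * (a * inv m)
      ≃⟨ solve 4 (λ a b a' b' → a' :* (b :* b') :- b' :* (a :* a') :=
                                (b :- a) :* (a' :* b')) ℚₚ.≃-refl a b (inv m) (inv n) ⟩
    (b - a) * (inv m * inv n)
      ≤⟨ ℚₚ.*-monoˡ-≤-nonNeg (inv m * inv n) {{nn}} (regular x (i n) (i m)) ⟩
    (ε (i n) + ε (i m)) * (inv m * inv n)
      ≤⟨ ℚₚ.*-monoʳ-≤-nonNeg (ε (i n) + ε (i m))
           (ℚₚ.*-mono-≤-nonNeg {{ℚᵘ.nonNegative (0≤inv m)}} {{ℚᵘ.nonNegative (0≤inv n)}}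
             (inv≤k m) (inv≤k n)) ⟩
    (ε (i n) + ε (i m)) * (k * k)
      ≃⟨ ℚₚ.*-distribʳ-+ (k * k) (ε (i n)) (ε (i m)) ⟩
    ε (i n) * (k * k) + ε (i m) * (k * k)
      ≃⟨ ℚₚ.+-cong (ε-scale n) (ε-scale m) ⟩
    ε n + ε m  ≃⟨ ℚₚ.+-comm (ε n) (ε m) ⟩
    ε m + ε n  ∎
    where
    open ℚ-Solver
    a b : ℚᵘ
    a = seq x (i m)
    b = seq x (i n)
    a≢0 : ℚᵘ.NonZero a
    a≢0 = ℚₚ.pos⇒nonZero a {{x-pos m}}
    b≢0 : ℚᵘ.NonZero b
    b≢0 = ℚₚ.pos⇒nonZero b {{x-pos n}}
    nn : ℚᵘ.NonNegative (inv m * inv n)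
    nn = ℚₚ.nonNeg*nonNeg⇒nonNeg (inv m) {{ℚᵘ.nonNegative (0≤inv m)}}
                                 (inv n) {{ℚᵘ.nonNegative (0≤inv n)}}

------------------------------------------------------------------------
-- Square roots of natural numbers

isqrt : ∀ m → ∃ λ s → s ℕ.* s ℕ.≤ m × m ℕ.< suc s ℕ.* suc s
isqrt zero = 0 , z≤n , s≤s z≤n
isqrt (suc m) with isqrt m
... | s , s²≤m , m<s⁺² with suc s ℕ.* suc s ℕ.≤? suc m
...   | no  s⁺²≰m⁺ = s , ℕₚ.m≤n⇒m≤1+n s²≤m , ℕₚ.≰⇒> s⁺²≰m⁺
...   | yes s⁺²≤m⁺ = suc s , s⁺²≤m⁺ ,
        ℕₚ.≤-<-trans m<s⁺² (ℕₚ.*-mono-< (ℕₚ.n<1+n (suc s)) (ℕₚ.n<1+n (suc s)))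

⌊√_⌋ : ℕ → ℕ
⌊√ m ⌋ = proj₁ (isqrt m)

private
  cross⇒≤ : ∀ a p b q → a ℕ.* suc q ℕ.≤ b ℕ.* suc p → mkℚᵘ (+ a) p ≤ mkℚᵘ (+ b) q
  cross⇒≤ a p b q le =
    *≤* (subst₂ ℤ._≤_ (ℤₚ.pos-* a (suc q)) (ℤₚ.pos-* b (suc p)) (ℤ.+≤+ le))

-- The n-th approximation is  ⌊(n+1)√m⌋ / (n+1).
√_ : ℕ → ℝ
√ m = mkℝ approx reg
  where
  s : ℕ → ℕ
  s n = ⌊√ m ℕ.* (suc n ℕ.* suc n) ⌋

  approx : ℕ → ℚᵘ
  approx n = mkℚᵘ (+ s n) n

  cross : ∀ p q → s p ℕ.* suc q ℕ.< suc (s q) ℕ.* suc p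
  cross p q = ℕₚ.≰⇒> λ le → ℕₚ.<-irrefl refl (begin-strict
      (suc (s q) ℕ.* suc p) ℕ.* (suc (s q) ℕ.* suc p)  ≤⟨ ℕₚ.*-mono-≤ le le ⟩
      (s p ℕ.* suc q) ℕ.* (s p ℕ.* suc q)              ≡⟨ sq (s p) (suc q) ⟩
      (s p ℕ.* s p) ℕ.* (suc q ℕ.* suc q)
        ≤⟨ ℕₚ.*-monoˡ-≤ (suc q ℕ.* suc q) (proj₁ (proj₂ (isqrt (m ℕ.* (suc p ℕ.* suc p))))) ⟩
      (m ℕ.* (suc p ℕ.* suc p)) ℕ.* (suc q ℕ.* suc q)
        ≡⟨ exch m (suc p ℕ.* suc p) (suc q ℕ.* suc q) ⟩
      (m ℕ.* (suc q ℕ.* suc q)) ℕ.* (suc p ℕ.* suc p)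
        <⟨ ℕₚ.*-monoˡ-< (suc p ℕ.* suc p) (proj₂ (proj₂ (isqrt (m ℕ.* (suc q ℕ.* suc q))))) ⟩
      (suc (s q) ℕ.* suc (s q)) ℕ.* (suc p ℕ.* suc p)  ≡⟨ sq (suc (s q)) (suc p) ⟨
      (suc (s q) ℕ.* suc p) ℕ.* (suc (s q) ℕ.* suc p)  ∎)
    where
    open ℕₚ.≤-Reasoning
    open ℕ-Solver
    sq : ∀ a b → (a ℕ.* b) ℕ.* (a ℕ.* b) ≡ (a ℕ.* a) ℕ.* (b ℕ.* b)
    sq = solve 2 (λ a b → (a :* b) :* (a :* b) := (a :* a) :* (b :* b)) refl
    exch : ∀ a b c → (a ℕ.* b) ℕ.* c ≡ (a ℕ.* c) ℕ.* b
    exch = solve 3 (λ a b c → (a :* b) :* c := (a :* c) :* b) refl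

  open ℚₚ.≤-Reasoning
  reg : ∀ p q → approx p - approx q ≤ ε p + ε q
  reg p q = begin
    approx p - approx q        ≤⟨ ℚₚ.+-monoˡ-≤ (- approx q) below ⟩
    (approx q + ε q) - approx q
      ≃⟨ solve 2 (λ a b → (a :+ b) :- a := b) ℚₚ.≃-refl (approx q) (ε q) ⟩
    ε q                        ≤⟨ ℚₚ.p≤q⇒p≤r+q (ε p) (ℚₚ.≤-refl {ε q}) ⟩
    ε p + ε q                  ∎
    where
    open ℚ-Solver
    succ≃ : mkℚᵘ (+ suc (s q)) q ≃ approx q + ε q
    succ≃ = *≡* (Z.solve 2 (λ a d →
        (Z.con (+ 1) Z.:+ a) Z.:* (d Z.:* d) Z.:= (a Z.:* d Z.:+ Z.con (+ 1) Z.:* d) Z.:* d)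
        refl (+ s q) (+ suc q))
      where module Z = ℤ-Solver
    below : approx p ≤ approx q + ε q
    below = ℚₚ.≤-trans (cross⇒≤ (s p) p (suc (s q)) q (ℕₚ.<⇒≤ (cross p q))) (ℚₚ.≤-reflexive succ≃)

√-pos : ∀ d → Positiveℝ (√ (suc d))
√-pos d = record { bound = 0 ; lower = λ n _ → cross⇒≤ 1 0 ⌊√ suc d ℕ.* (suc n ℕ.* suc n) ⌋ n (le n) }
  where
  le : ∀ n → 1 ℕ.* suc n ℕ.≤ ⌊√ suc d ℕ.* (suc n ℕ.* suc n) ⌋ ℕ.* 1
  le n = begin
    1 ℕ.* suc n  ≡⟨ ℕₚ.*-identityˡ (suc n) ⟩
    suc n        ≤⟨ n<s ⟩
    s            ≡⟨ ℕₚ.*-identityʳ s ⟨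
    s ℕ.* 1      ∎
    where
    open ℕₚ.≤-Reasoning
    M s : ℕ
    M = suc d ℕ.* (suc n ℕ.* suc n)
    s = ⌊√ M ⌋
    n<s : n ℕ.< s
    n<s = ℕₚ.≰⇒> λ s≤n → ℕₚ.<-irrefl refl (begin-strict
      M                  <⟨ proj₂ (proj₂ (isqrt M)) ⟩
      suc s ℕ.* suc s    ≤⟨ ℕₚ.*-mono-≤ (s≤s s≤n) (s≤s s≤n) ⟩
      suc n ℕ.* suc n    ≤⟨ ℕₚ.m≤n*m (suc n ℕ.* suc n) (suc d) ⟩
      M                  ∎)

-- The value at 0 is a convention; it is never used below, since the
-- endpoints of an edge have positive degree.
1/√_ : ℕ → ℝ
1/√ zero    = 0ℝ
1/√ (suc d) = (√ suc d) ⁻¹[ √-pos d ]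

------------------------------------------------------------------------
-- Finite simple graphs

record Graph (n : ℕ) : Set₁ where
  field
    Adj     : Fin n → Fin n → Set
    Adj?    : ∀ u v → Dec (Adj u v)
    Adj-sym : ∀ {u v} → Adj u v → Adj v u
    loopless : ∀ {v} → ¬ Adj v v

infix 4 _≅_

record _≅_ {m n : ℕ} (G : Graph m) (H : Graph n) : Set where
  field
    vertices : Permutation m n
    edges    : ∀ u v → Graph.Adj G u v ⇔ Graph.Adj H (vertices ⟨$⟩ʳ u) (vertices ⟨$⟩ʳ v)

pathGraph : ∀ n → Graph n
pathGraph n = record
  { Adj      = λ u v → toℕ v ≡ suc (toℕ u) ⊎ toℕ u ≡ suc (toℕ v)
  ; Adj?     = λ u v → (toℕ v ℕ.≟ suc (toℕ u)) ⊎-dec (toℕ u ℕ.≟ suc (toℕ v))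
  ; Adj-sym  = swap
  ; loopless = λ { (inj₁ e) → ℕₚ.1+n≢n (sym e) ; (inj₂ e) → ℕₚ.1+n≢n (sym e) }
  }

-- The least natural number satisfying P, given one that does.
least : {P : ℕ → Set} → (∀ k → Dec (P k)) → ∀ k → P k →
        ∃ λ m → P m × (∀ j → P j → m ℕ.≤ j)
least P? zero p = 0 , p , λ _ _ → z≤n
least P? (suc k) p with P? 0
... | yes p₀ = 0 , p₀ , λ _ _ → z≤n
... | no ¬p₀ with least (λ j → P? (suc j)) k p
...   | m , pm , m≤ = suc m , pm , λ
        { zero p₀ → contradiction p₀ ¬p₀ ; (suc j) pj → s≤s (m≤ j pj) }

minimum : List ℕ → ℕ
minimum []       = 0
minimum (x ∷ xs) = min x xs

module _ {n : ℕ} (G : Graph n) where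
  open Graph G

  degree : Fin n → ℕ
  degree v = length (filter (Adj? v) (allFin n))

  -- Each unordered edge is listed once, as the pair with u < v.
  edgeList : List (Fin n × Fin n)
  edgeList = filter (λ (u , v) → (u Fin.<? v) ×-dec Adj? u v)
                    (cartesianProduct (allFin n) (allFin n))

  randić : ℝ
  randić = sumℝ (map (λ (u , v) → 1/√ (degree u ℕ.* degree v)) edgeList)

  data Walk : ℕ → Fin n → Fin n → Set where
    []  : ∀ {v} → Walk 0 v v
    _∷_ : ∀ {k u v w} → Adj u v → Walk k v w → Walk (suc k) u w

  walk? : ∀ k u v → Dec (Walk k u v)
  walk? zero    u v = map′ (λ { refl → [] }) (λ { [] → refl }) (u Fin.≟ v)
  walk? (suc k) u v =
    map′ (λ (_ , a , p) → a ∷ p) (λ { (a ∷ p) → _ , a , p })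
         (Finₚ.any? (λ w → Adj? u w ×-dec walk? k w v))

  visited : ∀ {k u v} → Walk k u v → List (Fin n)
  visited {v = v} []      = v ∷ []
  visited {u = u} (_ ∷ p) = u ∷ visited p

  Connected : Set
  Connected = ∀ u v → ∃ λ k → Walk k u v

  -- A cycle is a path with at least three vertices together with an edge
  -- joining its ends.
  Acyclic : Set
  Acyclic = ∀ {k u v} (p : Walk k u v) → Unique (visited p) → 2 ℕ.≤ k → ¬ Adj v u

  record IsTree : Set where
    field
      connected : Connected
      acyclic   : Acyclic

  IsPath : Set
  IsPath = G ≅ pathGraph n

  module _ (conn : Connected) where

    dist : Fin n → Fin n → ℕ
    dist u v = proj₁ (least (λ k → walk? k u v) (proj₁ (conn u v)) (proj₂ (conn u v)))

    eccentricity : Fin n → ℕ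
    eccentricity v = max 0 (map (dist v) (filter (λ w → ¬? (w Fin.≟ v)) (allFin n)))

    radius : ℕ
    radius = minimum (map eccentricity (allFin n))

open IsTree public

module Submission where

-- Let D be the length of a longest path.  In an acyclic graph a walk that
-- never backtracks is a path, so its midpoint shows that r ≤ ⌈D/2⌉.
--
-- For the lower bound on R, the weight of each edge uv is bounded below by
-- f(u,v) + f(v,u) with rational shares f, and double counting turns the sum
-- over the edges into the sum over the vertices u of Σ_{v ~ u} f(u,v).  Root
-- the tree at an end of a longest path.  A vertex of degree d off the path
-- collects about 3/2d from each child, which pays for the 7/10 that it passes
-- on to its parent; an edge inside the path gives 1/d - 1/4 to an endpoint of
-- degree d.  What the path collects is moved down to the root, so that all
-- other vertex sums are nonnegative.  This yields R ≥ D/2 + 2/5, and another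
-- 1/10 if some inner vertex of the path has degree at least 3.  If there is no
-- such vertex, the tree is a path on D + 1 vertices, and D is even unless the
-- path is one of the exceptions.
--
-- On a path with an even number of vertices greater than 2 all edges have
-- weight 1/2, except the two at the ends, which have weight 1/√2.

-- The constants fit one budget. With 7/10 in place of 1/√2, an inner path vertex of degree 2 gains
-- 9/20 = 7/10 - 1/4 from a neighbour that is an end, so a bare path yields (D - 1)/2 + 2 · 9/20.
-- The radius may require (D + 1)/2, which is exactly 1/10 more, and this is what a branch vertex
-- has to supply. The requirement is met with equality when `D` is 2 and the middle vertex branches.
--
-- A vertex collects from every child off the path as if that child were a leaf, so that its sum
-- depends on degrees only and not on the shape of the subtrees. For a child that is not a leaf this
-- may overstate the edge; the 7/10 charged to the child corrects it, since the two shares of such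
-- an edge then add up to at most 0.
--
-- The order on the reals is not decidable. It is never branched on: all cases are distinguished by
-- degrees and heights, and each real estimate compares a rational with a single `1/√ m`.

open import Defs

-- Order and addition of Bishop reals, and bounds for reciprocal square roots.

module Reals where

  open import Level using (0ℓ)
  open import Algebra.Bundles using (AbelianGroup)
  open import Data.Nat as ℕ using (ℕ; zero; suc)
  import Data.Nat.Properties as ℕₚ
  open import Data.Integer.Solver using () renaming (module +-*-Solver to ℤ-Solver)
  open import Data.Integer as ℤ using (+_; +[1+_]; -[1+_])
  import Data.Integer.Properties as ℤₚ
  open import Data.Nat.Solver using () renaming (module +-*-Solver to ℕ-Solver)
  open import Data.Rational.Unnormalised as ℚᵘ
    using (ℚᵘ; mkℚᵘ; 0ℚᵘ; _+_; _*_; _-_; -_; _≤_; _≃_; *≤*; *≡*)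
  import Data.Rational.Unnormalised.Properties as ℚₚ
  open import Data.Rational.Unnormalised.Solver using () renaming (module +-*-Solver to ℚ-Solver)
  open import Data.List using ([]; _∷_; foldr)
  open import Data.Product using (_×_; _,_; proj₁; proj₂)
  open import Relation.Binary.PropositionalEquality as Eq using (_≡_; refl; cong; sym; subst; subst₂)

  /-mono : ∀ a p b q → a ℕ.* suc q ℕ.≤ b ℕ.* suc p → mkℚᵘ (+ a) p ≤ mkℚᵘ (+ b) q
  /-mono a p b q le =
    *≤* (subst₂ ℤ._≤_ (ℤₚ.pos-* a (suc q)) (ℤₚ.pos-* b (suc p)) (ℤ.+≤+ le))

  /-mono⁻¹ : ∀ {a p b q} → mkℚᵘ (+ a) p ≤ mkℚᵘ (+ b) q → a ℕ.* suc q ℕ.≤ b ℕ.* suc p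
  /-mono⁻¹ {a} {p} {b} {q} (*≤* le) =
    ℤₚ.drop‿+≤+ (subst₂ ℤ._≤_ (sym (ℤₚ.pos-* a (suc q))) (sym (ℤₚ.pos-* b (suc p))) le)

  /-cong : ∀ a p b q → a ℕ.* suc q ≡ b ℕ.* suc p → mkℚᵘ (+ a) p ≃ mkℚᵘ (+ b) q
  /-cong a p b q eq = ℚₚ.≤-antisym (/-mono a p b q (ℕₚ.≤-reflexive eq))
                                   (/-mono b q a p (ℕₚ.≤-reflexive (sym eq)))

  +-same-denominator : ∀ a b n → mkℚᵘ (+ a) n + mkℚᵘ (+ b) n ≃ mkℚᵘ (+ (a ℕ.+ b)) n
  +-same-denominator a b n = *≡* (solve 3 (λ a b d →
      (a :* d :+ b :* d) :* d := (a :+ b) :* (d :* d)) refl (+ a) (+ b) (+ suc n))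
    where open ℤ-Solver

  -- The comparison x ≤ℝ y asks for C = 2; allowing any C makes transitivity and
  -- monotonicity of sums immediate.
  infix 4 _≲_ _≈_

  record _≲_ (x y : ℝ) : Set where
    constructor within
    field
      C     : ℕ
      bound : ∀ n → seq x n - seq y n ≤ mkℚᵘ (+ C) n

  _≈_ : ℝ → ℝ → Set
  x ≈ y = x ≲ y × y ≲ x

  -- If `p - q` were at least 1/(d+1), the index n = C(d+1) would give the contradiction C/(n+1) <
  -- 1/(d+1).
  archimedean : ∀ C {p q} → (∀ n → p ≤ q + mkℚᵘ (+ C) n) → p ≤ q
  archimedean C {p} {q} bound = ℚₚ.≮⇒≥ λ q<p → absurd (p - q) bound′
      (ℚₚ.<-respˡ-≃ (ℚₚ.+-inverseʳ q) (ℚₚ.+-monoˡ-< (- q) q<p))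
    where
    bound′ : ∀ n → p - q ≤ mkℚᵘ (+ C) n
    bound′ n = begin
      p - q                     ≤⟨ ℚₚ.+-monoˡ-≤ (- q) (bound n) ⟩
      q + mkℚᵘ (+ C) n - q      ≃⟨ solve 2 (λ q c → q :+ c :- q := c) ℚₚ.≃-refl q (mkℚᵘ (+ C) n) ⟩
      mkℚᵘ (+ C) n              ∎
      where open ℚₚ.≤-Reasoning
            open ℚ-Solver
    absurd : ∀ r → (∀ n → r ≤ mkℚᵘ (+ C) n) → 0ℚᵘ ℚᵘ.< r → _
    absurd (mkℚᵘ (+ zero)   d) r≤ (ℚᵘ.*<* (ℤ.+<+ ()))
    absurd (mkℚᵘ -[1+ _ ]   d) r≤ (ℚᵘ.*<* ())
    absurd (mkℚᵘ +[1+ a ]   d) r≤ _ = ℕₚ.<-irrefl refl (begin-strict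
        C ℕ.* suc d                        <⟨ ℕₚ.n<1+n _ ⟩
        suc (C ℕ.* suc d)                  ≤⟨ ℕₚ.m≤n*m _ (suc a) ⟩
        suc a ℕ.* suc (C ℕ.* suc d)        ≤⟨ /-mono⁻¹ (r≤ (C ℕ.* suc d)) ⟩
        C ℕ.* suc d                        ∎)
      where open ℕₚ.≤-Reasoning

  -- Regularity carries the difference at index `n` over to a far index `m`, where the constant `C`
  -- is divided by `m + 1`. Letting `m` grow leaves only the two terms `ε n`.
  ≲⇒≤ℝ : ∀ {x y} → x ≲ y → x ≤ℝ y
  ≲⇒≤ℝ {x} {y} (within C x≲y) n = archimedean (1 ℕ.+ (C ℕ.+ 1)) λ m → begin
      seq x n - seq y n
        ≃⟨ solve 4 (λ a b c d → a :- d := (a :- b) :+ ((b :- c) :+ (c :- d)))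
             ℚₚ.≃-refl (seq x n) (seq x m) (seq y m) (seq y n) ⟩
      (seq x n - seq x m) + ((seq x m - seq y m) + (seq y m - seq y n))
        ≤⟨ ℚₚ.+-mono-≤ (regular x n m) (ℚₚ.+-mono-≤ (x≲y m) (regular y m n)) ⟩
      (ε n + ε m) + (mkℚᵘ (+ C) m + (ε m + ε n))
        ≃⟨ solve 3 (λ a b c → (a :+ b) :+ (c :+ (b :+ a)) := (a :+ a) :+ (b :+ (c :+ b)))
             ℚₚ.≃-refl (ε n) (ε m) (mkℚᵘ (+ C) m) ⟩
      (ε n + ε n) + (ε m + (mkℚᵘ (+ C) m + ε m))
        ≃⟨ ℚₚ.+-congʳ (ε n + ε n) (ℚₚ.≃-trans
             (ℚₚ.+-congʳ (ε m) (+-same-denominator C 1 m)) (+-same-denominator 1 (C ℕ.+ 1) m)) ⟩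
      (ε n + ε n) + mkℚᵘ (+ (1 ℕ.+ (C ℕ.+ 1))) m  ∎
    where open ℚₚ.≤-Reasoning
          open ℚ-Solver

  ≲-trans : ∀ {x y z} → x ≲ y → y ≲ z → x ≲ z
  ≲-trans {x} {y} {z} (within C x≲y) (within D y≲z) = within (C ℕ.+ D) λ n → begin
      seq x n - seq z n
        ≃⟨ ℚₚ.+-minus-telescope (seq x n) (seq y n) (seq z n) ⟨
      (seq x n - seq y n) + (seq y n - seq z n)  ≤⟨ ℚₚ.+-mono-≤ (x≲y n) (y≲z n) ⟩
      mkℚᵘ (+ C) n + mkℚᵘ (+ D) n                ≃⟨ +-same-denominator C D n ⟩
      mkℚᵘ (+ (C ℕ.+ D)) n                       ∎
    where open ℚₚ.≤-Reasoning

  ≤-pointwise⇒≲ : ∀ {x y} → (∀ n → seq x n ≤ seq y n) → x ≲ y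
  ≤-pointwise⇒≲ {x} {y} le = within 0 λ n → begin
      seq x n - seq y n   ≤⟨ ℚₚ.p≤q⇒p-q≤0 (le n) ⟩
      0ℚᵘ                 ≃⟨ /-cong 0 0 0 n refl ⟩
      mkℚᵘ (+ 0) n        ∎
    where open ℚₚ.≤-Reasoning

  ≃-pointwise⇒≈ : ∀ {x y} → (∀ n → seq x n ≃ seq y n) → x ≈ y
  ≃-pointwise⇒≈ eq = ≤-pointwise⇒≲ (λ n → ℚₚ.≤-reflexive (eq n))
                    , ≤-pointwise⇒≲ (λ n → ℚₚ.≤-reflexive (ℚₚ.≃-sym (eq n)))

  ≈-refl : ∀ {x} → x ≈ x
  ≈-refl = ≃-pointwise⇒≈ λ _ → ℚₚ.≃-refl

  ≲-refl : ∀ {x} → x ≲ x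
  ≲-refl = proj₁ ≈-refl

  private
    h : ℕ → ℕ
    h n = suc (n ℕ.+ n)

    C/h≤C/ : ∀ C n → mkℚᵘ (+ C) (h n) ≤ mkℚᵘ (+ C) n
    C/h≤C/ C n = /-mono C (h n) C n
      (ℕₚ.*-monoʳ-≤ C (ℕ.s≤s (ℕₚ.m≤n⇒m≤1+n (ℕₚ.m≤m+n n n))))

  +-mono-≲ : ∀ {x y u v} → x ≲ y → u ≲ v → x +ℝ u ≲ y +ℝ v
  +-mono-≲ {x} {y} {u} {v} (within C x≲y) (within D u≲v) = within (C ℕ.+ D) λ n → begin
      (seq x (h n) + seq u (h n)) - (seq y (h n) + seq v (h n))
        ≃⟨ solve 4 (λ a b c d → (a :+ b) :- (c :+ d) := (a :- c) :+ (b :- d)) ℚₚ.≃-refl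
             (seq x (h n)) (seq u (h n)) (seq y (h n)) (seq v (h n)) ⟩
      (seq x (h n) - seq y (h n)) + (seq u (h n) - seq v (h n))
        ≤⟨ ℚₚ.+-mono-≤ (x≲y (h n)) (u≲v (h n)) ⟩
      mkℚᵘ (+ C) (h n) + mkℚᵘ (+ D) (h n)  ≃⟨ +-same-denominator C D (h n) ⟩
      mkℚᵘ (+ (C ℕ.+ D)) (h n)             ≤⟨ C/h≤C/ (C ℕ.+ D) n ⟩
      mkℚᵘ (+ (C ℕ.+ D)) n                 ∎
    where open ℚₚ.≤-Reasoning
          open ℚ-Solver

  neg-mono-≲ : ∀ {x y} → x ≲ y → -ℝ y ≲ -ℝ x
  neg-mono-≲ {x} {y} (within C x≲y) = within C λ n → begin
      - seq y n - - seq x n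
        ≃⟨ solve 2 (λ a b → :- b :- :- a := a :- b) ℚₚ.≃-refl (seq x n) (seq y n) ⟩
      seq x n - seq y n  ≤⟨ x≲y n ⟩
      mkℚᵘ (+ C) n       ∎
    where open ℚₚ.≤-Reasoning
          open ℚ-Solver

  private
    regular-h : ∀ x n → (seq x n - seq x (h n) ≤ mkℚᵘ (+ 2) n) × (seq x (h n) - seq x n ≤ mkℚᵘ (+ 2) n)
    regular-h x n =
        (begin
          seq x n - seq x (h n)  ≤⟨ regular x n (h n) ⟩
          ε n + ε (h n)          ≤⟨ ℚₚ.+-monoʳ-≤ (ε n) (C/h≤C/ 1 n) ⟩
          ε n + ε n              ≃⟨ +-same-denominator 1 1 n ⟩
          mkℚᵘ (+ 2) n           ∎)
      , (begin
          seq x (h n) - seq x n  ≤⟨ regular x (h n) n ⟩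
          ε (h n) + ε n          ≤⟨ ℚₚ.+-monoˡ-≤ (ε n) (C/h≤C/ 1 n) ⟩
          ε n + ε n              ≃⟨ +-same-denominator 1 1 n ⟩
          mkℚᵘ (+ 2) n           ∎)
      where open ℚₚ.≤-Reasoning

  -- The two bracketings read `x` and `z` at different depths of index doubling, so they agree only
  -- up to regularity and not pointwise.
  +-assoc-≈ : ∀ x y z → (x +ℝ y) +ℝ z ≈ x +ℝ (y +ℝ z)
  +-assoc-≈ x y z =
      (within 4 λ n → begin
        ((X n + Y n) + Z n) - (X′ n + (Y n + Z′ n))
          ≃⟨ solve 5 (λ x y z x′ z′ → ((x :+ y) :+ z) :- (x′ :+ (y :+ z′)) := (x :- x′) :+ (z :- z′))
               ℚₚ.≃-refl (X n) (Y n) (Z n) (X′ n) (Z′ n) ⟩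
        (X n - X′ n) + (Z n - Z′ n)
          ≤⟨ ℚₚ.+-mono-≤ (proj₂ (regular-h x (h n))) (proj₁ (regular-h z (h n))) ⟩
        mkℚᵘ (+ 2) (h n) + mkℚᵘ (+ 2) (h n)  ≤⟨ finish n ⟩
        mkℚᵘ (+ 4) n                          ∎)
    , (within 4 λ n → begin
        (X′ n + (Y n + Z′ n)) - ((X n + Y n) + Z n)
          ≃⟨ solve 5 (λ x y z x′ z′ → (x′ :+ (y :+ z′)) :- ((x :+ y) :+ z) := (x′ :- x) :+ (z′ :- z))
               ℚₚ.≃-refl (X n) (Y n) (Z n) (X′ n) (Z′ n) ⟩
        (X′ n - X n) + (Z′ n - Z n)
          ≤⟨ ℚₚ.+-mono-≤ (proj₁ (regular-h x (h n))) (proj₂ (regular-h z (h n))) ⟩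
        mkℚᵘ (+ 2) (h n) + mkℚᵘ (+ 2) (h n)  ≤⟨ finish n ⟩
        mkℚᵘ (+ 4) n                          ∎)
    where
    open ℚₚ.≤-Reasoning
    open ℚ-Solver
    X Y Z X′ Z′ : ℕ → ℚᵘ
    X n = seq x (h (h n))
    Y n = seq y (h (h n))
    Z n = seq z (h n)
    X′ n = seq x (h n)
    Z′ n = seq z (h (h n))
    finish : ∀ n → mkℚᵘ (+ 2) (h n) + mkℚᵘ (+ 2) (h n) ≤ mkℚᵘ (+ 4) n
    finish n = ℚₚ.≤-trans (ℚₚ.≤-reflexive (+-same-denominator 2 2 (h n))) (C/h≤C/ 4 n)

  +-identityˡ-≈ : ∀ x → 0ℝ +ℝ x ≈ x
  +-identityˡ-≈ x =
      (within 2 λ n → ℚₚ.≤-trans (ℚₚ.≤-reflexive (ℚₚ.+-congˡ (- seq x n) (ℚₚ.+-identityˡ (seq x (h n)))))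
                            (proj₂ (regular-h x n)))
    , (within 2 λ n → ℚₚ.≤-trans (ℚₚ.≤-reflexive (ℚₚ.+-congʳ (seq x n) (ℚₚ.-‿cong (ℚₚ.+-identityˡ (seq x (h n))))))
                            (proj₁ (regular-h x n)))

  +-comm-≈ : ∀ x y → x +ℝ y ≈ y +ℝ x
  +-comm-≈ x y = ≃-pointwise⇒≈ λ n → ℚₚ.+-comm (seq x (h n)) (seq y (h n))

  ≈-sym : ∀ {x y} → x ≈ y → y ≈ x
  ≈-sym (x≲y , y≲x) = y≲x , x≲y

  ≈-trans : ∀ {x y z} → x ≈ y → y ≈ z → x ≈ z
  ≈-trans (x≲y , y≲x) (y≲z , z≲y) =
    ≲-trans x≲y y≲z , ≲-trans z≲y y≲x

  +-cong-≈ : ∀ {x y u v} → x ≈ y → u ≈ v → x +ℝ u ≈ y +ℝ v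
  +-cong-≈ {x} {y} {u} {v} (x≲y , y≲x) (u≲v , v≲u) =
    +-mono-≲ {x} {y} {u} {v} x≲y u≲v , +-mono-≲ {y} {x} {v} {u} y≲x v≲u

  neg-cong-≈ : ∀ {x y} → x ≈ y → -ℝ x ≈ -ℝ y
  neg-cong-≈ {x} {y} (x≲y , y≲x) = neg-mono-≲ {y} {x} y≲x , neg-mono-≲ {x} {y} x≲y

  +-inverseʳ-≈ : ∀ x → x -ℝ x ≈ 0ℝ
  +-inverseʳ-≈ x = ≃-pointwise⇒≈ λ n → ℚₚ.+-inverseʳ (seq x (h n))

  fromℚ-mono : ∀ {p q} → p ≤ q → fromℚ p ≲ fromℚ q
  fromℚ-mono {p} {q} p≤q = ≤-pointwise⇒≲ λ _ → p≤q

  fromℚ-cong : ∀ {p q} → p ≃ q → fromℚ p ≈ fromℚ q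
  fromℚ-cong {p} {q} p≃q = ≃-pointwise⇒≈ λ _ → p≃q



  -- Opaque copies of the operations: conversion of sums in _+ℝ_ involves
  -- comparing the regularity proofs.
  infixl 6 _⊕_
  infix  8 ⊖_

  abstract

    hide : ∀ {A : Set} → A → A
    hide x = x

    hide≡ : ∀ {A : Set} (x : A) → hide x ≡ x
    hide≡ x = refl

  _⊕_ : ℝ → ℝ → ℝ
  _⊕_ = hide _+ℝ_

  ⊖_ : ℝ → ℝ
  ⊖_ = hide (λ x → -ℝ x)

  ⊕≡+ℝ : ∀ x y → x ⊕ y ≡ x +ℝ y
  ⊕≡+ℝ x y = cong (λ f → f x y) {hide _+ℝ_} {_+ℝ_} (hide≡ _+ℝ_)

  ⊖≡-ℝ : ∀ x → ⊖ x ≡ -ℝ x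
  ⊖≡-ℝ x = cong (λ f → f x) {hide (λ x → -ℝ x)} {λ x → -ℝ x} (hide≡ (λ x → -ℝ x))

  ≈-reflexive : ∀ {x y} → x ≡ y → x ≈ y
  ≈-reflexive refl = ≈-refl

  ⊕≈+ℝ : ∀ x y → x ⊕ y ≈ x +ℝ y
  ⊕≈+ℝ x y = ≈-reflexive {x ⊕ y} {x +ℝ y} (⊕≡+ℝ x y)

  ⊖≈-ℝ : ∀ x → ⊖ x ≈ -ℝ x
  ⊖≈-ℝ x = ≈-reflexive {⊖ x} { -ℝ x} (⊖≡-ℝ x)

  ⊕-mono : ∀ {x y u v} → x ≲ y → u ≲ v → x ⊕ u ≲ y ⊕ v
  ⊕-mono {x} {y} {u} {v} x≲y u≲v = ≲-trans {x ⊕ u} {x +ℝ u} {y ⊕ v} (proj₁ (⊕≈+ℝ x u))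
    (≲-trans {x +ℝ u} {y +ℝ v} {y ⊕ v} (+-mono-≲ {x} {y} {u} {v} x≲y u≲v) (proj₂ (⊕≈+ℝ y v)))

  ⊕-cong : ∀ {x y u v} → x ≈ y → u ≈ v → x ⊕ u ≈ y ⊕ v
  ⊕-cong (x≲y , y≲x) (u≲v , v≲u) = ⊕-mono x≲y u≲v , ⊕-mono y≲x v≲u

  ⊖-cong : ∀ {x y} → x ≈ y → ⊖ x ≈ ⊖ y
  ⊖-cong {x} {y} x≈y = ≈-trans {⊖ x} { -ℝ x} {⊖ y} (⊖≈-ℝ x)
    (≈-trans { -ℝ x} { -ℝ y} {⊖ y} (neg-cong-≈ {x} {y} x≈y) (≈-sym {⊖ y} { -ℝ y} (⊖≈-ℝ y)))

  -ℝ≈⊕⊖ : ∀ x y → x -ℝ y ≈ x ⊕ ⊖ y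
  -ℝ≈⊕⊖ x y = ≈-sym {x ⊕ ⊖ y} {x -ℝ y} (≈-trans {x ⊕ ⊖ y} {x ⊕ (-ℝ y)} {x -ℝ y}
    (⊕-cong {x} {x} {⊖ y} { -ℝ y} ≈-refl (⊖≈-ℝ y))
    (≈-trans {x ⊕ (-ℝ y)} {x +ℝ (-ℝ y)} {x -ℝ y} (⊕≈+ℝ x (-ℝ y))
      (≃-pointwise⇒≈ {x +ℝ (-ℝ y)} {x -ℝ y} λ _ → ℚₚ.≃-refl)))

  ⊕-assoc : ∀ x y z → (x ⊕ y) ⊕ z ≈ x ⊕ (y ⊕ z)
  ⊕-assoc x y z =
    ≈-trans {(x ⊕ y) ⊕ z} {(x ⊕ y) +ℝ z} {x ⊕ (y ⊕ z)} (⊕≈+ℝ (x ⊕ y) z)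
    (≈-trans {(x ⊕ y) +ℝ z} {(x +ℝ y) +ℝ z} {x ⊕ (y ⊕ z)}
      (+-cong-≈ {x ⊕ y} {x +ℝ y} {z} {z} (⊕≈+ℝ x y) ≈-refl)
    (≈-trans {(x +ℝ y) +ℝ z} {x +ℝ (y +ℝ z)} {x ⊕ (y ⊕ z)} (+-assoc-≈ x y z)
    (≈-trans {x +ℝ (y +ℝ z)} {x +ℝ (y ⊕ z)} {x ⊕ (y ⊕ z)}
      (+-cong-≈ {x} {x} {y +ℝ z} {y ⊕ z} ≈-refl (≈-sym {y ⊕ z} {y +ℝ z} (⊕≈+ℝ y z)))
      (≈-sym {x ⊕ (y ⊕ z)} {x +ℝ (y ⊕ z)} (⊕≈+ℝ x (y ⊕ z))))))

  ⊕-comm : ∀ x y → x ⊕ y ≈ y ⊕ x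
  ⊕-comm x y = ≈-trans {x ⊕ y} {x +ℝ y} {y ⊕ x} (⊕≈+ℝ x y)
    (≈-trans {x +ℝ y} {y +ℝ x} {y ⊕ x} (+-comm-≈ x y) (≈-sym {y ⊕ x} {y +ℝ x} (⊕≈+ℝ y x)))

  ⊕-identityˡ : ∀ x → 0ℝ ⊕ x ≈ x
  ⊕-identityˡ x = ≈-trans {0ℝ ⊕ x} {0ℝ +ℝ x} {x} (⊕≈+ℝ 0ℝ x) (+-identityˡ-≈ x)

  ⊕-inverseʳ : ∀ x → x ⊕ ⊖ x ≈ 0ℝ
  ⊕-inverseʳ x = ≈-trans {x ⊕ ⊖ x} {x -ℝ x} {0ℝ} (≈-sym {x -ℝ x} {x ⊕ ⊖ x} (-ℝ≈⊕⊖ x x)) (+-inverseʳ-≈ x)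

  fromℚ-⊕ : ∀ p q → fromℚ p ⊕ fromℚ q ≈ fromℚ (p + q)
  fromℚ-⊕ p q = ≈-trans {fromℚ p ⊕ fromℚ q} {fromℚ p +ℝ fromℚ q} {fromℚ (p + q)}
    (⊕≈+ℝ (fromℚ p) (fromℚ q))
    (≃-pointwise⇒≈ {fromℚ p +ℝ fromℚ q} {fromℚ (p + q)} λ _ → ℚₚ.≃-refl)

  fromℚ-⊖ : ∀ p → ⊖ fromℚ p ≈ fromℚ (- p)
  fromℚ-⊖ p = ≈-trans {⊖ fromℚ p} { -ℝ fromℚ p} {fromℚ (- p)} (⊖≈-ℝ (fromℚ p))
    (≃-pointwise⇒≈ { -ℝ fromℚ p} {fromℚ (- p)} λ _ → ℚₚ.≃-refl)

  ℝ-abelianGroup : AbelianGroup 0ℓ 0ℓ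
  ℝ-abelianGroup = record
    { Carrier = ℝ
    ; _≈_ = _≈_
    ; _∙_ = _⊕_
    ; ε = 0ℝ
    ; _⁻¹ = ⊖_
    ; isAbelianGroup = record
      { isGroup = record
        { isMonoid = record
          { isSemigroup = record
            { isMagma = record
              { isEquivalence = record { refl = ≈-refl ; sym = ≈-sym ; trans = ≈-trans }
              ; ∙-cong = ⊕-cong
              }
            ; assoc = ⊕-assoc
            }
          ; identity = ⊕-identityˡ , λ x → ≈-trans (⊕-comm x 0ℝ) (⊕-identityˡ x)
          }
        ; inverse = (λ x → ≈-trans (⊕-comm (⊖ x) x) (⊕-inverseʳ x)) , ⊕-inverseʳ
        ; ⁻¹-cong = ⊖-cong
        }
      ; comm = ⊕-comm
      }
    }

  private
    -- For an abstract f; used at _+ℝ_ without unfolding that.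
    foldr-∷ : ∀ {A B : Set} (f : A → B → B) e x xs → foldr f e (x ∷ xs) ≡ f x (foldr f e xs)
    foldr-∷ f e x xs = refl

  sumℝ≡⊕ : ∀ xs → foldr _+ℝ_ 0ℝ xs ≡ foldr _⊕_ 0ℝ xs
  sumℝ≡⊕ []       = refl
  sumℝ≡⊕ (x ∷ xs) = begin
      foldr _+ℝ_ 0ℝ (x ∷ xs)    ≡⟨ foldr-∷ _+ℝ_ 0ℝ x xs ⟩
      x +ℝ foldr _+ℝ_ 0ℝ xs     ≡⟨ cong (x +ℝ_) {foldr _+ℝ_ 0ℝ xs} {foldr _⊕_ 0ℝ xs} (sumℝ≡⊕ xs) ⟩
      x +ℝ foldr _⊕_ 0ℝ xs      ≡⟨ ⊕≡+ℝ x (foldr _⊕_ 0ℝ xs) ⟨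
      x ⊕ foldr _⊕_ 0ℝ xs       ∎
    where open Eq.≡-Reasoning

  *-fractions : ∀ a b c d → mkℚᵘ (+ a) b * mkℚᵘ (+ c) d ≃ mkℚᵘ (+ (a ℕ.* c)) (d ℕ.+ b ℕ.* suc d)
  *-fractions a b c d = *≡* (cong (ℤ._* + (suc b ℕ.* suc d)) (sym (ℤₚ.pos-* a c)))

  sq-cancel-≤ : ∀ {a b} → a ℕ.* a ℕ.≤ b ℕ.* b → a ℕ.≤ b
  sq-cancel-≤ le = ℕₚ.≮⇒≥ λ b<a → ℕₚ.<⇒≱ (ℕₚ.*-mono-< b<a b<a) le

  sq-cancel-< : ∀ {a b} → a ℕ.* a ℕ.< b ℕ.* b → a ℕ.< b
  sq-cancel-< lt = ℕₚ.≰⇒> λ b≤a → ℕₚ.<⇒≱ lt (ℕₚ.*-mono-≤ b≤a b≤a)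

  private
    square-product : ∀ a b → (a ℕ.* b) ℕ.* (a ℕ.* b) ≡ (a ℕ.* a) ℕ.* (b ℕ.* b)
    square-product = solve 2 (λ a b → (a :* b) :* (a :* b) := (a :* a) :* (b :* b)) refl
      where open ℕ-Solver

    ratio-≤ : ∀ a b m N s → a ℕ.* a ℕ.* m ℕ.≤ b ℕ.* b → s ℕ.* s ℕ.≤ m ℕ.* (N ℕ.* N) →
              a ℕ.* s ℕ.≤ b ℕ.* N
    ratio-≤ a b m N s a²m≤b² s²≤mN² = sq-cancel-≤ {a ℕ.* s} (begin
        (a ℕ.* s) ℕ.* (a ℕ.* s)          ≡⟨ square-product a s ⟩
        (a ℕ.* a) ℕ.* (s ℕ.* s)          ≤⟨ ℕₚ.*-monoʳ-≤ (a ℕ.* a) s²≤mN² ⟩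
        (a ℕ.* a) ℕ.* (m ℕ.* (N ℕ.* N))  ≡⟨ ℕₚ.*-assoc (a ℕ.* a) m (N ℕ.* N) ⟨
        (a ℕ.* a ℕ.* m) ℕ.* (N ℕ.* N)    ≤⟨ ℕₚ.*-monoˡ-≤ (N ℕ.* N) a²m≤b² ⟩
        (b ℕ.* b) ℕ.* (N ℕ.* N)          ≡⟨ square-product b N ⟨
        (b ℕ.* N) ℕ.* (b ℕ.* N)          ∎)
      where open ℕₚ.≤-Reasoning

    ratio-≥ : ∀ k m N s → k ℕ.* k ℕ.≤ m → m ℕ.* (N ℕ.* N) ℕ.< suc s ℕ.* suc s → k ℕ.* N ℕ.≤ s
    ratio-≥ k m N s k²≤m mN²<s² = ℕ.s≤s⁻¹ (sq-cancel-< {k ℕ.* N} (begin-strict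
        (k ℕ.* N) ℕ.* (k ℕ.* N)  ≡⟨ square-product k N ⟩
        (k ℕ.* k) ℕ.* (N ℕ.* N)  ≤⟨ ℕₚ.*-monoˡ-≤ (N ℕ.* N) k²≤m ⟩
        m ℕ.* (N ℕ.* N)          <⟨ mN²<s² ⟩
        suc s ℕ.* suc s          ∎))
      where open ℕₚ.≤-Reasoning

    <suc-square : ∀ {k} s → k ℕ.< suc s ℕ.* suc s → k ℕ.≤ s ℕ.* s ℕ.+ 2 ℕ.* s
    <suc-square {k} s lt = ℕ.s≤s⁻¹ (subst (k ℕ.<_)
        (solve 1 (λ s → (con 1 :+ s) :* (con 1 :+ s) := con 1 :+ (s :* s :+ con 2 :* s)) refl s) lt)
      where open ℕ-Solver

    /≤integer : ∀ a b c → a ℕ.≤ c ℕ.* suc b → mkℚᵘ (+ a) b ≤ mkℚᵘ (+ c) 0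
    /≤integer a b c le = /-mono a b c 0 (subst (ℕ._≤ c ℕ.* suc b) (sym (ℕₚ.*-identityʳ a)) le)

    integer≤/ : ∀ a b c → c ℕ.* suc b ℕ.≤ a → mkℚᵘ (+ c) 0 ≤ mkℚᵘ (+ a) b
    integer≤/ a b c le = /-mono c 0 a b (subst (c ℕ.* suc b ℕ.≤_) (sym (ℕₚ.*-identityʳ a)) le)

  module _ (d : ℕ) where
    private
      m : ℕ
      m = suc d

      s : ℕ → ℕ
      s n = ⌊√ m ℕ.* (suc n ℕ.* suc n) ⌋

      s²≤ : ∀ n → s n ℕ.* s n ℕ.≤ m ℕ.* (suc n ℕ.* suc n)
      s²≤ n = proj₁ (proj₂ (isqrt (m ℕ.* (suc n ℕ.* suc n))))

      <suc-s² : ∀ n → m ℕ.* (suc n ℕ.* suc n) ℕ.< suc (s n) ℕ.* suc (s n)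
      <suc-s² n = proj₂ (proj₂ (isqrt (m ℕ.* (suc n ℕ.* suc n))))

      x y : ℕ → ℚᵘ
      x n = mkℚᵘ (+ s n) n
      y n = seq (1/√ m) n

      x-positive : ∀ n → ℚᵘ.Positive (x n)
      x-positive n = ℚᵘ.positive (ℚₚ.<-≤-trans (ℚₚ.positive⁻¹ (ε 0))
                                               (Positiveℝ.lower (√-pos d) n ℕ.z≤n))

      y*x≃1 : ∀ n → y n * x n ≃ ℚᵘ.1ℚᵘ
      -- `√-pos` has bound 0, so the scaling in the reciprocal is by 1 and `1/√ m` at `n` inverts
      -- `√ m` at the index `n * 1`.
      y*x≃1 n = subst (λ k → y n * x k ≃ ℚᵘ.1ℚᵘ) (ℕₚ.*-identityʳ n)
                      (ℚₚ.*-inverseˡ (x (n ℕ.* 1))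
                        {{ℚₚ.pos⇒nonZero (x (n ℕ.* 1)) {{x-positive (n ℕ.* 1)}}}})

    -- The approximations of `√ m` are rounded down, hence those of its reciprocal are rounded up
    -- and inherit a lower bound at every index.
    ≤1/√ : ∀ a b → a ℕ.* a ℕ.* m ℕ.≤ suc b ℕ.* suc b → fromℚ (mkℚᵘ (+ a) b) ≲ 1/√ m
    ≤1/√ a b a²m≤b² = ≤-pointwise⇒≲ λ n → ℚₚ.*-cancelʳ-≤-pos (x n) {{x-positive n}} (begin
        mkℚᵘ (+ a) b * x n                            ≃⟨ *-fractions a b (s n) n ⟩
        mkℚᵘ (+ (a ℕ.* s n)) (n ℕ.+ b ℕ.* suc n)      ≤⟨ /≤integer (a ℕ.* s n) _ 1
            (subst (a ℕ.* s n ℕ.≤_) (sym (ℕₚ.*-identityˡ (suc b ℕ.* suc n)))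
                   (ratio-≤ a (suc b) m (suc n) (s n) a²m≤b² (s²≤ n))) ⟩
        ℚᵘ.1ℚᵘ                                        ≃⟨ y*x≃1 n ⟨
        y n * x n                                     ∎)
      where open ℚₚ.≤-Reasoning

    -- Here the rounding goes the wrong way, but the integer (k+1)(n+1) is at most (n+1)√m and
    -- therefore also at most its floor.
    1/√≤ : ∀ k → suc k ℕ.* suc k ℕ.≤ m → 1/√ m ≲ fromℚ (mkℚᵘ (+ 1) k)
    1/√≤ k k²≤m = ≤-pointwise⇒≲ λ n → ℚₚ.*-cancelʳ-≤-pos (x n) {{x-positive n}} (begin
        y n * x n                                     ≃⟨ y*x≃1 n ⟩
        ℚᵘ.1ℚᵘ                                        ≤⟨ integer≤/ (1 ℕ.* s n) (n ℕ.+ k ℕ.* suc n) 1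
            (ℕₚ.*-monoʳ-≤ 1 (ratio-≥ (suc k) m (suc n) (s n) k²≤m (<suc-s² n))) ⟩
        mkℚᵘ (+ (1 ℕ.* s n)) (n ℕ.+ k ℕ.* suc n)      ≃⟨ *-fractions 1 k (s n) n ⟨
        mkℚᵘ (+ 1) k * x n                            ∎)
      where open ℚₚ.≤-Reasoning

    private
      M : ℚᵘ
      M = mkℚᵘ (+ m) 0

      x≤my : ∀ n → x n ≤ M * y n
      x≤my n = ℚₚ.*-cancelʳ-≤-pos (x n) {{x-positive n}} (begin
          x n * x n                                      ≃⟨ *-fractions (s n) n (s n) n ⟩
          mkℚᵘ (+ (s n ℕ.* s n)) (n ℕ.+ n ℕ.* suc n)     ≤⟨ /≤integer (s n ℕ.* s n) _ m (s²≤ n) ⟩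
          M                                              ≃⟨ ℚₚ.*-identityʳ M ⟨
          M * ℚᵘ.1ℚᵘ                                     ≃⟨ ℚₚ.*-congˡ {M} (y*x≃1 n) ⟨
          M * (y n * x n)                                ≃⟨ ℚₚ.*-assoc M (y n) (x n) ⟨
          M * y n * x n                                  ∎)
        where open ℚₚ.≤-Reasoning

      -- With N = n + 1 and x = s/N: from m N² < (s+1)² follows m N² ≤ s² + 2s, that is, m ≤ x² +
      -- 2x/N.
      my≤x : ∀ n → M * y n ≤ x n + mkℚᵘ (+ 2) n
      my≤x n = ℚₚ.*-cancelʳ-≤-pos (x n) {{x-positive n}} (begin
          M * y n * x n                                  ≃⟨ ℚₚ.*-assoc M (y n) (x n) ⟩
          M * (y n * x n)                                ≃⟨ ℚₚ.*-congˡ {M} (y*x≃1 n) ⟩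
          M * ℚᵘ.1ℚᵘ                                     ≃⟨ ℚₚ.*-identityʳ M ⟩
          M                                              ≤⟨ integer≤/ (s n ℕ.* s n ℕ.+ 2 ℕ.* s n) _ m (<suc-square (s n) (<suc-s² n)) ⟩
          mkℚᵘ (+ (s n ℕ.* s n ℕ.+ 2 ℕ.* s n)) (n ℕ.+ n ℕ.* suc n)
            ≃⟨ +-same-denominator (s n ℕ.* s n) (2 ℕ.* s n) (n ℕ.+ n ℕ.* suc n) ⟨
          mkℚᵘ (+ (s n ℕ.* s n)) _ + mkℚᵘ (+ (2 ℕ.* s n)) _
            ≃⟨ ℚₚ.+-cong (*-fractions (s n) n (s n) n) (*-fractions 2 n (s n) n) ⟨
          x n * x n + mkℚᵘ (+ 2) n * x n                 ≃⟨ ℚₚ.*-distribʳ-+ (x n) (x n) (mkℚᵘ (+ 2) n) ⟨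
          (x n + mkℚᵘ (+ 2) n) * x n                     ∎)
        where open ℚₚ.≤-Reasoning

    -- The index `suc (n + n)` is the one at which `_+ℝ_` reads its summands, so this applies to
    -- `1/√ 2 +ℝ 1/√ 2` with `m` equal to 2.
    *-1/√ : ∀ {z} → (∀ n → seq z n ≃ M * y (suc (n ℕ.+ n))) → z ≈ √ m
    *-1/√ {z} z≃ =
        within 4 (λ n → begin
          seq z n - x n
            ≤⟨ ℚₚ.+-monoˡ-≤ (- x n) (ℚₚ.≤-trans (ℚₚ.≤-reflexive (z≃ n)) (my≤x (h n))) ⟩
          x (h n) + mkℚᵘ (+ 2) (h n) - x n
            ≃⟨ solve 3 (λ a b c → a :+ b :- c := (a :- c) :+ b) ℚₚ.≃-refl (x (h n)) (mkℚᵘ (+ 2) (h n)) (x n) ⟩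
          (x (h n) - x n) + mkℚᵘ (+ 2) (h n)
            ≤⟨ ℚₚ.+-mono-≤ (proj₂ (regular-h (√ m) n)) (C/h≤C/ 2 n) ⟩
          mkℚᵘ (+ 2) n + mkℚᵘ (+ 2) n    ≃⟨ +-same-denominator 2 2 n ⟩
          mkℚᵘ (+ 4) n                   ∎)
      , within 2 (λ n → begin
          x n - seq z n
            ≤⟨ ℚₚ.+-monoʳ-≤ (x n) (ℚₚ.neg-mono-≤
                 (ℚₚ.≤-trans (x≤my (h n)) (ℚₚ.≤-reflexive (ℚₚ.≃-sym (z≃ n))))) ⟩
          x n - x (h n)                  ≤⟨ proj₁ (regular-h (√ m) n) ⟩
          mkℚᵘ (+ 2) n                   ∎)
      where open ℚₚ.≤-Reasoning
            open ℚ-Solver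

  1/√2⊕1/√2≈√2 : 1/√ 2 ⊕ 1/√ 2 ≈ √ 2
  1/√2⊕1/√2≈√2 = ≈-trans {1/√ 2 ⊕ 1/√ 2} {1/√ 2 +ℝ 1/√ 2} {√ 2} (⊕≈+ℝ (1/√ 2) (1/√ 2))
    (*-1/√ 1 {1/√ 2 +ℝ 1/√ 2} λ n →
      solve 1 (λ y → y :+ y := con (mkℚᵘ (+ 2) 0) :* y) ℚₚ.≃-refl (seq (1/√ 2) (h n)))
    where open ℚ-Solver

  1/√-square : ∀ k → 1/√ (suc k ℕ.* suc k) ≈ fromℚ (mkℚᵘ (+ 1) k)
  1/√-square k =
      1/√≤ (k ℕ.+ k ℕ.* suc k) k ℕₚ.≤-refl
    , ≤1/√ (k ℕ.+ k ℕ.* suc k) 1 k (ℕₚ.≤-reflexive (ℕₚ.*-identityˡ (suc k ℕ.* suc k)))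

-- Non-backtracking walks, distances and the radius.

module Trails where

  open import Data.Nat using (ℕ; zero; suc; _+_; _≤_; _<_; s≤s; z≤n)
  import Data.Nat.Properties as ℕₚ
  open import Data.Fin as Fin using (Fin)
  open import Data.List as List using (List; []; _∷_; length; allFin)
  import Data.List.Properties as Listₚ
  open import Data.List.Membership.Propositional using (_∈_)
  open import Data.List.Membership.Propositional.Properties using (∈-∃++; ∈-++⁻; ∈-++⁺ˡ; ∈-++⁺ʳ; ∈-allFin; ∈-filter⁺; ∈-map⁺; ∈-map⁻)
  open import Data.List.Extrema.Nat using (max≤v⁺; v≤max⁺; v≤min⁺; min≤⊤; min≤xs)
  open import Data.List.Relation.Unary.Any as Any using (here; there)
  import Data.List.Relation.Unary.Any.Properties as Anyₚ
  import Data.List.Relation.Unary.All.Properties as Allₚ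
  open import Data.List.Relation.Unary.All as All using (All)
  open import Data.List.Relation.Unary.AllPairs using ([]; _∷_)
  open import Data.List.Relation.Unary.Unique.Propositional using (Unique)
  open import Data.Product using (∃; _×_; _,_; proj₁; proj₂)
  open import Data.Sum using (_⊎_; inj₁; inj₂)
  open import Data.Unit using (⊤; tt)
  open import Relation.Nullary using (¬_; yes; no; contradiction)
  open import Relation.Nullary.Decidable using (¬?)
  open import Relation.Binary.PropositionalEquality as Eq using (_≡_; _≢_; refl; cong; sym; subst)

  unique-length-≤ : ∀ {A : Set} {xs ys : List A} → Unique xs → (∀ {x} → x ∈ xs → x ∈ ys) →
                    length xs ≤ length ys
  unique-length-≤ {xs = []}     _          _  = z≤n
  unique-length-≤ {xs = x ∷ xs} (x≢ ∷ uniq) xs⊆ with ∈-∃++ (xs⊆ (here refl))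
  ... | as , bs , refl = begin
      suc (length xs)                ≤⟨ s≤s (unique-length-≤ uniq xs⊆as++bs) ⟩
      suc (length (as List.++ bs))   ≡⟨ cong suc (Listₚ.length-++ as) ⟩
      suc (length as + length bs)    ≡⟨ ℕₚ.+-suc (length as) (length bs) ⟨
      length as + suc (length bs)    ≡⟨ Listₚ.length-++ as ⟨
      length (as List.++ x ∷ bs)     ∎
    where
    open ℕₚ.≤-Reasoning
    xs⊆as++bs : ∀ {y} → y ∈ xs → y ∈ as List.++ bs
    xs⊆as++bs y∈xs with ∈-++⁻ as (xs⊆ (there y∈xs))
    ... | inj₁ y∈as          = ∈-++⁺ˡ y∈as
    ... | inj₂ (here y≡x)    = contradiction (sym y≡x) (All.lookup x≢ y∈xs)
    ... | inj₂ (there y∈bs)  = ∈-++⁺ʳ as y∈bs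

  module _ {n : ℕ} (G : Graph n) where
    open Graph G

    private
      variable
        k l : ℕ
        u v w x : Fin n

    infix 4 _⇸_

    -- The walk does not step to x first.
    _⇸_ : Fin n → Walk G k u v → Set
    x ⇸ []               = ⊤
    x ⇸ (_∷_ {v = y} _ _) = x ≢ y

    NonBacktracking : Walk G k u v → Set
    NonBacktracking []              = ⊤
    NonBacktracking (_∷_ {u = x} _ p) = x ⇸ p × NonBacktracking p

    Trail : ℕ → Fin n → Fin n → Set
    Trail k u v = ∃ λ (p : Walk G k u v) → NonBacktracking p

    -- The condition for gluing two walks at their common start. It holds vacuously if either walk
    -- is empty.
    Diverge : Walk G k u v → Walk G l u w → Set
    Diverge []                q = ⊤
    Diverge (_∷_ {v = y} _ _) q = y ⇸ q

    -- The edges of `p` are moved one at a time, reversed, to the front of `q`. Divergence says that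
    -- the moved edge does not backtrack, and non-backtracking of `p` restores divergence for the
    -- next one.
    join : (p : Walk G k u v) → NonBacktracking p → (q : Walk G l u w) → NonBacktracking q →
           Diverge p q → Trail (k + l) v w
    join []      _        q nq _ = q , nq
    join {l = l} {w = w} (_∷_ {k = k} {u = u} {v = y} {w = v} a p) (u⇸p , np) q nq d =
      subst (λ m → Trail m v w) (ℕₚ.+-suc k l)
        (join p np (Adj-sym a ∷ q) (d , nq) (turn p u⇸p))
      where
      turn : ∀ {j} (p : Walk G j y v) → u ⇸ p → Diverge p (Adj-sym a ∷ q)
      turn []      _   = tt
      turn (_ ∷ _) u≢z = λ z≡u → u≢z (sym z≡u)

    -- The opposite motion: the first `i` edges of `q` go, reversed, to the front of `p`. Started
    -- with `p` empty, it cuts a trail at its `i`-th vertex into two divergent ones. The length `j`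
    -- is given by an equation because the recursion trades `suc i + k` for `i + suc k`.
    split-trail : ∀ i {j l} → j ≡ i + k → (p : Walk G k u v) → NonBacktracking p →
            (q : Walk G (i + l) u w) → NonBacktracking q → Diverge p q →
            ∃ λ c → ∃ λ (p′ : Trail j c v) → ∃ λ (q′ : Trail l c w) → Diverge (proj₁ p′) (proj₁ q′)
    split-trail zero    refl p np q nq d = _ , (p , np) , (q , nq) , d
    split-trail {k = k} {u = u} {v = v} (suc i) j≡ p np (_∷_ {v = y} a q) (u⇸q , nq) d =
      split-trail i (Eq.trans j≡ (sym (ℕₚ.+-suc i k))) (Adj-sym a ∷ p) (first p d , np) q nq u⇸q
      where
      first : ∀ {j} (p : Walk G j u v) → Diverge p (a ∷ q) → y ⇸ p
      first []      _   = tt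
      first (_ ∷ _) z≢y = λ y≡z → z≢y (sym y≡z)

    diverge-[] : (p : Walk G k u v) → Diverge p ([] {v = u})
    diverge-[] []      = tt
    diverge-[] (_ ∷ _) = tt

    -- The first step of `r` agrees with that of at most one of two divergent walks. Hence a trail
    -- from the midpoint of a longest path prolongs one of its halves.
    diverge-either : ∀ {j} {p : Walk G k u v} {q : Walk G l u w} → Diverge p q →
                     (r : Walk G j u x) → Diverge r p ⊎ Diverge r q
    diverge-either {p = []}    _   r  = inj₁ (diverge-[] r)
    diverge-either {p = _ ∷ _} _   [] = inj₁ tt
    diverge-either {p = _∷_ {v = y} _ _} {q} d (_∷_ {v = z} a r) with z Fin.≟ y
    ... | no  z≢y  = inj₁ z≢y
    ... | yes refl = inj₂ d

    nonBacktracking : Walk G k u v → ∃ λ l → Trail l u v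
    nonBacktracking []      = 0 , [] , tt
    nonBacktracking {u = u} (a ∷ p) with nonBacktracking p
    ... | _ , [] , _ = 1 , a ∷ [] , tt , tt
    ... | suc l , _∷_ {v = z} b q , z≢ , nq with u Fin.≟ z
    -- The new edge is undone at once, so both steps are cancelled.
    ...   | yes refl = l , q , nq
    ...   | no  u≢z  = suc (suc l) , a ∷ b ∷ q , u≢z , z≢ , nq

    end-visited : (p : Walk G k u v) → v ∈ visited G p
    end-visited []      = here refl
    end-visited (_ ∷ p) = there (end-visited p)

    length-visited : (p : Walk G k u v) → length (visited G p) ≡ suc k
    length-visited []      = refl
    length-visited (_ ∷ p) = cong suc (length-visited p)

    -- The last component keeps the first step of `p`; it is what rules out an immediate return in
    -- `unique-visited`.
    prefix : (p : Walk G k u v) → Unique (visited G p) → x ∈ visited G p →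
             ∃ λ l → ∃ λ (q : Walk G l u x) → Unique (visited G q)
               × (∀ {y} → y ∈ visited G q → y ∈ visited G p) × (∀ {y} → y ⇸ p → y ⇸ q)
    prefix []      uniq (here refl) = 0 , [] , uniq , (λ y∈ → y∈) , λ _ → tt
    prefix (a ∷ p) uniq (here refl) = 0 , [] , (All.[] ∷ []) , (λ { (here e) → here e }) , λ _ → tt
    prefix (a ∷ p) (u∉ ∷ uniq) (there x∈) with prefix p uniq x∈
    ... | l , q , uniq′ , q⊆p , _ =
      suc l , a ∷ q , All.tabulate (λ y∈q → All.lookup u∉ (q⊆p y∈q)) ∷ uniq′ ,
      (λ { (here e) → here e ; (there y∈) → there (q⊆p y∈) }) , λ y⇸ → y⇸

    module _ (acyclic : Acyclic G) where

      -- If `p` came back to `u`, the part from `y` to `u` together with `a` would be a loop at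
      -- length 0, a backtracking step at length 1, and a cycle at any greater length.
      unique-visited : (p : Walk G k u v) → NonBacktracking p → Unique (visited G p)
      unique-visited []      _          = All.[] ∷ []
      unique-visited {u = u} (_∷_ {v = y} a p) (u⇸p , np) = All.tabulate u∉ ∷ uniq
        where
        uniq = unique-visited p np
        u∉ : x ∈ visited G p → u ≢ x
        u∉ x∈p refl with prefix p uniq x∈p
        ... | 0 , [] , _ = loopless a
        ... | 1 , b ∷ [] , _ , _ , first = first u⇸p refl
        ... | suc (suc l) , q , uniq′ , _ = acyclic q uniq′ (s≤s (s≤s z≤n)) a

      no-closed-trail : ¬ Trail (suc k) u u
      no-closed-trail (a ∷ p , np) with unique-visited (a ∷ p) np
      ... | u∉ ∷ _ = All.lookup u∉ (end-visited p) refl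

      -- Common first steps are stripped. Where the trails part, they would join to a closed trail,
      -- which visits its start twice.
      trail-length-unique : Trail k u v → Trail l u v → k ≡ l
      trail-length-unique ([] , _)    ([] , _)    = refl
      trail-length-unique ([] , _)    (q@(_ ∷ _) , nq) = contradiction (q , nq) no-closed-trail
      trail-length-unique (p@(_ ∷ _) , np) ([] , _) = contradiction (p , np) no-closed-trail
      trail-length-unique (p@(_∷_ {v = y} _ p′) , np) (q@(_∷_ {v = z} _ q′) , nq) with y Fin.≟ z
      ... | yes refl = cong suc (trail-length-unique (p′ , proj₂ np) (q′ , proj₂ nq))
      ... | no  y≢z  = contradiction (join p np q nq y≢z) no-closed-trail

      trail-length-< : Trail k u v → k < n
      trail-length-< {k = k} (p , np) = begin
          suc k                   ≡⟨ length-visited p ⟨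
          length (visited G p)    ≤⟨ unique-length-≤ (unique-visited p np) (λ {x} _ → ∈-allFin x) ⟩
          length (allFin n)       ≡⟨ Listₚ.length-tabulate (λ i → i) ⟩
          n                       ∎
        where open ℕₚ.≤-Reasoning

    module _ (conn : Connected G) where

      dist-≤ : Walk G k u v → dist G conn u v ≤ k
      dist-≤ {k = k} {u = u} {v = v} p =
        proj₂ (proj₂ (least (λ j → walk? G j u v) (proj₁ (conn u v)) (proj₂ (conn u v)))) k p

      shortest : ∀ u v → Walk G (dist G conn u v) u v
      shortest u v =
        proj₁ (proj₂ (least (λ j → walk? G j u v) (proj₁ (conn u v)) (proj₂ (conn u v))))

      eccentricity-≤ : (∀ v → dist G conn u v ≤ k) → eccentricity G conn u ≤ k
      eccentricity-≤ {u = u} d≤k = max≤v⁺ z≤n (Allₚ.map⁺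
        (All.tabulate {xs = List.filter (λ w → ¬? (w Fin.≟ u)) (allFin n)} λ {v} _ → d≤k v))

      dist-≤-eccentricity : ∀ u v → dist G conn u v ≤ eccentricity G conn u
      dist-≤-eccentricity u v with v Fin.≟ u
      ... | yes refl = ℕₚ.≤-trans (dist-≤ []) z≤n
      ... | no  v≢u  = v≤max⁺ 0 _ (inj₂ (Anyₚ.map⁺ (Any.map (λ { refl → ℕₚ.≤-refl })
                         (∈-filter⁺ (λ w → ¬? (w Fin.≟ u)) (∈-allFin v) v≢u))))

  minimum-≤ : ∀ {k xs} → k ∈ xs → minimum xs ≤ k
  minimum-≤ {xs = x ∷ xs} (here refl) = min≤⊤ x xs
  minimum-≤ {xs = x ∷ xs} (there k∈)  = All.lookup (min≤xs x xs) k∈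

  minimum-≥ : ∀ {k xs} → 0 < length xs → (∀ {x} → x ∈ xs → k ≤ x) → k ≤ minimum xs
  minimum-≥ {xs = x ∷ xs} _ k≤ = v≤min⁺ (k≤ (here refl)) (All.tabulate λ x∈ → k≤ (there x∈))

  module _ {n : ℕ} (G : Graph n) (conn : Connected G) where

    radius-≤ : ∀ c {k} → (∀ v → dist G conn c v ≤ k) → radius G conn ≤ k
    radius-≤ c d≤k = ℕₚ.≤-trans (minimum-≤ (∈-map⁺ (eccentricity G conn) (∈-allFin c)))
                                 (eccentricity-≤ G conn d≤k)

    radius-≥ : ∀ {k} → 0 < n → (∀ u → ∃ λ v → k ≤ dist G conn u v) → k ≤ radius G conn
    radius-≥ {k} 0<n far = minimum-≥ (subst (0 <_) (sym length≡n) 0<n) k≤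
      where
      length≡n : length (List.map (eccentricity G conn) (allFin n)) ≡ n
      length≡n = Eq.trans (Listₚ.length-map _ (allFin n)) (Listₚ.length-tabulate (λ i → i))
      k≤ : ∀ {e} → e ∈ List.map (eccentricity G conn) (allFin n) → k ≤ e
      k≤ e∈ with ∈-map⁻ (eccentricity G conn) e∈
      ... | u , _ , refl = ℕₚ.≤-trans (proj₂ (far u)) (dist-≤-eccentricity G conn u (proj₁ (far u)))

    -- Cut the longest trail at `c` into parts of lengths `i` and `l`. A trail of length `k` from
    -- `c` prolongs one of them, so `k + i` or `k + l` is at most `i + l`, and `k ≤ l` in both
    -- cases.
    radius-≤-half-longest : ∀ {i l u v} → i ≤ l → Trail G (i + l) u v →
      (∀ {k x y} → Trail G k x y → k ≤ i + l) → radius G conn ≤ l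
    radius-≤-half-longest {i} {l} i≤l (p , np) longest
      with split-trail G i {l = l} (sym (ℕₚ.+-identityʳ i)) [] tt p np tt
    ... | c , (p′ , np′) , (q′ , nq′) , d = radius-≤ c close
      where
      close : ∀ x → dist G conn c x ≤ l
      close x with nonBacktracking G (proj₂ (conn c x))
      ... | k , r , nr = ℕₚ.≤-trans (dist-≤ G conn r) (bound (diverge-either G d r))
        where
        bound : Diverge G r p′ ⊎ Diverge G r q′ → k ≤ l
        bound (inj₁ r∥p′) = ℕₚ.+-cancelˡ-≤ i k l
          (subst (_≤ i + l) (ℕₚ.+-comm k i) (longest (join G r nr p′ np′ r∥p′)))
        bound (inj₂ r∥q′) = ℕₚ.≤-trans (ℕₚ.+-cancelʳ-≤ l k i (longest (join G r nr q′ nq′ r∥q′))) i≤l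

-- Finite sums in a commutative monoid and double counting of edges.

module Sums where

  open import Algebra.Bundles using (CommutativeMonoid)
  open import Data.Nat using (ℕ; zero; suc)
  open import Data.Fin as Fin using (Fin)
  import Data.Fin.Properties as Finₚ
  open import Data.List as List using (List; []; _∷_; _++_; length; map; filter; foldr; allFin; tabulate; cartesianProduct)
  open import Data.Product using (_×_; _,_; proj₂)
  open import Data.List.Membership.Propositional using (_∈_)
  open import Data.List.Membership.Propositional.Properties using (∈-filter⁻)
  open import Data.List.Relation.Unary.Any using (here; there)
  open import Function using (_∘_; id)
  open import Relation.Nullary using (¬_; Dec; yes; no; contradiction)
  open import Relation.Nullary.Decidable using (_×-dec_)
  open import Relation.Binary using (tri<; tri≈; tri>)
  open import Relation.Binary.PropositionalEquality as Eq using (_≢_)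

  module FiniteSums {c ℓ} (M : CommutativeMonoid c ℓ) where
    open CommutativeMonoid M renaming (ε to 0#)
    open import Algebra.Properties.CommutativeMonoid.Sum M
      using (sum; sum-cong-≋; ∑-distrib-+; ∑-comm; sum-replicate; sum-replicate-zero)
    open import Algebra.Properties.Monoid.Mult monoid using () renaming (_×_ to _⋆_)
    open import Relation.Binary.Reasoning.Setoid setoid

    when : ∀ {p} {P : Set p} → Dec P → Carrier → Carrier
    when (yes _) x = x
    when (no  _) x = 0#

    module _ {p} {P : Set p} where

      when-yes : (P? : Dec P) {x : Carrier} → P → when P? x ≈ x
      when-yes (yes _) _ = refl
      when-yes (no ¬p) p = contradiction p ¬p

      when-no : (P? : Dec P) {x : Carrier} → ¬ P → when P? x ≈ 0#
      when-no (yes p) ¬p = contradiction p ¬p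
      when-no (no _)  _  = refl

      when-0 : (P? : Dec P) → when P? 0# ≈ 0#
      when-0 (yes _) = refl
      when-0 (no _)  = refl

      when-cong : (P? : Dec P) {x y : Carrier} → (P → x ≈ y) → when P? x ≈ when P? y
      when-cong (yes p) x≈y = x≈y p
      when-cong (no _)  _   = refl

      when-∙ : (P? : Dec P) (x y : Carrier) → when P? (x ∙ y) ≈ when P? x ∙ when P? y
      when-∙ (yes _) x y = refl
      when-∙ (no  _) x y = sym (identityˡ 0#)

    listSum : ∀ {a} {A : Set a} → (A → Carrier) → List A → Carrier
    listSum f xs = foldr _∙_ 0# (map f xs)

    -- Abstract, so that unification can read the summand off a sum.
    abstract

      ∑ : ∀ {n} → (Fin n → Carrier) → Carrier
      ∑ f = sum f

      ∑-preserves : ∀ {r} (R : Carrier → Carrier → Set r) → R 0# 0# →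
        (∀ {x y u v} → R x y → R u v → R (x ∙ u) (y ∙ v)) →
        ∀ {n} {f g : Fin n → Carrier} → (∀ i → R (f i) (g i)) → R (∑ f) (∑ g)
      ∑-preserves R R0 R∙ {zero}  Rfg = R0
      ∑-preserves R R0 R∙ {suc n} Rfg = R∙ (Rfg Fin.zero) (∑-preserves R R0 R∙ (Rfg ∘ Fin.suc))

      ∑-∙ : ∀ {n} (f g : Fin n → Carrier) → ∑ (λ i → f i ∙ g i) ≈ ∑ f ∙ ∑ g
      ∑-∙ = ∑-distrib-+

      ∑-swap : ∀ {m n} (f : Fin m → Fin n → Carrier) → (∑ λ i → ∑ λ j → f i j) ≈ (∑ λ j → ∑ λ i → f i j)
      ∑-swap = ∑-comm

      ∑-const : ∀ n x → ∑ {n} (λ _ → x) ≈ n ⋆ x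
      ∑-const n x = sum-replicate n

      ∑-single : ∀ {n} (i : Fin n) (f : Fin n → Carrier) → (∀ j → j ≢ i → f j ≈ 0#) → ∑ f ≈ f i
      ∑-single {suc n} Fin.zero f f≈0 = begin
        f Fin.zero ∙ sum (f ∘ Fin.suc)        ≈⟨ ∙-congˡ (sum-cong-≋ λ j → f≈0 (Fin.suc j) λ ()) ⟩
        f Fin.zero ∙ sum {n} (λ _ → 0#)       ≈⟨ ∙-congˡ (sum-replicate-zero n) ⟩
        f Fin.zero ∙ 0#                       ≈⟨ identityʳ _ ⟩
        f Fin.zero                            ∎
      ∑-single {suc n} (Fin.suc i) f f≈0 = begin
        f Fin.zero ∙ sum (f ∘ Fin.suc)
          ≈⟨ ∙-cong (f≈0 Fin.zero λ ())
                    (∑-single i (f ∘ Fin.suc) λ j j≢i → f≈0 (Fin.suc j) (j≢i ∘ Finₚ.suc-injective)) ⟩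
        0# ∙ f (Fin.suc i)                    ≈⟨ identityˡ _ ⟩
        f (Fin.suc i)                         ∎

      listSum-tabulate : ∀ {a} {A : Set a} {n} (f : A → Carrier) (g : Fin n → A) →
                          listSum f (tabulate g) ≈ ∑ (f ∘ g)
      listSum-tabulate {n = zero}  f g = refl
      listSum-tabulate {n = suc n} f g = ∙-congˡ (listSum-tabulate f (g ∘ Fin.suc))

    ∑-cong : ∀ {n} {f g : Fin n → Carrier} → (∀ i → f i ≈ g i) → ∑ f ≈ ∑ g
    ∑-cong = ∑-preserves _≈_ refl ∙-cong

    module _ {a} {A : Set a} where

      listSum-++ : ∀ (f : A → Carrier) xs ys → listSum f (xs ++ ys) ≈ listSum f xs ∙ listSum f ys
      listSum-++ f []       ys = sym (identityˡ _)
      listSum-++ f (x ∷ xs) ys = trans (∙-congˡ (listSum-++ f xs ys)) (sym (assoc _ _ _))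

      listSum-filter : ∀ {p} {P : A → Set p} (P? : ∀ x → Dec (P x)) (f : A → Carrier) xs →
                       listSum f (filter P? xs) ≈ listSum (λ x → when (P? x) (f x)) xs
      listSum-filter P? f []       = refl
      listSum-filter P? f (x ∷ xs) with P? x
      ... | yes _ = ∙-congˡ (listSum-filter P? f xs)
      ... | no  _ = trans (listSum-filter P? f xs) (sym (identityˡ _))

      listSum-const : ∀ x (xs : List A) → listSum (λ _ → x) xs ≈ length xs ⋆ x
      listSum-const x []       = refl
      listSum-const x (_ ∷ xs) = ∙-congˡ (listSum-const x xs)

    listSum-map : ∀ {a b} {A : Set a} {B : Set b} (f : B → Carrier) (g : A → B) xs →
                  listSum f (map g xs) ≈ listSum (f ∘ g) xs
    listSum-map f g []       = refl
    listSum-map f g (x ∷ xs) = ∙-congˡ (listSum-map f g xs)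

    listSum-cong : ∀ {a} {A : Set a} {f g : A → Carrier} → (∀ x → f x ≈ g x) → ∀ xs → listSum f xs ≈ listSum g xs
    listSum-cong f≈g []       = refl
    listSum-cong f≈g (x ∷ xs) = ∙-cong (f≈g x) (listSum-cong f≈g xs)

    listSum-cong-∈ : ∀ {a} {A : Set a} {f g : A → Carrier} xs → (∀ {x} → x ∈ xs → f x ≈ g x) →
                     listSum f xs ≈ listSum g xs
    listSum-cong-∈ []       f≈g = refl
    listSum-cong-∈ (x ∷ xs) f≈g = ∙-cong (f≈g (here Eq.refl)) (listSum-cong-∈ xs (f≈g ∘ there))

    listSum-cartesianProduct : ∀ {a b} {A : Set a} {B : Set b} (f : A × B → Carrier) xs ys →
      listSum f (cartesianProduct xs ys) ≈ listSum (λ x → listSum (λ y → f (x , y)) ys) xs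
    listSum-cartesianProduct f []       ys = refl
    listSum-cartesianProduct f (x ∷ xs) ys = begin
      listSum f (map (x ,_) ys ++ cartesianProduct xs ys)
        ≈⟨ listSum-++ f (map (x ,_) ys) _ ⟩
      listSum f (map (x ,_) ys) ∙ listSum f (cartesianProduct xs ys)
        ≈⟨ ∙-cong (listSum-map f (x ,_) ys) (listSum-cartesianProduct f xs ys) ⟩
      listSum (λ y → f (x , y)) ys ∙ listSum (λ x → listSum (λ y → f (x , y)) ys) xs  ∎

    module _ {n : ℕ} (G : Graph n) where
      open Graph G

      neighbourSum : (Fin n → Carrier) → Fin n → Carrier
      neighbourSum f u = ∑ λ v → when (Adj? u v) (f v)

      neighbourSum-const : ∀ x u → neighbourSum (λ _ → x) u ≈ degree G u ⋆ x
      neighbourSum-const x u = begin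
        ∑ (λ v → when (Adj? u v) x)                     ≈⟨ listSum-tabulate (λ v → when (Adj? u v) x) id ⟨
        listSum (λ v → when (Adj? u v) x) (allFin n)    ≈⟨ listSum-filter (Adj? u) (λ _ → x) (allFin n) ⟨
        listSum (λ _ → x) (filter (Adj? u) (allFin n))  ≈⟨ listSum-const x (filter (Adj? u) (allFin n)) ⟩
        degree G u ⋆ x                                  ∎

      neighbourSum-∙ : ∀ f g u → neighbourSum (λ v → f v ∙ g v) u ≈ neighbourSum f u ∙ neighbourSum g u
      neighbourSum-∙ f g u = trans (∑-cong λ v → when-∙ (Adj? u v) (f v) (g v)) (∑-∙ _ _)

      neighbourSum-single : ∀ x w u → neighbourSum (λ v → when (v Fin.≟ w) x) u ≈ when (Adj? u w) x
      neighbourSum-single x w u = trans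
        (∑-single w _ λ v v≢w → trans (when-cong (Adj? u v) λ _ → when-no (v Fin.≟ w) v≢w) (when-0 (Adj? u v)))
        (when-cong (Adj? u w) λ _ → when-yes (w Fin.≟ w) Eq.refl)

      Adj-edgeList : ∀ {u v} → (u , v) ∈ edgeList G → Adj u v
      Adj-edgeList uv∈ = proj₂ (proj₂ (∈-filter⁻ (λ (u , v) → (u Fin.<? v) ×-dec Adj? u v)
        {xs = cartesianProduct (allFin n) (allFin n)} uv∈))

      -- `f u v` is the part of the edge assigned to `u` and need not be symmetric. Swapping the
      -- sums in the second half renames the endpoints; then each ordered adjacent pair occurs once,
      -- as exactly one of u < v and v < u holds.
      edge-double-counting : ∀ (f : Fin n → Fin n → Carrier) →
        listSum (λ (u , v) → f u v ∙ f v u) (edgeList G) ≈ ∑ λ u → neighbourSum (f u) u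
      edge-double-counting f = begin
        listSum (λ (u , v) → f u v ∙ f v u) (edgeList G)
          ≈⟨ listSum-filter (λ (u , v) → up? u v) both pairs ⟩
        listSum (λ (u , v) → when (up? u v) (both (u , v))) pairs
          ≈⟨ listSum-cartesianProduct (λ (u , v) → when (up? u v) (both (u , v))) (allFin n) (allFin n) ⟩
        listSum (λ u → listSum (λ v → when (up? u v) (f u v ∙ f v u)) (allFin n)) (allFin n)
          ≈⟨ listSum-cong (λ u → listSum-tabulate (λ v → when (up? u v) (both (u , v))) id) (allFin n) ⟩
        listSum (λ u → ∑ λ v → when (up? u v) (f u v ∙ f v u)) (allFin n)
          ≈⟨ listSum-tabulate (λ u → ∑ λ v → when (up? u v) (both (u , v))) id ⟩
        (∑ λ u → ∑ λ v → when (up? u v) (f u v ∙ f v u))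
          ≈⟨ ∑-cong (λ u → trans (∑-cong λ v → when-∙ (up? u v) (f u v) (f v u)) (∑-∙ _ _)) ⟩
        (∑ λ u → (∑ λ v → when (up? u v) (f u v)) ∙ (∑ λ v → when (up? u v) (f v u)))
          ≈⟨ ∑-∙ _ _ ⟩
        (∑ λ u → ∑ λ v → when (up? u v) (f u v)) ∙ (∑ λ u → ∑ λ v → when (up? u v) (f v u))
          ≈⟨ ∙-congˡ (∑-swap λ u v → when (up? u v) (f v u)) ⟩
        (∑ λ u → ∑ λ v → when (up? u v) (f u v)) ∙ (∑ λ u → ∑ λ v → when (up? v u) (f u v))
          ≈⟨ ∑-∙ _ _ ⟨
        (∑ λ u → (∑ λ v → when (up? u v) (f u v)) ∙ (∑ λ v → when (up? v u) (f u v)))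
          ≈⟨ ∑-cong (λ u → trans (sym (∑-∙ _ _)) (∑-cong (one-direction u))) ⟩
        (∑ λ u → neighbourSum (f u) u)  ∎
        where
        pairs : List (Fin n × Fin n)
        pairs = cartesianProduct (allFin n) (allFin n)
        both : Fin n × Fin n → Carrier
        both (u , v) = f u v ∙ f v u
        up? : ∀ u v → Dec (u Fin.< v × Adj u v)
        up? u v = (u Fin.<? v) ×-dec Adj? u v
        one-direction′ : ∀ u v (A? : Dec (Adj u v)) →
          when (up? u v) (f u v) ∙ when (up? v u) (f u v) ≈ when A? (f u v)
        one-direction′ u v (no ¬a) =
          trans (∙-cong (when-no (up? u v) λ (_ , a) → ¬a a)
                        (when-no (up? v u) λ (_ , a) → ¬a (Adj-sym a))) (identityˡ 0#)
        one-direction′ u v (yes a) with Finₚ.<-cmp u v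
        ... | tri< u<v _ v≮u = trans (∙-cong (when-yes (up? u v) (u<v , a))
                                             (when-no (up? v u) λ (lt , _) → v≮u lt)) (identityʳ _)
        ... | tri≈ _ Eq.refl _ = contradiction a loopless
        ... | tri> u≮v _ v<u = trans (∙-cong (when-no (up? u v) λ (lt , _) → u≮v lt)
                                             (when-yes (up? v u) (v<u , Adj-sym a))) (identityˡ _)
        one-direction : ∀ u v → when (up? u v) (f u v) ∙ when (up? v u) (f u v) ≈ when (Adj? u v) (f u v)
        one-direction u v = one-direction′ u v (Adj? u v)

      edge-sum-split : ∀ (w : Fin n × Fin n → Carrier) (g : Fin n → Carrier) →
        (∀ u v → Adj u v → w (u , v) ≈ g u ∙ g v) →
        listSum w (edgeList G) ≈ ∑ λ u → degree G u ⋆ g u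
      edge-sum-split w g w≈ = begin
        listSum w (edgeList G)
          ≈⟨ listSum-cong-∈ (edgeList G) (λ {(u , v)} uv∈ → w≈ u v (Adj-edgeList uv∈)) ⟩
        listSum (λ (u , v) → g u ∙ g v) (edgeList G)
          ≈⟨ edge-double-counting (λ u _ → g u) ⟩
        (∑ λ u → neighbourSum (λ _ → g u) u)
          ≈⟨ ∑-cong (λ u → neighbourSum-const (g u) u) ⟩
        (∑ λ u → degree G u ⋆ g u)  ∎

      -- A monoid has no subtraction, so the exceptional value is presented as `x ∙ δ`: every term
      -- is `x` together with indicator corrections at `a` and `b`.
      two-exceptions : ∀ {x y δ : Carrier} (f : Fin n → Carrier) {a b} → a ≢ b → y ≈ x ∙ δ →
        f a ≈ y → f b ≈ y → (∀ u → u ≢ a → u ≢ b → f u ≈ x) → ∑ f ≈ (n ⋆ x) ∙ (δ ∙ δ)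
      two-exceptions {x} {y} {δ} f {a} {b} a≢b y≈ fa fb f≈ = begin
        ∑ f
          ≈⟨ ∑-cong pointwise ⟩
        (∑ λ u → x ∙ (when (u Fin.≟ a) δ ∙ when (u Fin.≟ b) δ))
          ≈⟨ ∑-∙ (λ _ → x) (λ u → when (u Fin.≟ a) δ ∙ when (u Fin.≟ b) δ) ⟩
        ∑ (λ _ → x) ∙ (∑ λ u → when (u Fin.≟ a) δ ∙ when (u Fin.≟ b) δ)
          ≈⟨ ∙-cong (∑-const n x) (trans (∑-∙ _ _) (∙-cong (point a) (point b))) ⟩
        (n ⋆ x) ∙ (δ ∙ δ)  ∎
        where
        point : ∀ w → (∑ λ u → when (u Fin.≟ w) δ) ≈ δ
        point w = trans (∑-single w _ λ u u≢w → when-no (u Fin.≟ w) u≢w) (when-yes (w Fin.≟ w) Eq.refl)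
        pointwise : ∀ u → f u ≈ x ∙ (when (u Fin.≟ a) δ ∙ when (u Fin.≟ b) δ)
        pointwise u with u Fin.≟ a | u Fin.≟ b
        ... | yes Eq.refl | yes Eq.refl = contradiction Eq.refl a≢b
        ... | yes Eq.refl | no _        = trans fa (trans y≈ (∙-congˡ (sym (identityʳ δ))))
        ... | no _        | yes Eq.refl = trans fb (trans y≈ (∙-congˡ (sym (identityˡ δ))))
        ... | no u≢a      | no u≢b      =
          trans (f≈ u u≢a u≢b) (sym (trans (∙-congˡ (identityˡ 0#)) (identityʳ x)))

-- Longest paths and the tree rooted at an end of one.

module Spines where

  open Trails
  open import Data.Nat as ℕ using (ℕ; zero; suc; pred; _+_; _∸_; _≤_; _<_; s≤s; z≤n; ⌊_/2⌋; ⌈_/2⌉)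
  import Data.Nat.Properties as ℕₚ
  open import Data.Fin as Fin using (Fin; toℕ; fromℕ<)
  import Data.Fin.Properties as Finₚ
  open import Data.Fin.Permutation using (Permutation; permutation; _⟨$⟩ʳ_; ↔⇒≡)
  open import Data.List as List using ([]; _∷_; length; allFin; cartesianProduct)
  open import Data.List.Extrema.Nat using (argmax; f[xs]≤f[argmax])
  open import Data.List.Membership.Propositional using (_∈_)
  open import Data.List.Membership.Propositional.Properties using (∈-allFin; ∈-filter⁺; ∈-filter⁻; ∈-cartesianProduct⁺)
  open import Data.List.Relation.Unary.Any using (here)
  open import Data.List.Relation.Unary.All as All using (All; []; _∷_)
  open import Data.List.Relation.Unary.AllPairs using ([]; _∷_)
  open import Data.List.Relation.Unary.Unique.Propositional using (Unique)
  import Data.List.Relation.Unary.Unique.Propositional.Properties as Uniqueₚ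
  open import Data.Product using (∃; _×_; _,_; proj₁; proj₂)
  open import Data.Sum using (_⊎_; inj₁; inj₂)
  open import Data.Unit using (tt)
  open import Function.Bundles using (mk⇔)
  open import Relation.Nullary using (¬_; yes; no; contradiction)
  open import Relation.Binary.PropositionalEquality as Eq using (_≡_; _≢_; refl; cong; sym; subst; trans)

  module _ {n : ℕ} (G : Graph n) where
    open Graph G

    degree-≥ : ∀ {u vs} → Unique vs → All (Adj u) vs → length vs ≤ degree G u
    degree-≥ {u} uniq adj = unique-length-≤ uniq
      λ {v} v∈ → ∈-filter⁺ (Adj? u) (∈-allFin v) (All.lookup adj v∈)

    degree-≤ : ∀ {u} vs → (∀ {v} → Adj u v → v ∈ vs) → degree G u ≤ length vs
    degree-≤ {u} vs adj∈ = unique-length-≤ (Uniqueₚ.filter⁺ (Adj? u) (Uniqueₚ.allFin⁺ n))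
      λ v∈ → adj∈ (proj₂ (∈-filter⁻ (Adj? u) {xs = allFin n} v∈))

    -- A longest path together with the rooting of the tree at one of its ends;
    -- spine i is the vertex of the path at height i.
    record Spine : Set where
      field
        D        : ℕ
        height   : Fin n → ℕ
        parent   : Fin n → Fin n
        spine    : ℕ → Fin n

      Child : Fin n → Fin n → Set
      Child u v = height v ≡ suc (height u) × parent v ≡ u

      field
        edge          : ∀ {u v} → Adj u v → Child u v ⊎ Child v u
        parent-adj    : ∀ {v} → 0 < height v → Adj (parent v) v
        height-parent : ∀ v → height (parent v) ≡ pred (height v)
        height-≤      : ∀ v → height v ≤ D
        height-0      : ∀ {v} → height v ≡ 0 → v ≡ spine 0
        height-spine  : ∀ {i} → i ≤ D → height (spine i) ≡ i
        parent-spine  : ∀ {i} → i < D → parent (spine (suc i)) ≡ spine i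
        bottom-leaf   : degree G (spine 0) ≤ 1
        top-leaf      : degree G (spine D) ≤ 1

      OnSpine : Fin n → Set
      OnSpine v = spine (height v) ≡ v

      spine-onSpine : ∀ {i} → i ≤ D → OnSpine (spine i)
      spine-onSpine i≤D = cong spine (height-spine i≤D)

      spine-adj : ∀ {i} → i < D → Adj (spine i) (spine (suc i))
      spine-adj {i} i<D = subst (λ u → Adj u (spine (suc i))) (parent-spine i<D)
        (parent-adj (subst (0 <_) (sym (height-spine i<D)) (s≤s z≤n)))

      spine-adj-parent : ∀ {i} → i < D → Adj (spine (suc i)) (spine i)
      spine-adj-parent i<D = Adj-sym (spine-adj i<D)

      spine-≢ : ∀ {i j} → i ≤ D → j ≤ D → i ≢ j → spine i ≢ spine j
      spine-≢ i≤D j≤D i≢j eq =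
        i≢j (trans (sym (height-spine i≤D)) (trans (cong height eq) (height-spine j≤D)))

      degree-inner : ∀ {i} → suc i < D → 2 ≤ degree G (spine (suc i))
      degree-inner {i} i+1<D = degree-≥
        ((spine-≢ (ℕₚ.≤-trans (ℕₚ.n≤1+n i) (ℕₚ.<⇒≤ i+1<D)) i+1<D
            (ℕₚ.<⇒≢ (ℕₚ.m<n⇒m<1+n (ℕₚ.n<1+n i))) ∷ []) ∷ [] ∷ [])
        (spine-adj-parent (ℕₚ.<-trans (ℕₚ.n<1+n i) i+1<D) ∷ spine-adj i+1<D ∷ [])

      degree-bottom : 0 < D → degree G (spine 0) ≡ 1
      degree-bottom 0<D = ℕₚ.≤-antisym bottom-leaf (degree-≥ ([] ∷ []) (spine-adj 0<D ∷ []))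

      degree-top : ∀ {i} → suc i ≡ D → degree G (spine D) ≡ 1
      degree-top {i} i+1≡D = ℕₚ.≤-antisym top-leaf (degree-≥ ([] ∷ [])
        (subst (λ k → Adj (spine k) (spine i)) i+1≡D (spine-adj-parent (ℕₚ.≤-reflexive i+1≡D)) ∷ []))

      -- Follow parents from `v` until one lies on the spine. It is adjacent to both its spine
      -- neighbours and to a child off the spine. It cannot be the bottom, which would then have
      -- degree at least 2.
      branch-vertex : ∀ v → ¬ OnSpine v → ∃ λ i → suc i < D × 3 ≤ degree G (spine (suc i))
      branch-vertex v off = go (height v) v refl off
        where
        go : ∀ h v → height v ≡ h → ¬ OnSpine v → ∃ λ i → suc i < D × 3 ≤ degree G (spine (suc i))
        go zero    v hv off = contradiction (trans (cong spine hv) (sym (height-0 hv))) off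
        go (suc k) v hv off with spine (height (parent v)) Fin.≟ parent v
        ... | no  off′ = go k (parent v) (trans (height-parent v) (cong pred hv)) off′
        ... | yes on = at k refl
          where
          k<D : k < D
          k<D = subst (_≤ D) hv (height-≤ v)
          parent≡ : parent v ≡ spine k
          parent≡ = trans (sym on) (cong spine (trans (height-parent v) (cong pred hv)))
          adj : Adj (spine k) v
          adj = subst (λ u → Adj u v) parent≡ (parent-adj (subst (0 <_) (sym hv) (s≤s z≤n)))
          next≢ : spine (suc k) ≢ v
          next≢ eq = off (trans (cong spine hv) eq)
          at : ∀ j → j ≡ k → ∃ λ i → suc i < D × 3 ≤ degree G (spine (suc i))
          at zero    refl = contradiction
            (ℕₚ.≤-trans (degree-≥ ((next≢ ∷ []) ∷ [] ∷ []) (spine-adj k<D ∷ adj ∷ [])) bottom-leaf)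
            λ { (s≤s ()) }
          at (suc i) refl = i , k<D , degree-≥
            ((spine-≢ i≤D k<D (ℕₚ.<⇒≢ (ℕₚ.m<n⇒m<1+n (ℕₚ.n<1+n i))) ∷ prev≢ ∷ []) ∷ (next≢ ∷ []) ∷ [] ∷ [])
            (spine-adj-parent (ℕₚ.<-trans (ℕₚ.n<1+n i) k<D) ∷ spine-adj k<D ∷ adj ∷ [])
            where
            i≤D : i ≤ D
            i≤D = ℕₚ.≤-trans (ℕₚ.m≤n+m i 2) k<D
            prev≢ : spine i ≢ v
            prev≢ eq = off (subst OnSpine eq (spine-onSpine i≤D))

      module _ (all-on : ∀ v → OnSpine v) where

        spine-permutation : Permutation n (suc D)
        spine-permutation = permutation (λ v → fromℕ< (s≤s (height-≤ v))) (λ i → spine (toℕ i))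
          (λ i → Finₚ.toℕ-injective (trans (Finₚ.toℕ-fromℕ< _)
                   (height-spine (ℕ.s≤s⁻¹ (Finₚ.toℕ<n i)))))
          (λ v → trans (cong spine (Finₚ.toℕ-fromℕ< _)) (all-on v))

        spine-order : n ≡ suc D
        spine-order = ↔⇒≡ spine-permutation

        spine-isPath : IsPath G
        spine-isPath = subst (λ m → G ≅ pathGraph m) (sym spine-order) record
          { vertices = spine-permutation
          ; edges    = λ u v → mk⇔ (λ a → to u v (edge a)) (from u v)
          }
          where
          index≡ : ∀ v → toℕ (spine-permutation ⟨$⟩ʳ v) ≡ height v
          index≡ v = Finₚ.toℕ-fromℕ< _
          to : ∀ u v → Child u v ⊎ Child v u →
               Graph.Adj (pathGraph (suc D)) (spine-permutation ⟨$⟩ʳ u) (spine-permutation ⟨$⟩ʳ v)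
          to u v (inj₁ (hv , _)) = inj₁ (trans (index≡ v) (trans hv (cong suc (sym (index≡ u)))))
          to u v (inj₂ (hu , _)) = inj₂ (trans (index≡ u) (trans hu (cong suc (sym (index≡ v)))))
          step : ∀ u v → toℕ (spine-permutation ⟨$⟩ʳ v) ≡ suc (toℕ (spine-permutation ⟨$⟩ʳ u)) → Adj u v
          step u v eq = Eq.subst₂ Adj (all-on u) (trans (cong spine (sym hv)) (all-on v))
            (spine-adj (subst (_≤ D) hv (height-≤ v)))
            where
            hv : height v ≡ suc (height u)
            hv = trans (sym (index≡ v)) (trans eq (cong suc (index≡ u)))
          from : ∀ u v →
            Graph.Adj (pathGraph (suc D)) (spine-permutation ⟨$⟩ʳ u) (spine-permutation ⟨$⟩ʳ v) → Adj u v
          from u v (inj₁ eq) = step u v eq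
          from u v (inj₂ eq) = Adj-sym (step v u eq)

    -- The length of a trail is determined by its ends, so it suffices to maximise over one chosen
    -- trail for each of the finitely many pairs.
    longest-trail : 0 < n → Connected G → Acyclic G →
      ∃ λ u → ∃ λ v → ∃ λ D → Trail G D u v × (∀ {k x y} → Trail G k x y → k ≤ D)
    longest-trail (s≤s _) conn acyclic =
      u , v , len (u , v) , proj₂ (nonBacktracking G (proj₂ (conn u v))) , longest
      where
      len : Fin n × Fin n → ℕ
      len (x , y) = proj₁ (nonBacktracking G (proj₂ (conn x y)))
      pairs = cartesianProduct (allFin n) (allFin n)
      best : Fin n × Fin n
      best = argmax len (Fin.zero , Fin.zero) pairs
      u = proj₁ best
      v = proj₂ best
      longest : ∀ {k x y} → Trail G k x y → k ≤ len (u , v)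
      longest {k} {x} {y} t = subst (_≤ len (u , v))
        (trail-length-unique G acyclic (proj₂ (nonBacktracking G (proj₂ (conn x y)))) t)
        (All.lookup (f[xs]≤f[argmax] {f = len} (Fin.zero , Fin.zero) pairs)
                    (∈-cartesianProduct⁺ (∈-allFin x) (∈-allFin y)))

    -- A second neighbour could be put in front of the trail.
    longest-end-leaf : ∀ {D u v} → Trail G D u v → (∀ {k x y} → Trail G k x y → k ≤ D) → degree G u ≤ 1
    longest-end-leaf ([] , _) longest = ℕₚ.≤-trans
      (degree-≤ [] λ a → contradiction (longest ((a ∷ []) , tt , tt)) λ ()) z≤n
    longest-end-leaf {u = u} (p@(_∷_ {v = y} _ _) , np) longest = degree-≤ (y ∷ []) only
      where
      only : ∀ {v} → Adj u v → v ∈ y ∷ []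
      only {v} a with v Fin.≟ y
      ... | yes v≡y = here v≡y
      ... | no  v≢y = contradiction (longest (join G (a ∷ []) (tt , tt) p np v≢y)) (ℕₚ.<⇒≱ (ℕₚ.n<1+n _))

    second : ∀ {k u v} → Walk G k u v → Fin n
    second {u = u} []    = u
    second (_∷_ {v = y} _ _) = y

    module _ (T : IsTree G) where

      private
        conn = connected T
        unique = trail-length-unique G (acyclic T)

      module _ {D e ρ} (P : Trail G D e ρ) (longest : ∀ {k x y} → Trail G k x y → k ≤ D) where

        private
          toRoot : ∀ v → ∃ λ k → Trail G k v ρ
          toRoot v = nonBacktracking G (proj₂ (conn v ρ))

          height : Fin n → ℕ
          height v = proj₁ (toRoot v)

          parent : Fin n → Fin n
          parent v = second (proj₁ (proj₂ (toRoot v)))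

          height≡ : ∀ {k v} → Trail G k v ρ → height v ≡ k
          height≡ t = unique (proj₂ (toRoot _)) t

          Child : Fin n → Fin n → Set
          Child u v = height v ≡ suc (height u) × parent v ≡ u

          -- The trail from `v` to the root either starts with `u` or can be preceded by `u`. The
          -- second case yields heights only; `edge` finds the parent by applying this to the
          -- reversed edge as well.
          half-edge : ∀ {u v} → Adj u v → Child u v ⊎ height u ≡ suc (height v)
          half-edge {u} {v} a with toRoot v
          ... | .0 , [] , _ = inj₂ (height≡ (a ∷ [] , tt , tt))
          ... | suc k , p@(_∷_ {v = y} _ q) , np with u Fin.≟ y
          ...   | yes refl = inj₁ (cong suc (sym (height≡ (q , proj₂ np))) , refl)
          ...   | no  u≢y  = inj₂ (height≡ (a ∷ p , u≢y , np))

          edge : ∀ {u v} → Adj u v → Child u v ⊎ Child v u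
          edge a with half-edge a
          ... | inj₁ c = inj₁ c
          ... | inj₂ hu with half-edge (Adj-sym a)
          ...   | inj₁ c  = inj₂ c
          ...   | inj₂ hv = contradiction (trans hu (cong suc hv)) (ℕₚ.<⇒≢ (ℕₚ.m<n⇒m<1+n (ℕₚ.n<1+n _)))

          parent-adj : ∀ {v} → 0 < height v → Adj (parent v) v
          parent-adj {v} 0<h with toRoot v
          ... | suc k , a ∷ _ , _ = Adj-sym a

          height-parent : ∀ v → height (parent v) ≡ pred (height v)
          height-parent v with toRoot v in eq
          ... | .0 , [] , _ = cong proj₁ eq
          ... | suc k , _ ∷ q , np = height≡ (q , proj₂ np)

          height-0 : ∀ {v} → height v ≡ 0 → v ≡ ρ
          height-0 {v} h≡0 with toRoot v
          ... | .0 , [] , _ = refl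

          ancestor : ℕ → Fin n
          ancestor zero    = e
          ancestor (suc j) = parent (ancestor j)

          height-ancestor : ∀ j → height (ancestor j) ≡ D ∸ j
          height-ancestor zero    = height≡ P
          height-ancestor (suc j) = trans (height-parent (ancestor j))
            (trans (cong pred (height-ancestor j)) (ℕₚ.pred[m∸n]≡m∸[1+n] D j))

          -- The vertices of the trail `P` are recovered as the iterated parents of its far end `e`,
          -- counted down from height `D`.
          spine : ℕ → Fin n
          spine i = ancestor (D ∸ i)

          height-spine : ∀ {i} → i ≤ D → height (spine i) ≡ i
          height-spine {i} i≤D = trans (height-ancestor (D ∸ i)) (ℕₚ.m∸[m∸n]≡n i≤D)

          spine-0 : spine 0 ≡ ρ
          spine-0 = height-0 (height-spine z≤n)

        rooted-spine : Spine
        rooted-spine = record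
          { D = D
          ; height = height
          ; parent = parent
          ; spine = spine
          ; edge = edge
          ; parent-adj = parent-adj
          ; height-parent = height-parent
          ; height-≤ = λ v → longest (proj₂ (toRoot v))
          ; height-0 = λ h≡0 → trans (height-0 h≡0) (sym spine-0)
          ; height-spine = height-spine
          ; parent-spine = λ {i} i<D → cong ancestor (sym (ℕₚ.+-∸-assoc 1 i<D))
          -- `longest-end-leaf` concerns the start of a trail. Joining `P` to the empty walk
          -- reverses it, at the cost of the length `D + 0`.
          ; bottom-leaf = subst (λ v → degree G v ≤ 1) (sym spine-0)
              (longest-end-leaf (join G (proj₁ P) (proj₂ P) [] tt (diverge-[] G (proj₁ P)))
                λ t → subst (_ ≤_) (sym (ℕₚ.+-identityʳ D)) (longest t))
          ; top-leaf = subst (λ j → degree G (ancestor j) ≤ 1) (sym (ℕₚ.n∸n≡0 D)) (longest-end-leaf P longest)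
          }

      tree-spine : 0 < n → ∃ λ (S : Spine) → Spine.D S < n × radius G conn ≤ ⌈ Spine.D S /2⌉
      tree-spine 0<n with longest-trail 0<n conn (acyclic T)
      ... | e , ρ , D , P , longest = rooted-spine P longest , trail-length-< G (acyclic T) P ,
        radius-≤-half-longest G conn (ℕₚ.⌊n/2⌋≤⌈n/2⌉ D)
          (subst (λ k → Trail G k e ρ) halves P) (λ t → subst (_ ≤_) halves (longest t))
        where
        halves : D ≡ ⌊ D /2⌋ + ⌈ D /2⌉
        halves = sym (ℕₚ.⌊n/2⌋+⌈n/2⌉≡n D)

-- Rational lower bounds for edge weights in terms of degrees.

module Weights where

  open Reals
  open Sums
  open import Data.Nat as ℕ using (ℕ; zero; suc; z≤n; s≤s)
  import Data.Nat.Properties as ℕₚ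
  open import Data.Integer using (+_)
  open import Data.Rational.Unnormalised as ℚᵘ
    using (ℚᵘ; mkℚᵘ; 0ℚᵘ; 1ℚᵘ; _+_; _*_; _-_; -_; _≤_; _≃_; _/_)
  import Data.Rational.Unnormalised.Properties as ℚₚ
  open import Data.Rational.Unnormalised.Solver using () renaming (module +-*-Solver to ℚ-Solver)
  open import Data.Nat.Solver using () renaming (module +-*-Solver to ℕ-Solver)
  open import Data.Product using (proj₁)
  open import Relation.Nullary.Decidable using (True; toWitness)
  open import Relation.Binary.PropositionalEquality as Eq using (_≡_; refl; cong; sym; subst)

  open import Algebra.Definitions.RawMonoid ℚᵘ.+-0-rawMonoid public using () renaming (_×_ to _⋆_)

  ⋆≃* : ∀ d x → d ⋆ x ≃ mkℚᵘ (+ d) 0 * x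
  ⋆≃* zero    x = ℚₚ.≃-sym (ℚₚ.*-zeroˡ x)
  ⋆≃* (suc d) x = begin
      x + d ⋆ x                            ≈⟨ ℚₚ.+-cong (ℚₚ.≃-sym (ℚₚ.*-identityˡ x)) (⋆≃* d x) ⟩
      1ℚᵘ * x + mkℚᵘ (+ d) 0 * x           ≈⟨ ℚₚ.*-distribʳ-+ x 1ℚᵘ (mkℚᵘ (+ d) 0) ⟨
      (1ℚᵘ + mkℚᵘ (+ d) 0) * x             ≈⟨ ℚₚ.*-congʳ {x} (+-same-denominator 1 d 0) ⟩
      mkℚᵘ (+ suc d) 0 * x                 ∎
    where open import Relation.Binary.Reasoning.Setoid ℚₚ.≃-setoid

  evident : ∀ {p q} {p≤q : True (p ℚₚ.≤? q)} → p ≤ q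
  evident {p≤q = p≤q} = toWitness p≤q

  recip : ℕ → ℚᵘ
  recip d = mkℚᵘ (+ 1) (ℕ.pred d)

  -- What a vertex of degree d collects from each child off the longest path, a
  -- lower bound for 1/√d.  With 7/5d throughout, a branch next to an end of the
  -- longest path would not gain 1/10.
  leafShare : ℕ → ℚᵘ
  leafShare 0                   = 0ℚᵘ
  leafShare 1                   = 0ℚᵘ
  leafShare 2                   = + 7 / 10
  leafShare d@(suc (suc (suc _))) = + 3 / 2 * recip d

  -- What a vertex of degree d off the longest path passes on to its parent.
  passedOn : ℕ → ℚᵘ
  passedOn 0             = 0ℚᵘ
  passedOn 1             = 0ℚᵘ
  passedOn (suc (suc _)) = + 7 / 10

  -- The share of a path edge given to its endpoint of degree d, the other one
  -- having degree d′.  For d, d′ ≥ 2 it comes from (1 - 2/d)(1 - 2/d′) ≥ 0.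
  pathShare : ℕ → ℕ → ℚᵘ
  pathShare d@(suc (suc _)) (suc (suc _)) = recip d - + 1 / 4
  pathShare d@(suc (suc _)) _             = leafShare d
  pathShare _               (suc (suc _)) = 0ℚᵘ
  pathShare _               _             = + 1 / 2

  private
    third : ∀ k → recip (3 ℕ.+ k) ≤ + 1 / 3
    third k = /-mono 1 (2 ℕ.+ k) 1 2 (ℕₚ.*-monoʳ-≤ 1 (ℕₚ.m≤m+n 3 k))

    cancel-recip : ∀ d → mkℚᵘ (+ suc d) 0 * recip (suc d) ≃ 1ℚᵘ
    cancel-recip d = ℚₚ.≃-trans (*-fractions (suc d) 0 1 d)
      (/-cong (suc d ℕ.* 1) (d ℕ.+ 0) 1 0
        (solve 1 (λ d → (con 1 :+ d) :* con 1 :* con 1 := con 1 :* (con 1 :+ (d :+ con 0))) refl d))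
      where open ℕ-Solver

    multiple-leafShare : ∀ k → (3 ℕ.+ k) ⋆ leafShare (3 ℕ.+ k) ≃ + 3 / 2
    multiple-leafShare k = begin
        (3 ℕ.+ k) ⋆ (+ 3 / 2 * z)            ≈⟨ ⋆≃* (3 ℕ.+ k) (+ 3 / 2 * z) ⟩
        mkℚᵘ (+ (3 ℕ.+ k)) 0 * (+ 3 / 2 * z)
          ≈⟨ solve 2 (λ d z → d :* (con (+ 3 / 2) :* z) := con (+ 3 / 2) :* (d :* z)) ℚₚ.≃-refl (mkℚᵘ (+ (3 ℕ.+ k)) 0) z ⟩
        + 3 / 2 * (mkℚᵘ (+ (3 ℕ.+ k)) 0 * z) ≈⟨ ℚₚ.*-congˡ {+ 3 / 2} (cancel-recip (2 ℕ.+ k)) ⟩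
        + 3 / 2 * 1ℚᵘ                        ≈⟨ ℚₚ.*-identityʳ (+ 3 / 2) ⟩
        + 3 / 2                              ∎
      where
      z = recip (3 ℕ.+ k)
      open import Relation.Binary.Reasoning.Setoid ℚₚ.≃-setoid
      open ℚ-Solver

    -- An inequality that is linear in the reciprocal z ≤ 1/3 only has to be
    -- checked at z = 1/3.
    linear : ∀ a b z {p q} → p ≤ a - b * (+ 1 / 3) → .{{ℚᵘ.NonNegative b}} → z ≤ + 1 / 3 →
             q ≃ a - b * z → p ≤ q
    linear a b z {p} {q} p≤ z≤ q≃ = begin
        p                     ≤⟨ p≤ ⟩
        a - b * (+ 1 / 3)     ≤⟨ ℚₚ.+-monoʳ-≤ a (ℚₚ.neg-mono-≤ (ℚₚ.*-monoʳ-≤-nonNeg b z≤)) ⟩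
        a - b * z             ≃⟨ q≃ ⟨
        q                     ∎
      where open ℚₚ.≤-Reasoning

  -- Below, identities with constants are solved in the form p - q ≃ 0ℚᵘ: the
  -- coefficients of unnormalised rationals need not agree on the nose, but they
  -- are recognised when they vanish.
  leafShare-≤ : ∀ d → leafShare d ≤ + 7 / 10
  leafShare-≤ 0 = evident
  leafShare-≤ 1 = evident
  leafShare-≤ 2 = ℚₚ.≤-refl
  leafShare-≤ (suc (suc (suc k))) = ℚₚ.≤-trans (ℚₚ.*-monoʳ-≤-nonNeg (+ 3 / 2) (third k))
    evident

  -- The balance of a vertex with `d - 1` children and a parent. At degree 2 everything collected is
  -- passed on; from degree 3 the surplus is 4/5 - 3/(2d), at least 3/10.
  passedOn-≤ : ∀ d → 0ℚᵘ ≤ d ⋆ leafShare d + (- passedOn d - leafShare d)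
  passedOn-≤ 0 = evident
  passedOn-≤ 1 = evident
  passedOn-≤ 2 = evident
  passedOn-≤ (suc (suc (suc k))) = linear (+ 4 / 5) (+ 3 / 2) z evident (third k)
    (ℚₚ.≃-trans (ℚₚ.+-congˡ (- (+ 7 / 10) - + 3 / 2 * z) (multiple-leafShare k))
      (ℚₚ.p-q≃0⇒p≃q _ _ (solve 1 (λ z → con (+ 3 / 2) :+ (:- con (+ 7 / 10) :- con (+ 3 / 2) :* z)
                          :- (con (+ 4 / 5) :- con (+ 3 / 2) :* z) := con 0ℚᵘ) ℚₚ.≃-refl z)))
    where
    z = recip (3 ℕ.+ k)
    open ℚ-Solver

  0≲1/√ : ∀ m → 0ℝ ≲ 1/√ m
  0≲1/√ zero    = ≲-refl
  0≲1/√ (suc d) = ≤1/√ d 0 0 z≤n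

  -- At degree 2 the claim is 2 · 7² ≤ 10². For larger `d`, 3/(2d) ≤ 1/√d amounts to 9 ≤ 4d.
  leafShare≲1/√ : ∀ d → fromℚ (leafShare d) ≲ 1/√ d
  leafShare≲1/√ 0 = 0≲1/√ 0
  leafShare≲1/√ 1 = 0≲1/√ 1
  leafShare≲1/√ 2 = ≤1/√ 1 7 9 (ℕₚ.m≤m+n 98 2)
  leafShare≲1/√ (suc (suc (suc k))) = ≲-trans
    (proj₁ (fromℚ-cong (*-fractions 3 1 1 (2 ℕ.+ k))))
    (≤1/√ (2 ℕ.+ k) 3 (2 ℕ.+ k ℕ.+ 1 ℕ.* (3 ℕ.+ k)) (begin
      9 ℕ.* (3 ℕ.+ k)                           ≤⟨ ℕₚ.m≤m+n _ (9 ℕ.+ 15 ℕ.* k ℕ.+ 4 ℕ.* (k ℕ.* k)) ⟩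
      9 ℕ.* (3 ℕ.+ k) ℕ.+ (9 ℕ.+ 15 ℕ.* k ℕ.+ 4 ℕ.* (k ℕ.* k))
        ≡⟨ solve 1 (λ k → con 9 :* (con 3 :+ k) :+ (con 9 :+ con 15 :* k :+ con 4 :* (k :* k))
                        := (con 3 :+ k :+ con 1 :* (con 3 :+ k)) :* (con 3 :+ k :+ con 1 :* (con 3 :+ k))) refl k ⟩
      (3 ℕ.+ k ℕ.+ 1 ℕ.* (3 ℕ.+ k)) ℕ.* (3 ℕ.+ k ℕ.+ 1 ℕ.* (3 ℕ.+ k))  ∎))
    where open ℕₚ.≤-Reasoning
          open ℕ-Solver

  private
    half : ∀ d → 0ℚᵘ ≤ + 1 / 2 - recip (2 ℕ.+ d)
    half d = ℚₚ.p≤q⇒0≤q-p (/-mono 1 (suc d) 1 1 (ℕₚ.*-monoʳ-≤ 1 (ℕₚ.m≤m+n 2 d)))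

    -- The right side minus the left side is 2(1/2 - z)(1/2 - z′).
    product-bound : ∀ {z z′} → 0ℚᵘ ≤ + 1 / 2 - z → 0ℚᵘ ≤ + 1 / 2 - z′ →
                    (z - + 1 / 4) + (z′ - + 1 / 4) ≤ + 2 / 1 * (z * z′)
    product-bound {z} {z′} 0≤z 0≤z′ = ℚₚ.p-q≤0⇒p≤q (begin
        (z - + 1 / 4) + (z′ - + 1 / 4) - + 2 / 1 * (z * z′)
          ≃⟨ ℚₚ.p-q≃0⇒p≃q _ _ (solve 2 (λ z z′ → (z :- con (+ 1 / 4)) :+ (z′ :- con (+ 1 / 4)) :- con (+ 2 / 1) :* (z :* z′)
               :- (:- (con (+ 2 / 1) :* ((con (+ 1 / 2) :- z) :* (con (+ 1 / 2) :- z′)))) := con 0ℚᵘ) ℚₚ.≃-refl z z′) ⟩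
        - (+ 2 / 1 * ((+ 1 / 2 - z) * (+ 1 / 2 - z′)))
          ≤⟨ ℚₚ.neg-mono-≤ (ℚₚ.nonNegative⁻¹ _ {{nonNeg}}) ⟩
        - 0ℚᵘ  ∎)
      where
      nonNeg : ℚᵘ.NonNegative (+ 2 / 1 * ((+ 1 / 2 - z) * (+ 1 / 2 - z′)))
      nonNeg = ℚₚ.nonNeg*nonNeg⇒nonNeg (+ 2 / 1) ((+ 1 / 2 - z) * (+ 1 / 2 - z′))
        {{ℚₚ.nonNeg*nonNeg⇒nonNeg (+ 1 / 2 - z) {{ℚᵘ.nonNegative 0≤z}}
                                  (+ 1 / 2 - z′) {{ℚᵘ.nonNegative 0≤z′}}}}
      open ℚₚ.≤-Reasoning
      open ℚ-Solver

    inner-share-≤ : ∀ d d′ → (recip (2 ℕ.+ d) - + 1 / 4) + (recip (2 ℕ.+ d′) - + 1 / 4) ≤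
                             mkℚᵘ (+ 2) ((1 ℕ.+ d′) ℕ.+ (1 ℕ.+ d) ℕ.* (2 ℕ.+ d′))
    inner-share-≤ d d′ = begin
        (recip (2 ℕ.+ d) - + 1 / 4) + (recip (2 ℕ.+ d′) - + 1 / 4)
          ≤⟨ product-bound {recip (2 ℕ.+ d)} {recip (2 ℕ.+ d′)} (half d) (half d′) ⟩
        + 2 / 1 * (recip (2 ℕ.+ d) * recip (2 ℕ.+ d′))
          ≃⟨ ℚₚ.*-congˡ {+ 2 / 1} (*-fractions 1 (1 ℕ.+ d) 1 (1 ℕ.+ d′)) ⟩
        + 2 / 1 * mkℚᵘ (+ 1) m⁻
          ≃⟨ *-fractions 2 0 1 m⁻ ⟩
        mkℚᵘ (+ 2) (m⁻ ℕ.+ 0)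
          ≃⟨ /-cong 2 (m⁻ ℕ.+ 0) 2 m⁻ (cong (λ m → 2 ℕ.* suc m) (sym (ℕₚ.+-identityʳ m⁻))) ⟩
        mkℚᵘ (+ 2) m⁻
          ∎
      where
      m⁻ : ℕ
      m⁻ = (1 ℕ.+ d′) ℕ.+ (1 ℕ.+ d) ℕ.* (2 ℕ.+ d′)
      open ℚₚ.≤-Reasoning

    -- The shares add up to at most 2/m, and 2/m ≤ 1/√m because m ≥ 4. Both steps are equalities
    -- when both degrees are 2.
    inner-share : ∀ d d′ m → (2 ℕ.+ d) ℕ.* (2 ℕ.+ d′) ≡ m →
      fromℚ ((recip (2 ℕ.+ d) - + 1 / 4) + (recip (2 ℕ.+ d′) - + 1 / 4)) ≲ 1/√ m
    inner-share d d′ (suc m⁻) eq = ≲-trans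
      (fromℚ-mono (subst (λ k → _ ≤ mkℚᵘ (+ 2) k) (ℕₚ.suc-injective eq) (inner-share-≤ d d′)))
      (≤1/√ m⁻ 2 m⁻ (ℕₚ.*-monoˡ-≤ (suc m⁻) (subst (4 ℕ.≤_) eq (ℕₚ.*-mono-≤ (ℕₚ.m≤m+n 2 d) (ℕₚ.m≤m+n 2 d′)))))

  -- The product is kept as a variable m, so that 1/√ m is not unfolded.
  pathShare≲1/√ : ∀ d d′ m → d ℕ.* d′ ≡ m → 1 ℕ.≤ d → 1 ℕ.≤ d′ →
                  fromℚ (pathShare d d′ + pathShare d′ d) ≲ 1/√ m
  pathShare≲1/√ 1 1 m eq _ _ = subst (λ m → fromℚ (+ 1 / 2 + + 1 / 2) ≲ 1/√ m) eq
    (≲-trans (fromℚ-mono evident) (≤1/√ 0 1 0 ℕₚ.≤-refl))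
  pathShare≲1/√ 1 d@(suc (suc _)) m eq _ _ =
    subst (λ m → fromℚ (0ℚᵘ + leafShare d) ≲ 1/√ m) (Eq.trans (sym (ℕₚ.*-identityˡ d)) eq)
      (≲-trans (proj₁ (fromℚ-cong (ℚₚ.+-identityˡ (leafShare d)))) (leafShare≲1/√ d))
  pathShare≲1/√ d@(suc (suc _)) 1 m eq _ _ =
    subst (λ m → fromℚ (leafShare d + 0ℚᵘ) ≲ 1/√ m) (Eq.trans (sym (ℕₚ.*-identityʳ d)) eq)
      (≲-trans (proj₁ (fromℚ-cong (ℚₚ.+-identityʳ (leafShare d)))) (leafShare≲1/√ d))
  pathShare≲1/√ (suc (suc d)) (suc (suc d′)) m eq _ _ = inner-share d d′ m eq

  -- An inner vertex of the path has 1/2 to contribute, plus these: the first for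
  -- a neighbour of degree d that ends the path, the second for its own degree d.
  endBonus : ℕ → ℚᵘ
  endBonus (suc (suc _)) = 0ℚᵘ
  endBonus _             = + 9 / 20

  branchBonus : ℕ → ℚᵘ
  branchBonus (suc (suc (suc _))) = + 1 / 10
  branchBonus _                   = 0ℚᵘ

  -- `leafShare` is counted for all `d` neighbours and then replaced by `pathShare` for the two on
  -- the path.
  slack : ℕ → ℕ → ℕ → ℚᵘ
  slack d d⁻ d⁺ = d ⋆ leafShare d + (pathShare d d⁻ - leafShare d) + (pathShare d d⁺ - leafShare d)

  -- At degree 2 an inner neighbour gives 1/4 and an end gives 7/10; the difference is the
  -- `endBonus`. For d ≥ 3 the slack is 3/2, 5/4 - 1/(2d) or 1 - 1/d with two, one or no
  -- neighbouring ends. It is least at d = 3, with values 3/2, 13/12 and 2/3 against the required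
  -- 3/2, 21/20 and 3/5.
  slack-≥ : ∀ d d⁻ d⁺ → 2 ℕ.≤ d →
            + 1 / 2 + endBonus d⁻ + endBonus d⁺ + branchBonus d ≤ slack d d⁻ d⁺
  slack-≥ (suc (suc (suc k))) d⁻ d⁺ _ = branch d⁻ d⁺
    where
    open ℚ-Solver
    z : ℚᵘ
    z = recip (3 ℕ.+ k)
    two-ends : ∀ {p} → p ≤ + 3 / 2 →
      p ≤ (3 ℕ.+ k) ⋆ (+ 3 / 2 * z) + (+ 3 / 2 * z - + 3 / 2 * z) + (+ 3 / 2 * z - + 3 / 2 * z)
    two-ends p≤ = linear (+ 3 / 2) 0ℚᵘ z (ℚₚ.≤-trans p≤ evident) (third k)
      (ℚₚ.≃-trans (ℚₚ.+-congˡ _ (ℚₚ.+-congˡ _ (multiple-leafShare k)))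
        (ℚₚ.p-q≃0⇒p≃q _ _ (solve 1 (λ z → con (+ 3 / 2) :+ (con (+ 3 / 2) :* z :- con (+ 3 / 2) :* z)
          :+ (con (+ 3 / 2) :* z :- con (+ 3 / 2) :* z) :- (con (+ 3 / 2) :- con 0ℚᵘ :* z) := con 0ℚᵘ) ℚₚ.≃-refl z)))
    one-end : ∀ {p} → p ≤ + 5 / 4 - + 1 / 2 * (+ 1 / 3) →
      p ≤ (3 ℕ.+ k) ⋆ (+ 3 / 2 * z) + (+ 3 / 2 * z - + 3 / 2 * z) + (z - + 1 / 4 - + 3 / 2 * z)
    one-end p≤ = linear (+ 5 / 4) (+ 1 / 2) z p≤ (third k)
      (ℚₚ.≃-trans (ℚₚ.+-congˡ _ (ℚₚ.+-congˡ _ (multiple-leafShare k)))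
        (ℚₚ.p-q≃0⇒p≃q _ _ (solve 1 (λ z → con (+ 3 / 2) :+ (con (+ 3 / 2) :* z :- con (+ 3 / 2) :* z)
          :+ (z :- con (+ 1 / 4) :- con (+ 3 / 2) :* z) :- (con (+ 5 / 4) :- con (+ 1 / 2) :* z) := con 0ℚᵘ) ℚₚ.≃-refl z)))
    end-one : ∀ {p} → p ≤ + 5 / 4 - + 1 / 2 * (+ 1 / 3) →
      p ≤ (3 ℕ.+ k) ⋆ (+ 3 / 2 * z) + (z - + 1 / 4 - + 3 / 2 * z) + (+ 3 / 2 * z - + 3 / 2 * z)
    end-one p≤ = ℚₚ.≤-trans (one-end p≤) (ℚₚ.≤-reflexive
      (solve 3 (λ a b c → a :+ b :+ c := a :+ c :+ b) ℚₚ.≃-refl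
        ((3 ℕ.+ k) ⋆ (+ 3 / 2 * z)) (+ 3 / 2 * z - + 3 / 2 * z) (z - + 1 / 4 - + 3 / 2 * z)))
    no-end : (+ 1 / 2 + 0ℚᵘ + 0ℚᵘ + + 1 / 10) ≤
      (3 ℕ.+ k) ⋆ (+ 3 / 2 * z) + (z - + 1 / 4 - + 3 / 2 * z) + (z - + 1 / 4 - + 3 / 2 * z)
    no-end = linear 1ℚᵘ 1ℚᵘ z evident (third k)
      (ℚₚ.≃-trans (ℚₚ.+-congˡ _ (ℚₚ.+-congˡ _ (multiple-leafShare k)))
        (ℚₚ.p-q≃0⇒p≃q _ _ (solve 1 (λ z → con (+ 3 / 2) :+ (z :- con (+ 1 / 4) :- con (+ 3 / 2) :* z)
          :+ (z :- con (+ 1 / 4) :- con (+ 3 / 2) :* z) :- (con 1ℚᵘ :- con 1ℚᵘ :* z) := con 0ℚᵘ) ℚₚ.≃-refl z)))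
    branch : ∀ d⁻ d⁺ → + 1 / 2 + endBonus d⁻ + endBonus d⁺ + + 1 / 10 ≤ slack (3 ℕ.+ k) d⁻ d⁺
    branch 0             0             = two-ends evident
    branch 0             1             = two-ends evident
    branch 1             0             = two-ends evident
    branch 1             1             = two-ends evident
    branch 0             (suc (suc _)) = one-end evident
    branch 1             (suc (suc _)) = one-end evident
    branch (suc (suc _)) 0             = end-one evident
    branch (suc (suc _)) 1             = end-one evident
    branch (suc (suc _)) (suc (suc _)) = no-end
  slack-≥ 1 _ _ (s≤s ())
  slack-≥ 2 0             0             _ = evident
  slack-≥ 2 0             1             _ = evident
  slack-≥ 2 0             (suc (suc _)) _ = evident
  slack-≥ 2 1             0             _ = evident
  slack-≥ 2 1             1             _ = evident
  slack-≥ 2 1             (suc (suc _)) _ = evident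
  slack-≥ 2 (suc (suc _)) 0             _ = evident
  slack-≥ 2 (suc (suc _)) 1             _ = evident
  slack-≥ 2 (suc (suc _)) (suc (suc _)) _ = evident

-- Distribution of the edge weights over the vertices of the rooted tree.

module SpineBound where

  open Reals
  open Sums
  open Spines
  open Weights
  open import Data.Nat as ℕ using (ℕ; zero; suc; z≤n; s≤s)
  import Data.Nat.Properties as ℕₚ
  open import Data.Integer using (+_)
  open import Data.Rational.Unnormalised
    using (ℚᵘ; 0ℚᵘ; _+_; _-_; -_; _≤_; _≃_)
  import Data.Rational.Unnormalised.Properties as ℚₚ
  open import Data.Rational.Unnormalised.Solver using () renaming (module +-*-Solver to ℚ-Solver)
  open import Data.Fin as Fin using (Fin)
  open import Data.List using ([]; _∷_; map; foldr)
  open import Data.List.Membership.Propositional using (_∈_)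
  open import Data.List.Relation.Unary.Any using (here; there)
  open import Data.List.Relation.Unary.All using ([]; _∷_)
  open import Data.List.Relation.Unary.AllPairs using ([]; _∷_)
  open import Data.Product using (_×_; _,_; proj₁; proj₂)
  open import Data.Sum using (inj₁; inj₂)
  open import Function using (_∘_)
  open import Relation.Nullary using (¬_; Dec; yes; no; contradiction)
  open import Relation.Nullary.Decidable using (_×-dec_)
  open import Relation.Binary.PropositionalEquality as Eq using (_≡_; _≢_; refl; cong; sym; subst; trans)

  open FiniteSums ℚₚ.+-0-commutativeMonoid

  sumℝ-≥ : ∀ {a} {A : Set a} (q : A → ℚᵘ) (f : A → ℝ) xs →
           (∀ {x} → x ∈ xs → fromℚ (q x) ≲ f x) →
           fromℚ (listSum q xs) ≲ foldr _⊕_ 0ℝ (map f xs)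
  sumℝ-≥ q f []       le = ≲-refl
  sumℝ-≥ q f (x ∷ xs) le = ≲-trans (proj₂ (fromℚ-⊕ (q x) (listSum q xs)))
    (⊕-mono (le (here refl)) (sumℝ-≥ q f xs (le ∘ there)))

  module _ {n : ℕ} (G : Graph n) where
    open Graph G

    randić-≥ : ∀ (f : Fin n → Fin n → ℚᵘ) →
      (∀ u v → Adj u v → fromℚ (f u v + f v u) ≲ 1/√ (degree G u ℕ.* degree G v)) →
      fromℚ (∑ λ u → neighbourSum G (f u) u) ≲ randić G
    randić-≥ f edge-≥ = subst (fromℚ (∑ λ u → neighbourSum G (f u) u) ≲_)
      (sym (sumℝ≡⊕ (map (λ (u , v) → 1/√ (degree G u ℕ.* degree G v)) (edgeList G))))
      (≲-trans
        (proj₁ (fromℚ-cong (ℚₚ.≃-sym (edge-double-counting G f))))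
        (sumℝ-≥ (λ (u , v) → f u v + f v u) (λ (u , v) → 1/√ (degree G u ℕ.* degree G v)) (edgeList G)
          λ {(u , v)} uv∈ → edge-≥ u v (Adj-edgeList G uv∈)))

    module _ (S : Spine G) (T : ℕ → ℚᵘ) where
      open Spine S

      private
        deg : Fin n → ℕ
        deg = degree G

        Inner : Fin n → Set
        Inner u = OnSpine u × height u ℕ.< D

        onSpine? : ∀ u → Dec (OnSpine u)
        onSpine? u = spine (height u) Fin.≟ u

        inner? : ∀ u → Dec (Inner u)
        inner? u = onSpine? u ×-dec (height u ℕ.<? D)

        next : Fin n → Fin n
        next u = spine (suc (height u))

        -- The amounts that `u` receives from the edge to a child off the path, to its parent, and
        -- to the next vertex of the path. On a path edge `T` is subtracted at the upper end and
        -- added at the lower end.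
        own down up : Fin n → ℚᵘ
        own u = leafShare (deg u)
        down u with onSpine? u
        ... | yes _ = pathShare (deg u) (deg (parent u)) - T (height u)
        ... | no  _ = - passedOn (deg u)
        up u = pathShare (deg u) (deg (next u)) + T (suc (height u))

        down-on : ∀ {u} → OnSpine u → down u ≡ pathShare (deg u) (deg (parent u)) - T (height u)
        down-on {u} on with onSpine? u
        ... | yes _   = refl
        ... | no  off = contradiction on off

        down-off : ∀ {u} → ¬ OnSpine u → down u ≡ - passedOn (deg u)
        down-off {u} off with onSpine? u
        ... | yes on = contradiction on off
        ... | no  _  = refl

        -- Every neighbour is treated as a child off the path and then corrected at two places. In
        -- this additive form the neighbour sum is a multiple of `own u` plus two indicator terms.
        share : Fin n → Fin n → ℚᵘ
        share u v = (own u + when (v Fin.≟ parent u) (down u - own u))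
                  + when (v Fin.≟ next u) (when (inner? u) (up u - own u))

        total : ∀ u → neighbourSum G (share u) u ≃
          (deg u ⋆ own u + when (Adj? u (parent u)) (down u - own u))
            + when (Adj? u (next u)) (when (inner? u) (up u - own u))
        total u = ℚₚ.≃-trans
          (neighbourSum-∙ G (λ v → own u + when (v Fin.≟ parent u) (down u - own u)) _ u)
          (ℚₚ.+-cong
            (ℚₚ.≃-trans (neighbourSum-∙ G (λ _ → own u) _ u)
              (ℚₚ.+-cong (neighbourSum-const G (own u) u) (neighbourSum-single G _ (parent u) u)))
            (neighbourSum-single G _ (next u) u))

        module _ {u v : Fin n} (hv : height v ≡ suc (height u)) (pv : parent v ≡ u) where

          v≢parent : v ≢ parent u
          v≢parent refl = ℕₚ.<-irrefl refl (begin-strict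
              height u                  <⟨ ℕₚ.n<1+n _ ⟩
              suc (height u)            ≡⟨ hv ⟨
              height (parent u)         ≡⟨ height-parent u ⟩
              ℕ.pred (height u)         ≤⟨ ℕₚ.pred[n]≤n ⟩
              height u                  ∎)
            where open ℕₚ.≤-Reasoning

          hu<D : height u ℕ.< D
          hu<D = subst (ℕ._≤ D) hv (height-≤ v)

          share-down : share v u ≃ down v
          share-down = begin
              share v u
                ≈⟨ ℚₚ.+-cong (ℚₚ.+-congʳ (own v) (when-yes (u Fin.≟ parent v) (sym pv))) up-none ⟩
              (own v + (down v - own v)) + 0ℚᵘ
                ≈⟨ solve 2 (λ o d → (o :+ (d :- o)) :+ con 0ℚᵘ := d) ℚₚ.≃-refl (own v) (down v) ⟩
              down v  ∎
            where
            open import Relation.Binary.Reasoning.Setoid ℚₚ.≃-setoid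
            open ℚ-Solver
            next≢ : Inner v → u ≢ next v
            next≢ (_ , hv<D) u≡next = ℕₚ.<⇒≢ (ℕₚ.m<n⇒m<1+n (ℕₚ.n<1+n (height u)))
              (trans (cong height u≡next) (trans (height-spine hv<D) (cong suc hv)))
            up-none : when (u Fin.≟ next v) (when (inner? v) (up v - own v)) ≃ 0ℚᵘ
            up-none with inner? v
            ... | yes inner = when-no (u Fin.≟ next v) (next≢ inner)
            ... | no  _ with u Fin.≟ next v
            ...   | yes _ = ℚₚ.≃-refl
            ...   | no  _ = ℚₚ.≃-refl

          own-only : own u + when (v Fin.≟ parent u) (down u - own u) ≃ own u
          own-only = ℚₚ.≃-trans (ℚₚ.+-congʳ (own u) (when-no (v Fin.≟ parent u) v≢parent))
                                (ℚₚ.+-identityʳ (own u))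

          on-parent : OnSpine v → OnSpine u
          on-parent on = trans (sym (parent-spine hu<D))
                               (trans (cong parent (trans (cong spine (sym hv)) on)) pv)

          share-up-on : OnSpine v → share u v ≃ up u
          share-up-on on = begin
              share u v
                ≈⟨ ℚₚ.+-cong own-only (ℚₚ.≃-trans
                     (when-yes (v Fin.≟ next u) (sym (trans (cong spine (sym hv)) on)))
                     (when-yes (inner? u) (on-parent on , hu<D))) ⟩
              own u + (up u - own u)
                ≈⟨ solve 2 (λ o d → o :+ (d :- o) := d) ℚₚ.≃-refl (own u) (up u) ⟩
              up u  ∎
            where
            open import Relation.Binary.Reasoning.Setoid ℚₚ.≃-setoid
            open ℚ-Solver

          share-up-off : ¬ OnSpine v → share u v ≃ own u
          share-up-off off = ℚₚ.≃-trans
            (ℚₚ.+-cong own-only (when-no (v Fin.≟ next u)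
              λ v≡next → off (trans (cong spine hv) (sym v≡next))))
            (ℚₚ.+-identityʳ (own u))

          degree-child : 1 ℕ.≤ deg v
          degree-child = degree-≥ G ([] ∷ []) (Adj-sym (subst (λ x → Adj x v) pv
            (parent-adj (subst (0 ℕ.<_) (sym hv) (s≤s z≤n)))) ∷ [])

          degree-parent : 1 ℕ.≤ deg u
          degree-parent = degree-≥ G ([] ∷ []) (subst (λ x → Adj x v) pv
            (parent-adj (subst (0 ℕ.<_) (sym hv) (s≤s z≤n))) ∷ [])

          -- A leaf passes nothing on, and its edge weighs 1/√dᵤ. For any other child the 7/10 is at
          -- least `leafShare dᵤ`, so comparing the edge with 0 is enough.
          off-bound : ∀ dᵤ dᵥ m → dᵤ ℕ.* dᵥ ≡ m → 1 ℕ.≤ dᵥ →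
                      fromℚ (leafShare dᵤ + - passedOn dᵥ) ≲ 1/√ m
          off-bound d 1 m eq _ = ≲-trans (proj₁ (fromℚ-cong (ℚₚ.+-identityʳ (leafShare d))))
            (subst (λ m → fromℚ (leafShare d) ≲ 1/√ m) (trans (sym (ℕₚ.*-identityʳ d)) eq) (leafShare≲1/√ d))
          off-bound d (suc (suc _)) m eq _ =
            ≲-trans (fromℚ-mono (ℚₚ.p≤q⇒p-q≤0 (leafShare-≤ d))) (0≲1/√ m)

          -- On a path edge `T` enters with opposite signs at the two ends and cancels, so any
          -- choice of `T` is admissible.
          child-≥ : Dec (OnSpine v) → ∀ m → deg u ℕ.* deg v ≡ m → fromℚ (share u v + share v u) ≲ 1/√ m
          child-≥ (no off) m eq = ≲-trans
            (proj₁ (fromℚ-cong (ℚₚ.+-cong (share-up-off off)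
              (ℚₚ.≃-trans share-down (ℚₚ.≃-reflexive (down-off off))))))
            (off-bound (deg u) (deg v) m eq degree-child)
          child-≥ (yes on) m eq = ≲-trans (proj₁ (fromℚ-cong cancel))
            (pathShare≲1/√ (deg u) (deg v) m eq degree-parent degree-child)
            where
            open import Relation.Binary.Reasoning.Setoid ℚₚ.≃-setoid
            open ℚ-Solver
            next≡v : next u ≡ v
            next≡v = trans (cong spine (sym hv)) on
            cancel : share u v + share v u ≃ pathShare (deg u) (deg v) + pathShare (deg v) (deg u)
            cancel = begin
              share u v + share v u
                ≈⟨ ℚₚ.+-cong (share-up-on on) (ℚₚ.≃-trans share-down (ℚₚ.≃-reflexive (down-on on))) ⟩
              (pathShare (deg u) (deg (next u)) + T (suc (height u)))
                + (pathShare (deg v) (deg (parent v)) - T (height v))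
                ≡⟨ Eq.cong₂ _+_ (Eq.cong₂ (λ w k → pathShare (deg u) (deg w) + T k) next≡v (sym hv))
                                (cong (λ w → pathShare (deg v) (deg w) - T (height v)) pv) ⟩
              (pathShare (deg u) (deg v) + T (height v)) + (pathShare (deg v) (deg u) - T (height v))
                ≈⟨ solve 3 (λ a b t → (a :+ t) :+ (b :- t) := a :+ b) ℚₚ.≃-refl
                     (pathShare (deg u) (deg v)) (pathShare (deg v) (deg u)) (T (height v)) ⟩
              pathShare (deg u) (deg v) + pathShare (deg v) (deg u)  ∎

        edge-≥ : ∀ u v → Adj u v → fromℚ (share u v + share v u) ≲ 1/√ (deg u ℕ.* deg v)
        edge-≥ u v a with edge a
        ... | inj₁ (hv , pv) = child-≥ hv pv (onSpine? v) (deg u ℕ.* deg v) refl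
        ... | inj₂ (hu , pu) = ≲-trans (proj₁ (fromℚ-cong (ℚₚ.+-comm (share u v) (share v u))))
          (child-≥ hu pu (onSpine? u) (deg u ℕ.* deg v) (ℕₚ.*-comm (deg v) (deg u)))

      private
        value : Fin n → ℚᵘ
        value u = (deg u ⋆ own u + when (Adj? u (parent u)) (down u - own u))
                + when (Adj? u (next u)) (when (inner? u) (up u - own u))

        adj-parent : ∀ {u} → 0 ℕ.< height u → Adj u (parent u)
        adj-parent 0<h = Adj-sym (parent-adj 0<h)

        value-off : ∀ {u} → ¬ OnSpine u → 0 ℕ.< height u → 0ℚᵘ ≤ value u
        value-off {u} off 0<h = begin
            0ℚᵘ
              ≤⟨ passedOn-≤ (deg u) ⟩
            deg u ⋆ own u + (- passedOn (deg u) - own u)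
              ≡⟨ cong (λ x → deg u ⋆ own u + (x - own u)) (down-off off) ⟨
            deg u ⋆ own u + (down u - own u)
              ≃⟨ ℚₚ.+-identityʳ _ ⟨
            (deg u ⋆ own u + (down u - own u)) + 0ℚᵘ
              ≃⟨ ℚₚ.+-cong
                   (ℚₚ.+-congʳ (deg u ⋆ own u) (when-yes (Adj? u (parent u)) (adj-parent 0<h)))
                   (ℚₚ.≃-trans (when-cong (Adj? u (next u)) λ _ → when-no (inner? u) λ (on , _) → off on)
                     (when-0 (Adj? u (next u)))) ⟨
            value u  ∎
          where open ℚₚ.≤-Reasoning

        value-inner : ∀ i → suc i ℕ.< D → ∀ {u} → u ≡ spine (suc i) →
          value u ≃ (T (2 ℕ.+ i) + slack (deg u) (deg (spine i)) (deg (spine (2 ℕ.+ i)))) - T (suc i)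
        value-inner i i+1<D {u} refl = begin
            value u
              ≈⟨ ℚₚ.+-cong
                   (ℚₚ.+-congʳ (deg u ⋆ own u) (when-yes (Adj? u (parent u)) (adj-parent (subst (0 ℕ.<_) (sym hu) (s≤s z≤n)))))
                   (ℚₚ.≃-trans (when-yes (Adj? u (next u)) (subst (Adj u) (sym next≡) (spine-adj i+1<D)))
                     (when-yes (inner? u) (on , subst (ℕ._< D) (sym hu) i+1<D))) ⟩
            (deg u ⋆ own u + (down u - own u)) + (up u - own u)
              ≡⟨ Eq.cong₂ (λ a b → (deg u ⋆ own u + (a - own u)) + (b - own u)) down≡ up≡ ⟩
            (deg u ⋆ own u + ((σ⁻ - T (suc i)) - own u)) + ((σ⁺ + T (2 ℕ.+ i)) - own u)
              ≈⟨ solve 6 (λ w o σ⁻ σ⁺ t t′ → (w :+ ((σ⁻ :- t) :- o)) :+ ((σ⁺ :+ t′) :- o)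
                   := (t′ :+ (w :+ (σ⁻ :- o) :+ (σ⁺ :- o))) :- t) ℚₚ.≃-refl
                   (deg u ⋆ own u) (own u) σ⁻ σ⁺ (T (suc i)) (T (2 ℕ.+ i)) ⟩
            (T (2 ℕ.+ i) + slack (deg u) (deg (spine i)) (deg (spine (2 ℕ.+ i)))) - T (suc i)  ∎
          where
          open import Relation.Binary.Reasoning.Setoid ℚₚ.≃-setoid
          open ℚ-Solver
          i<D : i ℕ.< D
          i<D = ℕₚ.<-trans (ℕₚ.n<1+n i) i+1<D
          hu : height u ≡ suc i
          hu = height-spine i<D
          on : OnSpine u
          on = spine-onSpine i<D
          σ⁻ σ⁺ : ℚᵘ
          σ⁻ = pathShare (deg u) (deg (spine i))
          σ⁺ = pathShare (deg u) (deg (spine (2 ℕ.+ i)))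
          next≡ : next u ≡ spine (2 ℕ.+ i)
          next≡ = cong (λ k → spine (suc k)) hu
          down≡ : down u ≡ σ⁻ - T (suc i)
          down≡ = trans (down-on on)
            (Eq.cong₂ (λ w k → pathShare (deg u) (deg w) - T k) (parent-spine i<D) hu)
          up≡ : up u ≡ σ⁺ + T (2 ℕ.+ i)
          up≡ = cong (λ k → pathShare (deg u) (deg (spine (suc k))) + T (suc k)) hu

        value-top : ∀ i → suc i ≡ D → ∀ {u} → u ≡ spine D →
          value u ≃ pathShare 1 (deg (spine i)) - T D
        value-top i i+1≡D {u} refl = begin
            value u
              ≈⟨ ℚₚ.+-cong
                   (ℚₚ.+-congʳ (deg u ⋆ own u) (when-yes (Adj? u (parent u)) (adj-parent (subst (0 ℕ.<_) (sym hu) 0<D))))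
                   (ℚₚ.≃-trans (when-cong (Adj? u (next u)) λ _ → when-no (inner? u) λ (_ , hu<D) → ℕₚ.<-irrefl hu hu<D)
                     (when-0 (Adj? u (next u)))) ⟩
            (deg u ⋆ own u + (down u - own u)) + 0ℚᵘ
              ≡⟨ cong (λ a → (deg u ⋆ own u + (a - own u)) + 0ℚᵘ) down≡ ⟩
            (deg u ⋆ own u + ((pathShare (deg u) (deg (spine i)) - T D) - own u)) + 0ℚᵘ
              ≡⟨ cong (λ d → (d ⋆ leafShare d + ((pathShare d (deg (spine i)) - T D) - leafShare d)) + 0ℚᵘ) (degree-top i+1≡D) ⟩
            (1 ⋆ 0ℚᵘ + ((pathShare 1 (deg (spine i)) - T D) - 0ℚᵘ)) + 0ℚᵘ
              ≈⟨ solve 1 (λ p → (con (1 ⋆ 0ℚᵘ) :+ (p :- con 0ℚᵘ)) :+ con 0ℚᵘ := p) ℚₚ.≃-refl _ ⟩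
            pathShare 1 (deg (spine i)) - T D  ∎
          where
          open import Relation.Binary.Reasoning.Setoid ℚₚ.≃-setoid
          open ℚ-Solver
          0<D : 0 ℕ.< D
          0<D = subst (0 ℕ.<_) i+1≡D (s≤s z≤n)
          hu : height u ≡ D
          hu = height-spine ℕₚ.≤-refl
          parent≡ : parent u ≡ spine i
          parent≡ = trans (cong (parent ∘ spine) (sym i+1≡D)) (parent-spine (subst (i ℕ.<_) i+1≡D (ℕₚ.n<1+n i)))
          down≡ : down u ≡ pathShare (deg u) (deg (spine i)) - T D
          down≡ = trans (down-on (spine-onSpine ℕₚ.≤-refl))
            (Eq.cong₂ (λ w k → pathShare (deg u) (deg w) - T k) parent≡ hu)

        value-bottom : 0 ℕ.< D → ∀ {u} → u ≡ spine 0 → value u ≃ pathShare 1 (deg (spine 1)) + T 1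
        value-bottom 0<D {u} refl = begin
            value u
              ≈⟨ ℚₚ.+-cong
                   -- The `parent` of the root is the root itself, which is not a neighbour, so the
                   -- correction at the parent vanishes.
                   (ℚₚ.+-congʳ (deg u ⋆ own u) (when-no (Adj? u (parent u)) λ a → loopless (subst (Adj u) parent≡ a)))
                   (ℚₚ.≃-trans (when-yes (Adj? u (next u)) (subst (Adj u) (sym next≡) (spine-adj 0<D)))
                     (when-yes (inner? u) (spine-onSpine z≤n , subst (ℕ._< D) (sym hu) 0<D))) ⟩
            (deg u ⋆ own u + 0ℚᵘ) + (up u - own u)
              ≡⟨ cong (λ b → (deg u ⋆ own u + 0ℚᵘ) + (b - own u)) up≡ ⟩
            (deg u ⋆ own u + 0ℚᵘ) + ((pathShare (deg u) (deg (spine 1)) + T 1) - own u)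
              ≡⟨ cong (λ d → (d ⋆ leafShare d + 0ℚᵘ) + ((pathShare d (deg (spine 1)) + T 1) - leafShare d)) (degree-bottom 0<D) ⟩
            (1 ⋆ 0ℚᵘ + 0ℚᵘ) + ((pathShare 1 (deg (spine 1)) + T 1) - 0ℚᵘ)
              ≈⟨ solve 1 (λ p → (con (1 ⋆ 0ℚᵘ) :+ con 0ℚᵘ) :+ (p :- con 0ℚᵘ) := p) ℚₚ.≃-refl _ ⟩
            pathShare 1 (deg (spine 1)) + T 1  ∎
          where
          open import Relation.Binary.Reasoning.Setoid ℚₚ.≃-setoid
          open ℚ-Solver
          hu : height u ≡ 0
          hu = height-spine z≤n
          parent≡ : parent u ≡ u
          parent≡ = height-0 (trans (height-parent u) (cong ℕ.pred hu))
          next≡ : next u ≡ spine 1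
          next≡ = cong (λ k → spine (suc k)) hu
          up≡ : up u ≡ pathShare (deg u) (deg (spine 1)) + T 1
          up≡ = cong (λ k → pathShare (deg u) (deg (spine (suc k))) + T (suc k)) hu

      -- T i is the amount the part of the path from height i on, with everything
      -- hanging off it, sends down to height i ∸ 1.
      spine-bound : 0 ℕ.< D →
        (∀ i → suc i ℕ.< D → T (suc i) ≤ T (2 ℕ.+ i)
          + slack (degree G (spine (suc i))) (degree G (spine i)) (degree G (spine (2 ℕ.+ i)))) →
        (∀ i → suc i ≡ D → T D ≤ pathShare 1 (degree G (spine i))) →
        fromℚ (pathShare 1 (degree G (spine 1)) + T 1) ≲ randić G
      spine-bound 0<D inner-≤ top-≤ = ≲-trans (fromℚ-mono collect) (randić-≥ share edge-≥)
        where
        bottom : ℚᵘ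
        bottom = pathShare 1 (deg (spine 1)) + T 1
        rest : ∀ u → u ≢ spine 0 → ∀ h → height u ≡ h → Dec (OnSpine u) → 0ℚᵘ ≤ value u
        rest u u≢ zero    hu _        = contradiction (height-0 hu) u≢
        rest u u≢ (suc i) hu (no off) = value-off off (subst (0 ℕ.<_) (sym hu) (s≤s z≤n))
        rest u u≢ (suc i) hu (yes on) with ℕₚ.m≤n⇒m<n∨m≡n (subst (ℕ._≤ D) hu (height-≤ u))
        ... | inj₁ i+1<D = ℚₚ.≤-trans
          (ℚₚ.p≤q⇒0≤q-p (subst (λ w → T (suc i) ≤ T (2 ℕ.+ i) + slack (deg w) (deg (spine i)) (deg (spine (2 ℕ.+ i))))
            (sym u≡) (inner-≤ i i+1<D)))
          (ℚₚ.≤-reflexive (ℚₚ.≃-sym (value-inner i i+1<D u≡)))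
          where u≡ = trans (sym on) (cong spine hu)
        ... | inj₂ i+1≡D = ℚₚ.≤-trans (ℚₚ.p≤q⇒0≤q-p (top-≤ i i+1≡D))
          (ℚₚ.≤-reflexive (ℚₚ.≃-sym (value-top i i+1≡D (trans (sym on) (cong spine (trans hu i+1≡D))))))
        -- The vertex sums are compared with a function supported at the root, whose total is
        -- `bottom`.
        vertex : ∀ u → when (u Fin.≟ spine 0) bottom ≤ neighbourSum G (share u) u
        vertex u = ℚₚ.≤-trans (at (u Fin.≟ spine 0)) (ℚₚ.≤-reflexive (ℚₚ.≃-sym (total u)))
          where
          at : (u≟ : Dec (u ≡ spine 0)) → when u≟ bottom ≤ value u
          at (yes u≡) = ℚₚ.≤-reflexive (ℚₚ.≃-sym (value-bottom 0<D u≡))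
          at (no  u≢) = rest u u≢ (height u) refl (onSpine? u)
        collect : bottom ≤ ∑ λ u → neighbourSum G (share u) u
        collect = begin
            bottom
              ≃⟨ when-yes (spine 0 Fin.≟ spine 0) refl ⟨
            when (spine 0 Fin.≟ spine 0) bottom
              ≃⟨ ∑-single (spine 0) (λ u → when (u Fin.≟ spine 0) bottom) (λ u → when-no (u Fin.≟ spine 0)) ⟨
            ∑ (λ u → when (u Fin.≟ spine 0) bottom)
              ≤⟨ ∑-preserves _≤_ ℚₚ.≤-refl ℚₚ.+-mono-≤ vertex ⟩
            ∑ (λ u → neighbourSum G (share u) u)  ∎
          where open ℚₚ.≤-Reasoning

-- Exact values of the index and the radius for paths.

module Exact where

  import Algebra.Bundles
  open Reals
  open Sums
  open Trails
  open Spines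
  open import Data.Nat as ℕ using (ℕ; zero; suc; _≤_; _<_; z≤n; s≤s)
  import Data.Nat.Properties as ℕₚ
  open import Data.Integer using (+_)
  open import Data.Rational.Unnormalised as ℚᵘ using (ℚᵘ; mkℚᵘ; _/_)
  import Data.Rational.Unnormalised.Properties as ℚₚ
  open import Data.Fin as Fin using (Fin; toℕ; fromℕ<)
  import Data.Fin.Properties as Finₚ
  open import Data.Fin.Permutation as Perm using (_⟨$⟩ʳ_; _⟨$⟩ˡ_)
  open import Data.List using ([]; _∷_; map)
  open import Data.List.Membership.Propositional using (_∈_)
  open import Data.List.Relation.Unary.Any using (here; there)
  open import Data.List.Relation.Unary.All using ([]; _∷_)
  open import Data.List.Relation.Unary.AllPairs using ([]; _∷_)
  open import Data.Product using (∃; _×_; _,_)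
  open import Data.Sum using (_⊎_; inj₁; inj₂)
  open import Function.Bundles using (Equivalence)
  open import Relation.Nullary using (yes; no; contradiction)
  open import Relation.Binary.PropositionalEquality as Eq using (_≡_; _≢_; refl; cong; sym; subst; trans)

  open FiniteSums (Algebra.Bundles.AbelianGroup.commutativeMonoid ℝ-abelianGroup)
  open import Algebra.Properties.Monoid.Mult (Algebra.Bundles.AbelianGroup.monoid ℝ-abelianGroup)
    using () renaming (_×_ to _⋆ℝ_)

  module GroupIdentities {c ℓ} (A : Algebra.Bundles.AbelianGroup c ℓ) where
    open Algebra.Bundles.AbelianGroup A renaming (_≈_ to _≈ᴬ_; refl to reflᴬ; sym to symᴬ; trans to transᴬ; ε to 0#)
    open import Algebra.Properties.CommutativeSemigroup
      (Algebra.Bundles.CommutativeMonoid.commutativeSemigroup commutativeMonoid) using (interchange; x∙yz≈y∙xz)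
    open import Relation.Binary.Reasoning.Setoid setoid
    open import Algebra.Properties.AbelianGroup A using (xyx⁻¹≈y)

    shift-out : ∀ {r k d} → r ≈ᴬ k ∙ d → r - k ≈ᴬ d
    shift-out {r} {k} {d} r≈ = transᴬ (∙-congʳ r≈) (xyx⁻¹≈y k d)

    take-from : ∀ s q → s ≈ᴬ (s - q) ∙ q
    take-from s q = symᴬ (transᴬ (assoc s (q ⁻¹) q) (transᴬ (∙-congˡ (inverseˡ q)) (identityʳ s)))

    re-split : ∀ s {q h t} → q ⁻¹ ≈ᴬ h - t → (s - q) ∙ 0# ≈ᴬ h ∙ (s - t)
    re-split s {q} {h} {t} q≈ = begin
      (s - q) ∙ 0#     ≈⟨ identityʳ (s - q) ⟩
      s ∙ q ⁻¹         ≈⟨ ∙-congˡ q≈ ⟩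
      s ∙ (h ∙ t ⁻¹)   ≈⟨ x∙yz≈y∙xz s h (t ⁻¹) ⟩
      h ∙ (s - t)      ∎

    double-difference : ∀ {s t z w} → s ∙ s ≈ᴬ z → t ⁻¹ ∙ t ⁻¹ ≈ᴬ w ⁻¹ → (s - t) ∙ (s - t) ≈ᴬ z - w
    double-difference {s} {t} ss tt = transᴬ (interchange s (t ⁻¹) s (t ⁻¹)) (∙-cong ss tt)

  open GroupIdentities ℝ-abelianGroup

  module _ {n : ℕ} (G : Graph n) where
    open Graph G

    randić-split : ∀ (g : Fin n → ℝ) →
      (∀ u v → Adj u v → 1/√ (degree G u ℕ.* degree G v) ≈ g u ⊕ g v) →
      randić G ≈ ∑ λ u → degree G u ⋆ℝ g u
    randić-split g split = subst (_≈ ∑ λ u → degree G u ⋆ℝ g u)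
      (sym (sumℝ≡⊕ (map (λ (u , v) → 1/√ (degree G u ℕ.* degree G v)) (edgeList G))))
      (edge-sum-split G (λ (u , v) → 1/√ (degree G u ℕ.* degree G v)) g split)

  -- The share of an edge, of weight 1/√2 at the ends of a path and 1/2
  -- elsewhere, that goes to an endpoint of the given degree.
  pathWeight : ℕ → ℝ
  pathWeight 1 = 1/√ 2 ⊕ ⊖ fromℚ (+ 1 / 4)
  pathWeight _ = fromℚ (+ 1 / 4)

  -- An inner vertex collects 2 · 1/4 = 1/2 and an end 1/√2 - 1/4; this is the excess of the end.
  -- Its double √2 - 3/2 is the constant of the theorem.
  δ : ℝ
  δ = 1/√ 2 ⊕ ⊖ fromℚ (+ 3 / 4)

  end-split : 1/√ 2 ≈ pathWeight 1 ⊕ pathWeight 2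
  end-split = take-from (1/√ 2) (fromℚ (+ 1 / 4))

  inner-split : 1/√ 4 ≈ pathWeight 2 ⊕ pathWeight 2
  inner-split = ≈-trans (1/√-square 1)
    (≈-trans (fromℚ-cong (ℚᵘ.*≡* refl)) (≈-sym (fromℚ-⊕ (+ 1 / 4) (+ 1 / 4))))

  end-total : 1 ⋆ℝ pathWeight 1 ≈ fromℚ (+ 1 / 2) ⊕ δ
  end-total = re-split (1/√ 2) (≈-trans (fromℚ-⊖ (+ 1 / 4)) (≈-trans (fromℚ-cong (ℚᵘ.*≡* refl))
    (≈-sym (≈-trans (⊕-cong (≈-refl {fromℚ (+ 1 / 2)}) (fromℚ-⊖ (+ 3 / 4))) (fromℚ-⊕ (+ 1 / 2) (ℚᵘ.- (+ 3 / 4)))))))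

  inner-total : 2 ⋆ℝ pathWeight 2 ≈ fromℚ (+ 1 / 2)
  inner-total = ≈-trans (⊕-cong (≈-refl {fromℚ (+ 1 / 4)}) (fromℚ-⊕ (+ 1 / 4) (+ 0 / 1)))
    (≈-trans (fromℚ-⊕ (+ 1 / 4) (+ 1 / 4 ℚᵘ.+ + 0 / 1)) (fromℚ-cong (ℚᵘ.*≡* refl)))

  δ⊕δ : δ ⊕ δ ≈ √ 2 ⊕ ⊖ fromℚ (+ 3 / 2)
  δ⊕δ = double-difference {1/√ 2} {fromℚ (+ 3 / 4)} {√ 2} {fromℚ (+ 3 / 2)} 1/√2⊕1/√2≈√2
    (≈-trans (⊕-cong (fromℚ-⊖ (+ 3 / 4)) (fromℚ-⊖ (+ 3 / 4)))
      (≈-trans (fromℚ-⊕ (ℚᵘ.- (+ 3 / 4)) (ℚᵘ.- (+ 3 / 4)))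
        (≈-trans (fromℚ-cong (ℚᵘ.*≡* refl)) (≈-sym (fromℚ-⊖ (+ 3 / 2))))))

  EdgeDegrees : ℕ → ℕ → Set
  EdgeDegrees d d′ = (d ≡ 1 × d′ ≡ 2) ⊎ (d ≡ 2 × d′ ≡ 1) ⊎ (d ≡ 2 × d′ ≡ 2)

  edge-split : ∀ {d d′} → EdgeDegrees d d′ → ∀ m → d ℕ.* d′ ≡ m → 1/√ m ≈ pathWeight d ⊕ pathWeight d′
  edge-split (inj₁ (refl , refl))        m eq =
    subst (λ m → 1/√ m ≈ pathWeight 1 ⊕ pathWeight 2) eq end-split
  edge-split (inj₂ (inj₁ (refl , refl))) m eq =
    subst (λ m → 1/√ m ≈ pathWeight 2 ⊕ pathWeight 1) eq
      (≈-trans end-split (⊕-comm (pathWeight 1) (pathWeight 2)))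
  edge-split (inj₂ (inj₂ (refl , refl))) m eq =
    subst (λ m → 1/√ m ≈ pathWeight 2 ⊕ pathWeight 2) eq inner-split

  module _ {n : ℕ} (G : Graph n) (P : IsPath G) where
    open Graph G
    open _≅_ P

    position : Fin n → ℕ
    position v = toℕ (vertices ⟨$⟩ʳ v)

    at : ∀ {i} → i < n → Fin n
    at i<n = vertices ⟨$⟩ˡ fromℕ< i<n

    position-at : ∀ {i} (i<n : i < n) → position (at i<n) ≡ i
    position-at i<n = trans (cong toℕ (Perm.inverseʳ vertices)) (Finₚ.toℕ-fromℕ< i<n)

    at-position : ∀ {i v} (i<n : i < n) → position v ≡ i → v ≡ at i<n
    at-position i<n pv = trans (sym (Perm.inverseˡ vertices))
      (cong (vertices ⟨$⟩ˡ_) (Finₚ.toℕ-injective (trans pv (sym (Finₚ.toℕ-fromℕ< i<n)))))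

    position-< : ∀ v → position v < n
    position-< v = Finₚ.toℕ<n (vertices ⟨$⟩ʳ v)

    adjacent-positions : ∀ {u v} → Adj u v → position v ≡ suc (position u) ⊎ position u ≡ suc (position v)
    adjacent-positions {u} {v} = Equivalence.to (edges u v)

    successive-adjacent : ∀ {u v} → position v ≡ suc (position u) → Adj u v
    successive-adjacent {u} {v} eq = Equivalence.from (edges u v) (inj₁ eq)

    degree-first : ∀ {u} → position u ≡ 0 → 1 < n → degree G u ≡ 1
    degree-first {u} pu 1<n = ℕₚ.≤-antisym
      (degree-≤ G (at 1<n ∷ []) only)
      (degree-≥ G ([] ∷ []) (successive-adjacent (trans (position-at 1<n) (cong suc (sym pu))) ∷ []))
      where
      only : ∀ {v} → Adj u v → v ∈ at 1<n ∷ []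
      only a with adjacent-positions a
      ... | inj₁ pv = here (at-position 1<n (trans pv (cong suc pu)))
      ... | inj₂ pu′ = contradiction (trans (sym pu) pu′) λ ()

    degree-last : ∀ {u i} → position u ≡ suc i → suc (suc i) ≡ n → degree G u ≡ 1
    degree-last {u} {i} pu n≡ = ℕₚ.≤-antisym
      (degree-≤ G (at i<n ∷ []) only)
      (degree-≥ G ([] ∷ []) (Adj-sym (successive-adjacent (trans pu (cong suc (sym (position-at i<n))))) ∷ []))
      where
      i<n : i < n
      i<n = ℕₚ.≤-trans (ℕₚ.n≤1+n (suc i)) (ℕₚ.≤-reflexive n≡)
      only : ∀ {v} → Adj u v → v ∈ at i<n ∷ []
      only {v} a with adjacent-positions a
      ... | inj₁ pv  = contradiction (trans pv (trans (cong suc pu) n≡)) (ℕₚ.<⇒≢ (position-< v))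
      ... | inj₂ pu′ = here (at-position i<n (ℕₚ.suc-injective (trans (sym pu′) pu)))

    degree-between : ∀ {u i} → position u ≡ suc i → suc (suc i) < n → degree G u ≡ 2
    degree-between {u} {i} pu 2+i<n = ℕₚ.≤-antisym
      (degree-≤ G (at i<n ∷ at 2+i<n ∷ []) only)
      (degree-≥ G ((i≢ ∷ []) ∷ [] ∷ [])
        ( Adj-sym (successive-adjacent (trans pu (cong suc (sym (position-at i<n)))))
        ∷ successive-adjacent (trans (position-at 2+i<n) (cong suc (sym pu))) ∷ []))
      where
      i<n : i < n
      i<n = ℕₚ.<-trans (ℕₚ.n<1+n i) (ℕₚ.<-trans (ℕₚ.n<1+n (suc i)) 2+i<n)
      i≢ : at i<n ≢ at 2+i<n
      i≢ eq = ℕₚ.<⇒≢ (ℕₚ.m<n⇒m<1+n (ℕₚ.n<1+n i))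
        (trans (sym (position-at i<n)) (trans (cong position eq) (position-at 2+i<n)))
      only : ∀ {v} → Adj u v → v ∈ at i<n ∷ at 2+i<n ∷ []
      only a with adjacent-positions a
      ... | inj₁ pv  = there (here (at-position 2+i<n (trans pv (cong suc pu))))
      ... | inj₂ pu′ = here (at-position i<n (ℕₚ.suc-injective (trans (sym pu′) pu)))

    start-position-≤ : ∀ {k u v} → Walk G k u v → position u ≤ k ℕ.+ position v
    start-position-≤ [] = ℕₚ.≤-refl
    start-position-≤ {suc k} {u} {v} (_∷_ {v = w} a p) = ℕₚ.≤-trans (step (adjacent-positions a)) (s≤s (start-position-≤ p))
      where
      step : position w ≡ suc (position u) ⊎ position u ≡ suc (position w) → position u ≤ suc (position w)
      step (inj₁ e) = ℕₚ.≤-trans (ℕₚ.n≤1+n _) (ℕₚ.≤-trans (ℕₚ.≤-reflexive (sym e)) (ℕₚ.n≤1+n _))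
      step (inj₂ e) = ℕₚ.≤-reflexive e

    end-position-≤ : ∀ {k u v} → Walk G k u v → position v ≤ k ℕ.+ position u
    end-position-≤ [] = ℕₚ.≤-refl
    end-position-≤ {suc k} {u} {v} (_∷_ {v = w} a p) = ℕₚ.≤-trans (end-position-≤ p)
      (ℕₚ.≤-trans (ℕₚ.+-monoʳ-≤ k (step (adjacent-positions a))) (ℕₚ.≤-reflexive (ℕₚ.+-suc k (position u))))
      where
      step : position w ≡ suc (position u) ⊎ position u ≡ suc (position w) → position w ≤ suc (position u)
      step (inj₁ e) = ℕₚ.≤-reflexive e
      step (inj₂ e) = ℕₚ.≤-trans (ℕₚ.n≤1+n _) (ℕₚ.≤-trans (ℕₚ.≤-reflexive (sym e)) (ℕₚ.n≤1+n _))

    -- Positions change by one along an edge. The positions of the ends are 0 and 2q + 1, and every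
    -- position differs from one of these by at least q + 1.
    radius-path-≥ : (conn : Connected G) → ∀ q → n ≡ suc q ℕ.+ suc q → suc q ≤ radius G conn
    radius-path-≥ conn q n≡ = radius-≥ G conn 0<n far
      where
      0<n : 0 < n
      0<n = subst (0 <_) (sym n≡) (s≤s z≤n)
      last<n : q ℕ.+ suc q < n
      last<n = ℕₚ.≤-reflexive (sym n≡)
      far : ∀ u → ∃ λ v → suc q ≤ dist G conn u v
      far u with suc q ℕ.≤? position u
      ... | yes q<pu = at 0<n , (begin
            suc q                                      ≤⟨ q<pu ⟩
            position u                                 ≤⟨ start-position-≤ (shortest G conn u (at 0<n)) ⟩
            dist G conn u (at 0<n) ℕ.+ position (at 0<n) ≡⟨ cong (dist G conn u (at 0<n) ℕ.+_) (position-at 0<n) ⟩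
            dist G conn u (at 0<n) ℕ.+ 0               ≡⟨ ℕₚ.+-identityʳ _ ⟩
            dist G conn u (at 0<n)                     ∎)
        where open ℕₚ.≤-Reasoning
      ... | no  q≮pu = at last<n , ℕₚ.+-cancelˡ-≤ q (suc q) (dist G conn u (at last<n)) (begin
            q ℕ.+ suc q                                ≡⟨ position-at last<n ⟨
            position (at last<n)                       ≤⟨ end-position-≤ (shortest G conn u (at last<n)) ⟩
            dist G conn u (at last<n) ℕ.+ position u   ≤⟨ ℕₚ.+-monoʳ-≤ (dist G conn u (at last<n)) (ℕ.s≤s⁻¹ (ℕₚ.≰⇒> q≮pu)) ⟩
            dist G conn u (at last<n) ℕ.+ q            ≡⟨ ℕₚ.+-comm _ q ⟩
            q ℕ.+ dist G conn u (at last<n)            ∎)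
        where open ℕₚ.≤-Reasoning

    -- The upper bound comes from the general one: D < n already gives ⌈D/2⌉ ≤ q + 1.
    radius-path : (T : IsTree G) → ∀ q → n ≡ suc q ℕ.+ suc q → radius G (connected T) ≡ suc q
    radius-path T q n≡ with tree-spine G T (subst (0 <_) (sym n≡) (s≤s z≤n))
    ... | S , D<n , r≤ = ℕₚ.≤-antisym
      (ℕₚ.≤-trans r≤ (ℕₚ.≤-trans (ℕₚ.⌈n/2⌉-mono (ℕ.s≤s⁻¹ (subst (Spine.D S <_) n≡ D<n)))
        (ℕₚ.≤-reflexive (sym (ℕₚ.n≡⌊n+n/2⌋ (suc q))))))
      (radius-path-≥ (connected T) q n≡)

    module _ (N : ℕ) (n≡ : n ≡ 3 ℕ.+ N) where

      private
        0<n : 0 < n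
        0<n = subst (0 <_) (sym n≡) (s≤s z≤n)
        1<n : 1 < n
        1<n = subst (1 <_) (sym n≡) (s≤s (s≤s z≤n))
        last<n : 2 ℕ.+ N < n
        last<n = ℕₚ.≤-reflexive (sym n≡)

      -- With at least three vertices no edge joins the two ends, which leaves three patterns of
      -- degrees.
      edge-degrees : ∀ {u v} → position v ≡ suc (position u) → EdgeDegrees (degree G u) (degree G v)
      edge-degrees {u} {v} pv = by (position u) refl (ℕₚ.m≤n⇒m<n∨m≡n (position-< v))
        where
        by : ∀ i → position u ≡ i → suc (position v) < n ⊎ suc (position v) ≡ n →
             EdgeDegrees (degree G u) (degree G v)
        by zero    pu (inj₁ lt) = inj₁ (degree-first pu 1<n ,
          degree-between (trans pv (cong suc pu)) (subst (λ k → suc k < n) (trans pv (cong suc pu)) lt))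
        by zero    pu (inj₂ eq) = contradiction
          (trans (sym n≡) (trans (sym eq) (cong suc (trans pv (cong suc pu))))) λ ()
        by (suc i) pu (inj₁ lt) = inj₂ (inj₂
          ( degree-between pu (subst (_< n) (trans pv (cong suc pu)) (position-< v))
          , degree-between pv (subst (λ k → suc k < n) pv lt)))
        by (suc i) pu (inj₂ eq) = inj₂ (inj₁
          ( degree-between pu (subst (_< n) (trans pv (cong suc pu)) (position-< v))
          , degree-last pv (trans (cong suc (sym pv)) eq)))

      randić-path : randić G ≈ (n ⋆ℝ fromℚ (+ 1 / 2)) ⊕ (δ ⊕ δ)
      randić-path = ≈-trans
        (randić-split G (λ u → pathWeight (degree G u)) split)
        (two-exceptions G {fromℚ (+ 1 / 2)} {1 ⋆ℝ pathWeight 1} {δ}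
          (λ u → degree G u ⋆ℝ pathWeight (degree G u)) {at 0<n} {at last<n} first≢last
          end-total (degree-one (degree-first (position-at 0<n) 1<n))
          (degree-one (degree-last (position-at last<n) (sym n≡))) others)
        where
        split : ∀ u v → Adj u v → 1/√ (degree G u ℕ.* degree G v) ≈ pathWeight (degree G u) ⊕ pathWeight (degree G v)
        split u v a = by-direction (adjacent-positions a)
          where
          by-direction : position v ≡ suc (position u) ⊎ position u ≡ suc (position v) →
            1/√ (degree G u ℕ.* degree G v) ≈ pathWeight (degree G u) ⊕ pathWeight (degree G v)
          by-direction (inj₁ pv) = edge-split (edge-degrees pv) (degree G u ℕ.* degree G v) refl
          by-direction (inj₂ pu) = ≈-trans
            (edge-split (edge-degrees pu) (degree G u ℕ.* degree G v) (ℕₚ.*-comm (degree G v) (degree G u)))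
            (⊕-comm (pathWeight (degree G v)) (pathWeight (degree G u)))
        first≢last : at 0<n ≢ at last<n
        first≢last eq = contradiction
          (trans (sym (position-at 0<n)) (trans (cong position eq) (position-at last<n))) λ ()
        degree-one : ∀ {d} → d ≡ 1 → d ⋆ℝ pathWeight d ≈ 1 ⋆ℝ pathWeight 1
        degree-one refl = ≈-refl
        degree-two : ∀ {d} → d ≡ 2 → d ⋆ℝ pathWeight d ≈ fromℚ (+ 1 / 2)
        degree-two refl = inner-total
        others : ∀ u → u ≢ at 0<n → u ≢ at last<n → degree G u ⋆ℝ pathWeight (degree G u) ≈ fromℚ (+ 1 / 2)
        others u u≢first u≢last = degree-two (two (position u) refl)
          where
          two : ∀ i → position u ≡ i → degree G u ≡ 2
          two zero    pu = contradiction (at-position 0<n pu) u≢first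
          two (suc i) pu with ℕₚ.m≤n⇒m<n∨m≡n (subst (_< n) pu (position-< u))
          ... | inj₁ lt = degree-between pu lt
          ... | inj₂ eq = contradiction
            (at-position last<n (trans pu (ℕₚ.suc-injective (trans eq n≡)))) u≢last

  halves : ∀ q → (q ℕ.+ q) ⋆ℝ fromℚ (+ 1 / 2) ≈ fromℕ q
  halves zero    = ≈-refl
  halves (suc q) = ≈-trans
    (≈-reflexive (cong (_⋆ℝ fromℚ (+ 1 / 2)) {suc q ℕ.+ suc q} {2 ℕ.+ (q ℕ.+ q)} (cong suc (ℕₚ.+-suc q q))))
    (≈-trans (⊕-cong (≈-refl {fromℚ (+ 1 / 2)}) (⊕-cong (≈-refl {fromℚ (+ 1 / 2)}) (halves q)))
      (≈-trans (⊕-cong (≈-refl {fromℚ (+ 1 / 2)}) (fromℚ-⊕ (+ 1 / 2) (mkℚᵘ (+ q) 0)))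
        (≈-trans (fromℚ-⊕ (+ 1 / 2) (+ 1 / 2 ℚᵘ.+ mkℚᵘ (+ q) 0)) (fromℚ-cong
          (ℚₚ.≃-trans (ℚₚ.≃-sym (ℚₚ.+-assoc (+ 1 / 2) (+ 1 / 2) (mkℚᵘ (+ q) 0)))
            (ℚₚ.≃-trans (ℚₚ.+-congˡ (mkℚᵘ (+ q) 0) one)
              (+-same-denominator 1 q 0)))))))
    where
    one : + 1 / 2 ℚᵘ.+ + 1 / 2 ℚᵘ.≃ ℚᵘ.1ℚᵘ
    one = ℚᵘ.*≡* refl

  -- The `n` halves in `randić-path` add up to n/2, which is the radius, so the difference is δ + δ.
  even-path-value : ∀ {n} (G : Graph n) (T : IsTree G) → IsPath G → ∀ q → n ≡ suc q ℕ.+ suc q → 2 < n →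
    randić G ⊕ ⊖ fromℕ (radius G (connected T)) ≈ √ 2 ⊕ ⊖ fromℚ (+ 3 / 2)
  even-path-value G T P zero    refl (s≤s (s≤s ()))
  even-path-value {n} G T P (suc q) n≡ _ = ≈-trans
    (⊕-cong (≈-refl {randić G}) (⊖-cong (≈-reflexive (cong fromℕ (radius-path G P T (suc q) n≡)))))
    (≈-trans (shift-out (≈-trans (randić-path G P (q ℕ.+ suc q) n≡′)
        (⊕-cong (≈-trans (≈-reflexive (cong (_⋆ℝ fromℚ (+ 1 / 2)) n≡)) (halves (2 ℕ.+ q))) (≈-refl {δ ⊕ δ}))))
      δ⊕δ)
    where
    n≡′ : n ≡ 3 ℕ.+ (q ℕ.+ suc q)
    n≡′ = trans n≡ (cong (2 ℕ.+_) (ℕₚ.+-suc q (suc q)))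

  -- The only edge joins two vertices of degree 1, so the weights of `randić-path` do not apply; its
  -- weight 1 is split as 1/2 and 1/2.
  edge-path-value : ∀ {n} (G : Graph n) (T : IsTree G) → IsPath G → n ≡ 2 →
    randić G ⊕ ⊖ fromℕ (radius G (connected T)) ≈ 0ℝ
  edge-path-value G T P refl = ≈-trans
    (⊕-cong (≈-trans total (≈-reflexive (cong fromℕ (sym (radius-path G P T 0 refl)))))
            (≈-refl {⊖ fromℕ (radius G (connected T))}))
    (⊕-inverseʳ (fromℕ (radius G (connected T))))
    where
    ½ : ℝ
    ½ = fromℚ (+ 1 / 2)
    degree-one : ∀ u → degree G u ≡ 1
    degree-one u with position G P u in pu | position-< G P u
    ... | zero          | _ = degree-first G P pu (s≤s (s≤s z≤n))
    ... | suc zero      | _ = degree-last G P pu refl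
    ... | suc (suc _)   | s≤s (s≤s ())
    split : ∀ u v → Graph.Adj G u v → 1/√ (degree G u ℕ.* degree G v) ≈ ½ ⊕ ½
    split u v _ = subst (λ m → 1/√ m ≈ ½ ⊕ ½) (sym (Eq.cong₂ ℕ._*_ (degree-one u) (degree-one v)))
      (≈-trans (1/√-square 0) (≈-trans (fromℚ-cong (ℚᵘ.*≡* refl)) (≈-sym (fromℚ-⊕ (+ 1 / 2) (+ 1 / 2)))))
    total : randić G ≈ fromℕ 1
    total = ≈-trans (randić-split G (λ _ → ½) split)
      (≈-trans (∑-cong λ u → ≈-trans (≈-reflexive (cong (_⋆ℝ ½) (degree-one u))) (one ½))
        (≈-trans (∑-const 2 ½) (halves 1)))
      where
      one : ∀ x → 1 ⋆ℝ x ≈ x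
      one x = ≈-trans (⊕-comm x 0ℝ) (⊕-identityˡ x)

-- The choice of `T` and the resulting bounds in terms of the longest path.

module LowerBound where

  open Reals
  open Sums
  open Spines
  open Weights
  open SpineBound
  open import Data.Nat as ℕ using (ℕ; zero; suc; z≤n; s≤s; _∸_)
  import Data.Nat.Properties as ℕₚ
  open import Data.Integer using (+_)
  open import Data.Rational.Unnormalised
    using (ℚᵘ; mkℚᵘ; 0ℚᵘ; _+_; _≤_; _≃_; _/_; *≡*)
  import Data.Rational.Unnormalised.Properties as ℚₚ
  open import Data.Rational.Unnormalised.Solver using () renaming (module +-*-Solver to ℚ-Solver)
  open import Data.Sum using (_⊎_; inj₁; inj₂)
  open import Relation.Nullary using (Dec; yes; no; contradiction)
  open import Relation.Binary.PropositionalEquality using (_≡_; refl; cong; sym; subst; trans)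

  open FiniteSums ℚₚ.+-0-commutativeMonoid using (when; when-yes; when-no)

  private
    -- An indicator term of `T` may disappear from one height to the next only where a bonus `b` of
    -- the same size pays for it.
    when-mono : ∀ {P Q : Set} (P? : Dec P) (Q? : Dec Q) {x b} → 0ℚᵘ ≤ x → 0ℚᵘ ≤ b →
                (P → Q ⊎ x ≡ b) → when P? x ≤ when Q? x + b
    when-mono (no _)  (no _)  {b = b} 0≤x 0≤b _ = ℚₚ.≤-trans 0≤b (ℚₚ.≤-reflexive (ℚₚ.≃-sym (ℚₚ.+-identityˡ b)))
    when-mono (no _)  (yes _) 0≤x 0≤b _ = ℚₚ.≤-trans (ℚₚ.≤-reflexive (ℚₚ.≃-sym (ℚₚ.+-identityˡ 0ℚᵘ))) (ℚₚ.+-mono-≤ 0≤x 0≤b)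
    when-mono (yes _) (yes _) {x} 0≤x 0≤b _ =
      ℚₚ.≤-trans (ℚₚ.≤-reflexive (ℚₚ.≃-sym (ℚₚ.+-identityʳ x))) (ℚₚ.+-monoʳ-≤ x 0≤b)
    when-mono {Q = Q} (yes p) (no ¬q) {x} {b} 0≤x 0≤b f = by (f p)
      where
      by : Q ⊎ x ≡ b → x ≤ 0ℚᵘ + b
      by (inj₁ q)    = contradiction q ¬q
      by (inj₂ refl) = ℚₚ.≤-reflexive (ℚₚ.≃-sym (ℚₚ.+-identityˡ x))

    0≤endBonus : ∀ d → 0ℚᵘ ≤ endBonus d
    0≤endBonus 0             = evident
    0≤endBonus 1             = evident
    0≤endBonus (suc (suc _)) = evident

    0≤branchBonus : ∀ d → 0ℚᵘ ≤ branchBonus d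
    0≤branchBonus 0                   = evident
    0≤branchBonus 1                   = evident
    0≤branchBonus 2                   = evident
    0≤branchBonus (suc (suc (suc _))) = evident

    endBonus-1 : ∀ {d} → d ≡ 1 → + 9 / 20 ≡ endBonus d
    endBonus-1 refl = refl

    branchBonus-3 : ∀ {d} → 3 ℕ.≤ d → + 1 / 10 ≡ branchBonus d
    branchBonus-3 (s≤s (s≤s (s≤s _))) = refl

  module _ {n : ℕ} (G : Graph n) (S : Spine G) where
    open Spine S

    -- Both ends have degree 1 and a share of 1/2; the constant `T` carries the share of the upper
    -- end down to the root.
    single-edge-bound : D ≡ 1 → fromℕ 1 ≲ randić G
    single-edge-bound D≡1 = ≲-trans (fromℚ-mono enough)
      (spine-bound G S (λ _ → + 1 / 2) (ℕₚ.≤-reflexive (sym D≡1))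
        (λ i i+1<D → contradiction (subst (suc i ℕ.<_) D≡1 i+1<D) λ { (s≤s ()) })
        top)
      where
      half-≤ : ∀ {d} → d ≡ 1 → + 1 / 2 ≤ pathShare 1 d
      half-≤ refl = ℚₚ.≤-refl
      top : ∀ i → suc i ≡ D → + 1 / 2 ≤ pathShare 1 (degree G (spine i))
      top zero    _   = half-≤ (degree-bottom (ℕₚ.≤-reflexive (sym D≡1)))
      top (suc i) eq  = contradiction (trans eq D≡1) λ ()
      enough : mkℚᵘ (+ 1) 0 ≤ pathShare 1 (degree G (spine 1)) + + 1 / 2
      enough = ℚₚ.≤-trans (evident {mkℚᵘ (+ 1) 0} {+ 1 / 2 + + 1 / 2}) (ℚₚ.+-monoˡ-≤ (+ 1 / 2)
        (half-≤ (trans (cong (λ k → degree G (spine k)) (sym D≡1)) (degree-top (sym D≡1)))))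

    -- k = 0 stands for the absence of a known branch vertex on the path.
    branched-bound : 2 ℕ.≤ D → ∀ k → k ℕ.< D → (∀ i → suc i ≡ k → 3 ℕ.≤ degree G (spine k)) →
      ∀ {q} → q ≤ mkℚᵘ (+ (D ∸ 1)) 1 + + 9 / 10 + when (1 ℕ.≤? k) (+ 1 / 10) → fromℚ q ≲ randić G
    branched-bound 2≤D k k<D branch {q} q≤ = ≲-trans
      {fromℚ q} {fromℚ (pathShare 1 (degree G (spine 1)) + T 1)} {randić G}
      (fromℚ-mono (ℚₚ.≤-trans q≤ start)) (spine-bound G S T 0<D inner top)
      where
      0<D : 0 ℕ.< D
      0<D = ℕₚ.<-trans (s≤s z≤n) 2≤D
      T : ℕ → ℚᵘ
      -- What the vertices from height `i` on collect: 1/2 for each of the `D - i` inner ones, 9/20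
      -- at height `D - 1` for the top end, 9/20 at height 1 for the bottom end, and 1/10 at height
      -- `k` for the branch. All terms vanish at `D`.
      T i = mkℚᵘ (+ (D ∸ i)) 1 + when (i ℕ.<? D) (+ 9 / 20) + when (i ℕ.≤? 1) (+ 9 / 20) + when (i ℕ.≤? k) (+ 1 / 10)
      inner : ∀ i → suc i ℕ.< D → T (suc i) ≤ T (2 ℕ.+ i)
        + slack (degree G (spine (suc i))) (degree G (spine i)) (degree G (spine (2 ℕ.+ i)))
      inner i i+1<D = begin
          T (suc i)
            ≤⟨ ℚₚ.+-mono-≤ (ℚₚ.+-mono-≤ (ℚₚ.+-mono-≤ length-step top-step) bottom-step) branch-step ⟩
          (L + + 1 / 2) + (A + e⁺) + (B + e⁻) + (C + b)
            ≃⟨ solve 8 (λ L h A e⁺ B e⁻ C b → (L :+ h) :+ (A :+ e⁺) :+ (B :+ e⁻) :+ (C :+ b)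
                 := (L :+ A :+ B :+ C) :+ (h :+ e⁻ :+ e⁺ :+ b)) ℚₚ.≃-refl L (+ 1 / 2) A e⁺ B e⁻ C b ⟩
          T (2 ℕ.+ i) + (+ 1 / 2 + e⁻ + e⁺ + b)
            ≤⟨ ℚₚ.+-monoʳ-≤ (T (2 ℕ.+ i)) (slack-≥ d d⁻ d⁺ (degree-inner i+1<D)) ⟩
          T (2 ℕ.+ i) + slack d d⁻ d⁺  ∎
        where
        open ℚₚ.≤-Reasoning
        open ℚ-Solver
        d d⁻ d⁺ : ℕ
        d  = degree G (spine (suc i))
        d⁻ = degree G (spine i)
        d⁺ = degree G (spine (2 ℕ.+ i))
        e⁻ e⁺ b L A B C : ℚᵘ
        e⁻ = endBonus d⁻
        e⁺ = endBonus d⁺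
        b  = branchBonus d
        L  = mkℚᵘ (+ (D ∸ (2 ℕ.+ i))) 1
        A  = when (2 ℕ.+ i ℕ.<? D) (+ 9 / 20)
        B  = when (2 ℕ.+ i ℕ.≤? 1) (+ 9 / 20)
        C  = when (2 ℕ.+ i ℕ.≤? k) (+ 1 / 10)
        length-step : mkℚᵘ (+ (D ∸ suc i)) 1 ≤ L + + 1 / 2
        length-step = ℚₚ.≤-reflexive (ℚₚ.≃-sym (ℚₚ.≃-trans (+-same-denominator (D ∸ (2 ℕ.+ i)) 1 1)
          (ℚₚ.≃-reflexive (cong (λ m → mkℚᵘ (+ m) 1)
            (trans (ℕₚ.+-comm (D ∸ (2 ℕ.+ i)) 1) (sym (ℕₚ.+-∸-assoc 1 i+1<D)))))))
        top-step : when (suc i ℕ.<? D) (+ 9 / 20) ≤ A + e⁺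
        top-step = when-mono (suc i ℕ.<? D) (2 ℕ.+ i ℕ.<? D) evident (0≤endBonus d⁺)
          λ _ → top-case (ℕₚ.m≤n⇒m<n∨m≡n i+1<D)
          where
          top-case : 2 ℕ.+ i ℕ.< D ⊎ 2 ℕ.+ i ≡ D → 2 ℕ.+ i ℕ.< D ⊎ + 9 / 20 ≡ e⁺
          top-case (inj₁ lt) = inj₁ lt
          top-case (inj₂ eq) = inj₂ (endBonus-1
            (trans (cong (λ j → degree G (spine j)) eq) (degree-top eq)))
        bottom-step : when (suc i ℕ.≤? 1) (+ 9 / 20) ≤ B + e⁻
        bottom-step = when-mono (suc i ℕ.≤? 1) (2 ℕ.+ i ℕ.≤? 1) evident (0≤endBonus d⁻)
          λ { (s≤s z≤n) → inj₂ (endBonus-1 (degree-bottom 0<D)) }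
        branch-step : when (suc i ℕ.≤? k) (+ 1 / 10) ≤ C + b
        branch-step = when-mono (suc i ℕ.≤? k) (2 ℕ.+ i ℕ.≤? k) evident (0≤branchBonus d)
          λ i<k → branch-case (ℕₚ.m≤n⇒m<n∨m≡n i<k)
          where
          branch-case : suc i ℕ.< k ⊎ suc i ≡ k → 2 ℕ.+ i ℕ.≤ k ⊎ + 1 / 10 ≡ b
          branch-case (inj₁ lt) = inj₁ lt
          branch-case (inj₂ eq) = inj₂ (branchBonus-3 (subst (λ j → 3 ℕ.≤ degree G (spine j)) (sym eq) (branch i eq)))
      0≤pathShare : ∀ d → 0ℚᵘ ≤ pathShare 1 d
      0≤pathShare 0             = evident
      0≤pathShare 1             = evident
      0≤pathShare (suc (suc _)) = evident
      top : ∀ i → suc i ≡ D → T D ≤ pathShare 1 (degree G (spine i))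
      top i _ = ℚₚ.≤-trans (ℚₚ.≤-reflexive zero-at-top) (0≤pathShare (degree G (spine i)))
        where
        zero-at-top : T D ≃ 0ℚᵘ
        zero-at-top = ℚₚ.≃-trans
          (ℚₚ.+-cong (ℚₚ.+-cong (ℚₚ.+-cong (ℚₚ.≃-reflexive (cong (λ m → mkℚᵘ (+ m) 1) (ℕₚ.n∸n≡0 D)))
            (when-no (D ℕ.<? D) (ℕₚ.<-irrefl refl))) (when-no (D ℕ.≤? 1) (ℕₚ.<⇒≱ 2≤D)))
            (when-no (D ℕ.≤? k) (ℕₚ.<⇒≱ k<D)))
          (*≡* refl)
      start : mkℚᵘ (+ (D ∸ 1)) 1 + + 9 / 10 + when (1 ℕ.≤? k) (+ 1 / 10) ≤ pathShare 1 (degree G (spine 1)) + T 1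
      start = begin
          l + + 9 / 10 + C
            ≃⟨ ℚₚ.+-congˡ C (ℚₚ.p-q≃0⇒p≃q _ _ (solve 1
                 (λ l → l :+ con (+ 9 / 10) :- (l :+ con (+ 9 / 20) :+ con (+ 9 / 20)) := con 0ℚᵘ)
                 ℚₚ.≃-refl l)) ⟩
          l + + 9 / 20 + + 9 / 20 + C
            ≃⟨ ℚₚ.+-congˡ C (ℚₚ.+-cong (ℚₚ.+-congʳ l (when-yes (1 ℕ.<? D) 2≤D)) (when-yes (1 ℕ.≤? 1) ℕₚ.≤-refl)) ⟨
          T 1
            ≃⟨ ℚₚ.+-identityˡ (T 1) ⟨
          0ℚᵘ + T 1
            ≤⟨ ℚₚ.+-monoˡ-≤ (T 1) (0≤pathShare (degree G (spine 1))) ⟩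
          pathShare 1 (degree G (spine 1)) + T 1  ∎
        where
        open ℚₚ.≤-Reasoning
        open ℚ-Solver
        l C : ℚᵘ
        l = mkℚᵘ (+ (D ∸ 1)) 1
        C = when (1 ℕ.≤? k) (+ 1 / 10)

    private
      -- (c + D)/2 = (D - 1)/2 + (c + 1)/2. Without a branch `c` is 0 and 9/10 covers 1/2; with one
      -- `c` is 1 and 9/10 + 1/10 is exactly what is required.
      half-length : 2 ℕ.≤ D → ∀ c {q} → mkℚᵘ (+ suc c) 1 ≤ q →
        mkℚᵘ (+ (c ℕ.+ D)) 1 ≤ mkℚᵘ (+ (D ∸ 1)) 1 + q
      half-length 2≤D c {q} c≤q = begin
          mkℚᵘ (+ (c ℕ.+ D)) 1
            ≡⟨ cong (λ m → mkℚᵘ (+ m) 1) c+D≡ ⟩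
          mkℚᵘ (+ (D ∸ 1 ℕ.+ suc c)) 1
            ≃⟨ +-same-denominator (D ∸ 1) (suc c) 1 ⟨
          mkℚᵘ (+ (D ∸ 1)) 1 + mkℚᵘ (+ suc c) 1
            ≤⟨ ℚₚ.+-monoʳ-≤ (mkℚᵘ (+ (D ∸ 1)) 1) c≤q ⟩
          mkℚᵘ (+ (D ∸ 1)) 1 + q  ∎
        where
        open ℚₚ.≤-Reasoning
        c+D≡ : c ℕ.+ D ≡ D ∸ 1 ℕ.+ suc c
        c+D≡ = trans (ℕₚ.+-comm c D) (trans
          (cong (ℕ._+ c) (sym (ℕₚ.m∸n+n≡m {D} {1} (ℕₚ.≤-trans (s≤s z≤n) 2≤D))))
          (ℕₚ.+-assoc (D ∸ 1) 1 c))

    long-path-bound : 2 ℕ.≤ D → fromℚ (mkℚᵘ (+ D) 1) ≲ randić G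
    long-path-bound 2≤D = branched-bound 2≤D 0 (ℕₚ.≤-trans (s≤s z≤n) 2≤D) (λ _ ())
      (ℚₚ.≤-trans (half-length 2≤D 0 {+ 9 / 10 + 0ℚᵘ} evident)
        (ℚₚ.≤-reflexive (ℚₚ.≃-sym (ℚₚ.+-assoc (mkℚᵘ (+ (D ∸ 1)) 1) (+ 9 / 10) 0ℚᵘ))))

    branch-bound : ∀ i → suc i ℕ.< D → 3 ℕ.≤ degree G (spine (suc i)) →
                   fromℚ (mkℚᵘ (+ suc D) 1) ≲ randić G
    branch-bound i i+1<D 3≤deg = branched-bound 2≤D (suc i) i+1<D (λ { _ refl → 3≤deg })
      (ℚₚ.≤-trans (half-length 2≤D 1 {+ 9 / 10 + + 1 / 10} evident)
        (ℚₚ.≤-reflexive (ℚₚ.≃-sym (ℚₚ.+-assoc (mkℚᵘ (+ (D ∸ 1)) 1) (+ 9 / 10) (+ 1 / 10)))))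
      where
      2≤D : 2 ℕ.≤ D
      2≤D = ℕₚ.≤-trans (s≤s (s≤s z≤n)) i+1<D

-- Comparison of the index with the radius, by the parity of the order.

open Reals
open Spines
open Exact
open LowerBound
open import Data.Nat as ℕ using (ℕ; zero; suc; _≤_; _<_; z≤n; s≤s)
import Data.Nat.Properties as ℕₚ
open import Data.Nat.Divisibility using (_∣_; divides)
open import Data.Integer using (+_)
open import Data.Rational.Unnormalised using (mkℚᵘ; _/_)
open import Data.Fin as Fin using (Fin)
import Data.Fin.Properties as Finₚ
open import Data.Product using (∃; _×_; _,_; proj₁; proj₂)
open import Relation.Nullary using (¬_; Dec; yes; no; contradiction)
open import Relation.Binary.PropositionalEquality as Eq
  using (_≡_; _≢_; refl; cong; sym; subst; trans)

private
  halves-≤ : ∀ m → ℕ.⌊ m /2⌋ ℕ.+ ℕ.⌊ m /2⌋ ≤ m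
  halves-≤ m = ℕₚ.≤-trans (ℕₚ.+-monoʳ-≤ ℕ.⌊ m /2⌋ (ℕₚ.⌊n/2⌋≤⌈n/2⌉ m)) (ℕₚ.≤-reflexive (ℕₚ.⌊n/2⌋+⌈n/2⌉≡n m))

  halves-< : ∀ m → ¬ 2 ∣ m → ℕ.⌊ m /2⌋ ℕ.+ ℕ.⌊ m /2⌋ < m
  halves-< m odd = ℕₚ.≤∧≢⇒< (halves-≤ m) λ eq → odd (divides ℕ.⌊ m /2⌋
    (trans (sym eq) (trans (cong (ℕ.⌊ m /2⌋ ℕ.+_) (sym (ℕₚ.+-identityʳ _))) (ℕₚ.*-comm 2 ℕ.⌊ m /2⌋))))

fromℕ≲half : ∀ {r m x} → r ℕ.+ r ≤ m → fromℚ (mkℚᵘ (+ m) 1) ≲ x → fromℕ r ≲ x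
fromℕ≲half {r} {m} {x} r+r≤m = ≲-trans {fromℕ r} {fromℚ (mkℚᵘ (+ m) 1)} {x}
  (fromℚ-mono (/-mono r 0 m 1 (Eq.subst₂ _≤_ r+r≡ (sym (ℕₚ.*-identityʳ m)) r+r≤m)))
  where
  r+r≡ : r ℕ.+ r ≡ r ℕ.* 2
  r+r≡ = sym (trans (ℕₚ.*-comm r 2) (cong (r ℕ.+_) (ℕₚ.+-identityʳ r)))

distinct : ∀ {n} → 2 ≤ n → ∃ λ (u : Fin n) → ∃ λ v → u ≢ v
distinct (s≤s (s≤s _)) = Fin.zero , Fin.suc Fin.zero , λ ()

module _ {n : ℕ} (2≤n : 2 ≤ n) (G : Graph n) (S : Spine G)
         (not-even-path : ¬ (IsPath G × 2 ∣ n × 2 < n)) (r : ℕ) where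
  open Spine S

  -- In general `r + r ≤ D + 1`. For D ≥ 2, if the spine covers the tree, then D + 1 = n is odd,
  -- which improves this to `r + r ≤ D`; otherwise a branch vertex raises the bound on the index to
  -- (D + 1)/2. The case D = 1 is separate, as a path on two vertices is even but not excluded.
  half-longest≲randić : r ≤ ℕ.⌈ D /2⌉ → fromℕ r ≲ randić G
  half-longest≲randić r≤ = by-length D refl
    where
    -- ⌈D/2⌉ is by definition ⌊(D + 1)/2⌋, which brings in the parity of D + 1.
    r+r≤n : r ℕ.+ r ≤ ℕ.⌊ suc D /2⌋ ℕ.+ ℕ.⌊ suc D /2⌋
    r+r≤n = ℕₚ.+-mono-≤ r≤ r≤
    by-length : ∀ d → D ≡ d → fromℕ r ≲ randić G
    by-length zero D≡ = contradiction
      (trans (height-0 (flat (proj₁ (distinct 2≤n)))) (sym (height-0 (flat (proj₁ (proj₂ (distinct 2≤n)))))))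
      (proj₂ (proj₂ (distinct 2≤n)))
      where
      flat : ∀ v → height v ≡ 0
      flat v = ℕₚ.n≤0⇒n≡0 (subst (height v ≤_) D≡ (height-≤ v))
    by-length (suc zero) D≡ = ≲-trans {fromℕ r} {fromℕ 1} {randić G}
      (fromℚ-mono (/-mono r 0 1 0 (ℕₚ.*-monoˡ-≤ 1 (subst (λ d → r ≤ ℕ.⌈ d /2⌉) D≡ r≤))))
      (single-edge-bound G S D≡)
    by-length (suc (suc e)) D≡ = by-cover (Finₚ.all? λ v → spine (height v) Fin.≟ v)
      where
      2≤D : 2 ≤ D
      2≤D = subst (2 ≤_) (sym D≡) (s≤s (s≤s z≤n))
      by-cover : Dec (∀ v → OnSpine v) → fromℕ r ≲ randić G
      by-cover (yes all-on) = fromℕ≲half {r} {D} {randić G}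
        (ℕ.s≤s⁻¹ (ℕₚ.≤-<-trans r+r≤n (halves-< (suc D) odd))) (long-path-bound G S 2≤D)
        where
        order : n ≡ suc D
        order = spine-order all-on
        odd : ¬ 2 ∣ suc D
        odd even = not-even-path (spine-isPath all-on , subst (2 ∣_) (sym order) even ,
                                  subst (2 <_) (sym order) (s≤s 2≤D))
      by-cover (no ¬all-on) = by-branch (branch-vertex (proj₁ off) (proj₂ off))
        where
        off : ∃ λ v → ¬ OnSpine v
        off = Finₚ.¬∀⟶∃¬ n OnSpine (λ v → spine (height v) Fin.≟ v) ¬all-on
        by-branch : (∃ λ i → suc i < D × 3 ≤ degree G (spine (suc i))) → fromℕ r ≲ randić G
        by-branch (i , i+1<D , 3≤deg) = fromℕ≲half {r} {suc D} {randić G}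
          (ℕₚ.≤-trans r+r≤n (halves-≤ (suc D))) (branch-bound G S i i+1<D 3≤deg)

radius≲randić : ∀ {n} → 2 ≤ n → (G : Graph n) (T : IsTree G) →
  ¬ (IsPath G × 2 ∣ n × 2 < n) → fromℕ (radius G (connected T)) ≲ randić G
radius≲randić 2≤n G T not-even-path = by-spine (tree-spine G T (ℕₚ.≤-trans (s≤s z≤n) 2≤n))
  where
  by-spine : (∃ λ S → Spine.D S < _ × radius G (connected T) ≤ ℕ.⌈ Spine.D S /2⌉) →
             fromℕ (radius G (connected T)) ≲ randić G
  by-spine (S , _ , r≤) = half-longest≲randić 2≤n G S not-even-path (radius G (connected T)) r≤

≈⇒≃ℝ : ∀ {x y} → x ≈ y → x ≃ℝ y
≈⇒≃ℝ (x≲y , y≲x) = ≲⇒≤ℝ x≲y , ≲⇒≤ℝ y≲x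

≈⇒-ℝ≃-ℝ : ∀ x y u v → x ⊕ ⊖ y ≈ u ⊕ ⊖ v → x -ℝ y ≃ℝ u -ℝ v
≈⇒-ℝ≃-ℝ x y u v eq = ≈⇒≃ℝ {x -ℝ y} {u -ℝ v}
  (≈-trans {x -ℝ y} {x ⊕ ⊖ y} {u -ℝ v} (-ℝ≈⊕⊖ x y)
    (≈-trans {x ⊕ ⊖ y} {u ⊕ ⊖ v} {u -ℝ v} eq (≈-sym {u -ℝ v} {u ⊕ ⊖ v} (-ℝ≈⊕⊖ u v))))

≈⇒-ℝ≃0 : ∀ x y → x ⊕ ⊖ y ≈ 0ℝ → x -ℝ y ≃ℝ 0ℝ
≈⇒-ℝ≃0 x y eq = ≈⇒≃ℝ {x -ℝ y} {0ℝ} (≈-trans {x -ℝ y} {x ⊕ ⊖ y} {0ℝ} (-ℝ≈⊕⊖ x y) eq)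

≲⇒0≤-ℝ : ∀ x y → y ≲ x → 0ℝ ≤ℝ x -ℝ y
≲⇒0≤-ℝ x y y≲x = ≲⇒≤ℝ {0ℝ} {x -ℝ y} (≲-trans {0ℝ} {y ⊕ ⊖ y} {x -ℝ y} (proj₂ (⊕-inverseʳ y))
  (≲-trans {y ⊕ ⊖ y} {x ⊕ ⊖ y} {x -ℝ y} (⊕-mono {y} {x} {⊖ y} {⊖ y} y≲x ≲-refl) (proj₂ (-ℝ≈⊕⊖ x y))))

theorem5p1 : ∀ (n : ℕ) → 2 ≤ n → (G : Graph n) (T : IsTree G) →
    let R = randić G
        r = fromℕ (radius G (connected T))
        EvenPath>2 = IsPath G × 2 ∣ n × 2 < n
    in (EvenPath>2 → R -ℝ r ≃ℝ (√ 2) -ℝ fromℚ (+ 3 / 2))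
     × (¬ EvenPath>2 → 0ℝ ≤ℝ R -ℝ r)
     × (IsPath G × n ≡ 2 → R -ℝ r ≃ℝ 0ℝ)
theorem5p1 n 2≤n G T = even-path , other , edge-path
  where
  even-path : IsPath G × 2 ∣ n × 2 < n →
    randić G -ℝ fromℕ (radius G (connected T)) ≃ℝ (√ 2) -ℝ fromℚ (+ 3 / 2)
  even-path (P , divides zero n≡ , 2<n) = contradiction (subst (2 <_) n≡ 2<n) λ ()
  even-path (P , divides (suc q) n≡ , 2<n) =
    ≈⇒-ℝ≃-ℝ (randić G) (fromℕ (radius G (connected T))) (√ 2) (fromℚ (+ 3 / 2))
      (even-path-value G T P q n≡′ 2<n)
    where
    n≡′ : n ≡ suc q ℕ.+ suc q
    n≡′ = trans n≡ (trans (ℕₚ.*-comm (suc q) 2) (cong (suc q ℕ.+_) (ℕₚ.+-identityʳ (suc q))))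
  other : ¬ (IsPath G × 2 ∣ n × 2 < n) → 0ℝ ≤ℝ randić G -ℝ fromℕ (radius G (connected T))
  other not-even-path =
    ≲⇒0≤-ℝ (randić G) (fromℕ (radius G (connected T))) (radius≲randić 2≤n G T not-even-path)
  edge-path : IsPath G × n ≡ 2 → randić G -ℝ fromℕ (radius G (connected T)) ≃ℝ 0ℝ
  edge-path (P , n≡2) =
    ≈⇒-ℝ≃0 (randić G) (fromℕ (radius G (connected T))) (edge-path-value G T P n≡2)
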